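{- Let $P\subset\mathbb{R}^d$ be a smooth $d$-dimensional lattice polytope such that $P\cap\mathbb{Z}^d$ equals the vertex set of $P$. Then $P$ is lattice equivalent to a product of unimodular simplices.
   Context: A lattice polytope is smooth if it is simple and at every vertex the primitive integer vectors along the incident edges form a basis of the lattice $\mathbb{Z}^d$. Lattice equivalence means equivalence under an affine map preserving the lattice; a unimodular simplex is one lattice-equivalent to $\operatorname{conv}\{0,e_1,\dots,e_k\}$. -}

module Defs where

open import Data.Nat as ℕ using (ℕ; zero; suc)
open import Data.Integer as ℤ using (ℤ; +_)
open import Data.Integer.Divisibility using () renaming (_∣_ to _∣ℤ_)
open import Data.Rational as ℚ using (ℚ; 0ℚ; 1ℚ)
open import Data.Fin using (Fin)
open import Data.Vec as V using (Vec; []; _∷_)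
open import Data.List as L using (List)
open import Data.Nat.ListAction using (sum)
open import Data.Product using (Σ; ∃; _×_; _,_)
open import Data.Unit using (⊤)
open import Function.Bundles using (_⇔_)
open import Relation.Binary.PropositionalEquality using (_≡_; _≢_)

Point : ℕ → Set
Point = Vec ℚ

embed : ∀ {d} → Vec ℤ d → Point d
embed = V.map (λ z → z ℚ./ 1)

zeroP : ∀ {d} → Point d
zeroP = V.replicate _ 0ℚ

_⊕_ : ∀ {d} → Point d → Point d → Point d
_⊕_ = V.zipWith ℚ._+_

_⊖_ : ∀ {d} → Point d → Point d → Point d
_⊖_ = V.zipWith ℚ._-_

_•_ : ∀ {d} → ℚ → Point d → Point d
λ₀ • x = V.map (λ₀ ℚ.*_) x

dot : ∀ {d} → Point d → Point d → ℚ
dot c x = V.foldr _ ℚ._+_ 0ℚ (V.zipWith ℚ._*_ c x)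

sumℚ : ∀ {n} → Vec ℚ n → ℚ
sumℚ = V.foldr _ ℚ._+_ 0ℚ

lincomb : ∀ {n d} → Vec ℚ n → Vec (Point d) n → Point d
lincomb [] [] = zeroP
lincomb (l ∷ ls) (x ∷ xs) = (l • x) ⊕ lincomb ls xs

zlincomb : ∀ {n d} → Vec ℤ n → Vec (Vec ℤ d) n → Vec ℤ d
zlincomb [] [] = V.replicate _ (+ 0)
zlincomb (c ∷ cs) (b ∷ bs) = V.zipWith ℤ._+_ (V.map (c ℤ.*_) b) (zlincomb cs bs)

InConv : ∀ {n d} → Vec (Point d) n → Point d → Set
InConv {n} S x = Σ (Vec ℚ n) λ ls →
  ((i : Fin n) → 0ℚ ℚ.≤ V.lookup ls i) × sumℚ ls ≡ 1ℚ × x ≡ lincomb ls S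

InAff : ∀ {n d} → Vec (Point d) n → Point d → Set
InAff {n} S x = Σ (Vec ℚ n) λ ls → sumℚ ls ≡ 1ℚ × x ≡ lincomb ls S

-- A lattice polytope P = conv S, S a finite family of lattice points.

LatticePolytope : ℕ → Set
LatticePolytope d = Σ ℕ λ n → Vec (Vec ℤ d) n

gens : ∀ {d} → (P : LatticePolytope d) → Vec (Point d) (Data.Product.proj₁ P)
gens (n , S) = V.map embed S

_∈P_ : ∀ {d} → Point d → LatticePolytope d → Set
x ∈P P = InConv (gens P) x

FullDim : ∀ {d} → LatticePolytope d → Set
FullDim {d} P = (x : Point d) → InAff (gens P) x

Vertex : ∀ {d} → LatticePolytope d → Point d → Set
Vertex {d} P v = v ∈P P × Σ (Point d) λ c →
  (x : Point d) → x ∈P P → x ≢ v → dot c x ℚ.< dot c v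

Edge : ∀ {d} → LatticePolytope d → Point d → Point d → Set
Edge {d} P u w = u ≢ w × u ∈P P × w ∈P P × Σ (Point d) λ c →
  dot c w ≡ dot c u ×
  ((x : Point d) → x ∈P P → dot c x ℚ.≤ dot c u) ×
  ((x : Point d) → x ∈P P → dot c x ≡ dot c u → InConv (u ∷ w ∷ []) x)

Primitive : ∀ {d} → Vec ℤ d → Set
Primitive {d} p = (k : ℕ) → ((i : Fin d) → (+ k) ∣ℤ V.lookup p i) → k ≡ 1

PrimDir : ∀ {d} → Point d → Vec ℤ d → Set
PrimDir y p = Primitive p × Σ ℚ λ l → 0ℚ ℚ.< l × y ≡ l • embed p

IsBasis : ∀ {d} → Vec (Vec ℤ d) d → Set
IsBasis {d} b =
  ((z : Vec ℤ d) → Σ (Vec ℤ d) λ c → z ≡ zlincomb c b) ×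
  ((c : Vec ℤ d) → zlincomb c b ≡ V.replicate d (+ 0) → c ≡ V.replicate d (+ 0))

Smooth : ∀ {d} → LatticePolytope d → Set
Smooth {d} P = FullDim P ×
  ((v : Point d) → Vertex P v →
    Σ (Vec (Point d) d) λ w →
      ((i j : Fin d) → V.lookup w i ≡ V.lookup w j → i ≡ j) ×
      ((u : Point d) → Edge P v u ⇔ Σ (Fin d) λ i → u ≡ V.lookup w i) ×
      Σ (Vec (Vec ℤ d) d) λ p →
        ((i : Fin d) → PrimDir (V.lookup w i ⊖ v) (V.lookup p i)) × IsBasis p)

IsLatticePoint : ∀ {d} → Point d → Set
IsLatticePoint {d} x = Σ (Vec ℤ d) λ z → x ≡ embed z

Mat : ℕ → Set
Mat d = Vec (Vec ℤ d) d   -- list of rows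

matMul : ∀ {d} → Mat d → Mat d → Mat d
matMul A B = V.map (λ row → zlincomb row B) A

idMat : ∀ {d} → Mat d
idMat {d} = V.tabulate λ i → V.tabulate λ j → rowEntry i j
  where
  open import Data.Fin using (_≟_)
  open import Relation.Nullary using (yes; no)
  rowEntry : Fin d → Fin d → ℤ
  rowEntry i j with i ≟ j
  ... | yes _ = + 1
  ... | no _ = + 0

Unimodular : ∀ {d} → Mat d → Set
Unimodular {d} A = Σ (Mat d) λ B → matMul A B ≡ idMat × matMul B A ≡ idMat

applyAff : ∀ {d} → Mat d → Vec ℤ d → Point d → Point d
applyAff A t x = V.map (λ row → dot (embed row) x) A ⊕ embed t

simplexVerts : (k : ℕ) → Vec (Point k) (suc k)
simplexVerts k = zeroP ∷ V.tabulate (λ i → embed (V.tabulate λ j → e i j))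
  where
  open import Data.Fin using (_≟_)
  open import Relation.Nullary using (yes; no)
  e : Fin k → Fin k → ℤ
  e i j with i ≟ j
  ... | yes _ = + 1
  ... | no _ = + 0

InProdSimplex : (ks : List ℕ) → Point (sum ks) → Set
InProdSimplex L.[] x = ⊤
InProdSimplex (k L.∷ ks) x =
  InConv (simplexVerts k) (V.take k x) × InProdSimplex ks (V.drop k x)

-- At every lattice point v of P the edge directions q₁, …, q_d form a lattice basis, P
-- lies in the cone they span at v, and v + q_k is again a lattice point.  Moving from v
-- to v + q_i turns every other q_j into q_j or q_j - q_i, since no three lattice points
-- of P are collinear; the first case occurs exactly if v + q_i + q_j lies in P.  The
-- indices j of the second case satisfy x_i + Σ x_j ≤ 1 on P.  Hence "i = j or
-- v + q_i + q_j ∉ P" is an equivalence relation, with Σ x_j ≤ 1 on P for every class.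
-- Conversely, if the directions of a set are pairwise compatible at v, they stay so at
-- each of their ends, so v plus their sum lies in P; hence P contains all vertices of the
-- product of the simplices spanned by the classes.
module Submission where

import Algebra.Properties.Ring
import Algebra.Properties.Semiring.Sum
open import Algebra.Bundles using (CommutativeRing)
open import Data.Empty using (⊥; ⊥-elim)
open import Data.Fin as Fin using (Fin; zero; suc)
import Data.Fin.Properties as Fin
open import Data.Integer as ℤ using (ℤ; +_)
import Data.Integer.Properties as ℤ
open import Data.List as List using (List; []; _∷_)
import Data.List.Properties as List
open import Data.List.Membership.Propositional using (_∈_)
open import Data.List.Membership.Propositional.Properties using (∈-lookup)
open import Data.List.Relation.Binary.Permutation.Propositional as Perm using (_↭_; prep; ↭-refl; ↭-sym; ↭-trans)
import Data.List.Relation.Binary.Permutation.Propositional.Properties as Perm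
open import Data.List.Relation.Unary.All as All using (All; []; _∷_)
import Data.List.Relation.Unary.All.Properties as All
open import Data.List.Relation.Unary.AllPairs using (AllPairs; []; _∷_)
open import Data.List.Relation.Unary.Any using (here; there)
open import Data.List.Relation.Unary.Unique.Propositional using (Unique)
open import Data.List.Relation.Unary.Unique.Propositional.Properties using (allFin⁺)
open import Data.Nat as ℕ using (ℕ)
import Data.Nat.Properties as ℕ
open import Data.Product using (Σ; ∃; _×_; _,_; proj₁; proj₂)
open import Data.Rational as ℚ using (ℚ; 0ℚ; 1ℚ)
import Data.Rational.Properties as ℚ
import Data.Rational.Unnormalised as ℚᵘ
import Data.Rational.Unnormalised.Properties as ℚᵘ
open import Data.Sum using (_⊎_; inj₁; inj₂)
open import Data.Vec as Vec using (Vec; []; _∷_)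
open import Data.Vec.Membership.Propositional.Properties as VM using (∈-toList⁺)
import Data.Vec.Properties as Vec
open import Defs
open import Function using (_∘_; _∋_)
open import Function.Bundles using (_⇔_; mk⇔; Equivalence)
open import Level using (0ℓ)
open import Relation.Binary.Definitions using (tri<; tri≈; tri>)
open import Relation.Binary.PropositionalEquality as ≡ using (_≡_; _≢_)
open import Relation.Nullary using (¬_; Dec; yes; no)
open import Relation.Nullary.Decidable using (dec⇒maybe)
open import Tactic.RingSolver using (solve-∀)
open import Tactic.RingSolver.Core.AlmostCommutativeRing using (AlmostCommutativeRing; fromCommutativeRing)

-- Smoothness lists the edges at a vertex and makes their directions a basis, but it does not say
-- that `P` lies in the cone of these directions. If a dual functional were negative somewhere on
-- `P`, some edge at the vertex would have to descend along it, against duality; the obstacle is to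
-- find that edge. It is obtained from a finite maximisation: rescale the generators, seen from the
-- vertex, to a slice of their cone, and maximise a strictly convex quadratic over the finitely many
-- points of the slice. A maximiser of such a function is exposed, and a large linear term forces it
-- into the region where the functional is negative.
--
-- The listed ends of the edges are a priori only rational points. A convex combination representing
-- such an end can use no generator off the ray, and a generator on the ray is a lattice point at or
-- beyond `v + q_k`.
--
-- The inequality of a class is proved for lattice points from its pairwise instances, where
-- integrality lets at most one coordinate be nonzero, and then spread to `P` by convexity.

module Linear (R : CommutativeRing 0ℓ 0ℓ) where
  open CommutativeRing R hiding (zero)
  open Algebra.Properties.Semiring.Sum semiring public
    using (sum; sum-cong-≋; ∑-distrib-+; ∑-comm; *-distribˡ-sum; *-distribʳ-sum; sum-replicate-zero)
  open import Relation.Binary.Reasoning.Setoid setoid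

  Fun : ℕ → Set
  Fun n = Fin n → Carrier

  ⟨_,_⟩ : ∀ {n} → Fun n → Fun n → Carrier
  ⟨ a , x ⟩ = sum (λ i → a i * x i)

  dot-cong : ∀ {n} (a : Fun n) {x y : Fun n} → (∀ i → x i ≈ y i) → ⟨ a , x ⟩ ≈ ⟨ a , y ⟩
  dot-cong a h = sum-cong-≋ (λ i → *-congˡ (h i))

  dot-comm : ∀ {n} (a x : Fun n) → ⟨ a , x ⟩ ≈ ⟨ x , a ⟩
  dot-comm a x = sum-cong-≋ (λ i → *-comm (a i) (x i))

  dot-+ : ∀ {n} (a x y : Fun n) → ⟨ a , (λ i → x i + y i) ⟩ ≈ ⟨ a , x ⟩ + ⟨ a , y ⟩
  dot-+ a x y = trans (sum-cong-≋ (λ i → distribˡ (a i) (x i) (y i)))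
                      (∑-distrib-+ (λ i → a i * x i) (λ i → a i * y i))

  private
    swap-* : ∀ a c x → a * (c * x) ≈ c * (a * x)
    swap-* a c x = trans (sym (*-assoc a c x)) (trans (*-congʳ (*-comm a c)) (*-assoc c a x))

  dot-* : ∀ {n} (a : Fun n) c (x : Fun n) → ⟨ a , (λ i → c * x i) ⟩ ≈ c * ⟨ a , x ⟩
  dot-* a c x = trans (sum-cong-≋ (λ i → swap-* (a i) c (x i)))
                      (sym (*-distribˡ-sum c (λ i → a i * x i)))

  dot-neg : ∀ {n} (a x : Fun n) → ⟨ a , (λ i → - x i) ⟩ ≈ - ⟨ a , x ⟩
  dot-neg a x = begin
    ⟨ a , (λ i → - x i) ⟩        ≈⟨ dot-cong a (λ i → sym (-1*x≈-x (x i))) ⟩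
    ⟨ a , (λ i → - 1# * x i) ⟩   ≈⟨ dot-* a (- 1#) x ⟩
    - 1# * ⟨ a , x ⟩             ≈⟨ -1*x≈-x _ ⟩
    - ⟨ a , x ⟩                  ∎
    where open Algebra.Properties.Ring ring using (-1*x≈-x)

  dot-- : ∀ {n} (a x y : Fun n) → ⟨ a , (λ i → x i - y i) ⟩ ≈ ⟨ a , x ⟩ - ⟨ a , y ⟩
  dot-- a x y = trans (dot-+ a x (λ i → - y i)) (+-congˡ (dot-neg a y))

  dot-sum : ∀ {m n} (a : Fun n) (l : Fun m) (X : Fin m → Fun n) →
            ⟨ a , (λ i → sum (λ k → l k * X k i)) ⟩ ≈ sum (λ k → l k * ⟨ a , X k ⟩)
  dot-sum {m} a l X = begin
    ⟨ a , (λ i → sum (λ k → l k * X k i)) ⟩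
      ≈⟨ sum-cong-≋ (λ i → *-distribˡ-sum (a i) (λ k → l k * X k i)) ⟩
    sum (λ i → sum (λ k → a i * (l k * X k i)))
      ≈⟨ ∑-comm (λ i k → a i * (l k * X k i)) ⟩
    sum (λ k → sum (λ i → a i * (l k * X k i)))
      ≈⟨ sum-cong-≋ (λ k → dot-* a (l k) (X k)) ⟩
    sum (λ k → l k * ⟨ a , X k ⟩) ∎

  sum-zero : ∀ {n} (x : Fun n) → (∀ i → x i ≈ 0#) → sum x ≈ 0#
  sum-zero {n} x h = trans (sum-cong-≋ h) (sum-replicate-zero n)

  δ : ∀ {n} → Fin n → Fun n
  δ zero    zero    = 1#
  δ zero    (suc j) = 0#
  δ (suc i) zero    = 0#
  δ (suc i) (suc j) = δ i j

  δ-refl : ∀ {n} (i : Fin n) → δ i i ≡ 1#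
  δ-refl zero    = ≡.refl
  δ-refl (suc i) = δ-refl i

  δ-≢ : ∀ {n} (i j : Fin n) → i ≢ j → δ i j ≡ 0#
  δ-≢ zero    zero    h = ⊥-elim (h ≡.refl)
  δ-≢ zero    (suc j) h = ≡.refl
  δ-≢ (suc i) zero    h = ≡.refl
  δ-≢ (suc i) (suc j) h = δ-≢ i j (h ∘ ≡.cong suc)

  δ-sym : ∀ {n} (i j : Fin n) → δ i j ≡ δ j i
  δ-sym zero    zero    = ≡.refl
  δ-sym zero    (suc j) = ≡.refl
  δ-sym (suc i) zero    = ≡.refl
  δ-sym (suc i) (suc j) = δ-sym i j

  dot-δ : ∀ {n} (i : Fin n) (x : Fun n) → ⟨ δ i , x ⟩ ≈ x i
  dot-δ zero x = begin
    1# * x zero + sum (λ j → 0# * x (suc j))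
      ≈⟨ +-cong (*-identityˡ _) (sum-zero (λ j → 0# * x (suc j)) (λ j → zeroˡ (x (suc j)))) ⟩
    x zero + 0#  ≈⟨ +-identityʳ _ ⟩
    x zero       ∎
  dot-δ (suc i) x = trans (+-cong (zeroˡ _) (dot-δ i (x ∘ suc))) (+-identityˡ _)

  -- Decidable equality turns a nonzero sum into a concrete index. This search supplies the
  -- generators and the new basis directions chosen later.
  sum-≉0 : (∀ x y → Dec (x ≈ y)) → ∀ {n} (x : Fun n) → ¬ (sum x ≈ 0#) → ∃ λ i → ¬ (x i ≈ 0#)
  sum-≉0 _≟_ {ℕ.zero}  x h = ⊥-elim (h refl)
  sum-≉0 _≟_ {ℕ.suc n} x h with x zero ≟ 0#
  ... | no x₀≉0 = zero , x₀≉0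
  ... | yes x₀≈0 with sum-≉0 _≟_ (x ∘ suc) (λ s → h (trans (+-cong x₀≈0 s) (+-identityˡ 0#)))
  ...   | i , xᵢ≉0 = suc i , xᵢ≉0

  -- Nonnegativity is an abstract predicate, so that the vanishing of all terms of a nonnegative
  -- zero sum is available over both `ℚ` and `ℤ`.
  module Nonnegative (0≤ : Carrier → Set) (0≤0 : 0≤ 0#)
                     (0≤+ : ∀ {x y} → 0≤ x → 0≤ y → 0≤ (x + y))
                     (+≈0 : ∀ {x y} → 0≤ x → 0≤ y → x + y ≈ 0# → x ≈ 0# × y ≈ 0#) where

    sum-0≤ : ∀ {n} (x : Fun n) → (∀ i → 0≤ (x i)) → 0≤ (sum x)
    sum-0≤ {ℕ.zero}  x h = 0≤0
    sum-0≤ {ℕ.suc n} x h = 0≤+ (h zero) (sum-0≤ (x ∘ suc) (h ∘ suc))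

    sum-≈0 : ∀ {n} (x : Fun n) → (∀ i → 0≤ (x i)) → sum x ≈ 0# → ∀ i → x i ≈ 0#
    sum-≈0 {ℕ.suc n} x h s zero    = proj₁ (+≈0 (h zero) (sum-0≤ (x ∘ suc) (h ∘ suc)) s)
    sum-≈0 {ℕ.suc n} x h s (suc i) =
      sum-≈0 (x ∘ suc) (h ∘ suc) (proj₂ (+≈0 (h zero) (sum-0≤ (x ∘ suc) (h ∘ suc)) s)) i

open import Data.Nat.ListAction using (sum)
open import Relation.Binary.PropositionalEquality
  using (refl; sym; trans; cong; cong₂; subst; subst₂; module ≡-Reasoning)

-- The embedding of the integers into the rationals.

ringℚ : AlmostCommutativeRing 0ℓ 0ℓ
ringℚ = fromCommutativeRing ℚ.+-*-commutativeRing (λ x → dec⇒maybe (0ℚ ℚ.≟ x))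

ringℤ : AlmostCommutativeRing 0ℓ 0ℓ
ringℤ = fromCommutativeRing ℤ.+-*-commutativeRing (λ x → dec⇒maybe (+ 0 ℤ.≟ x))

ι : ℤ → ℚ
ι z = z ℚ./ 1

private
  toℚᵘ-ι : ∀ z → ℚ.toℚᵘ (ι z) ℚᵘ.≃ z ℚᵘ./ 1
  toℚᵘ-ι z = ℚ.toℚᵘ-fromℚᵘ (z ℚᵘ./ 1)

ι-+ : ∀ a b → ι (a ℤ.+ b) ≡ ι a ℚ.+ ι b
ι-+ a b = ℚ.toℚᵘ-injective (begin
  ℚ.toℚᵘ (ι (a ℤ.+ b))                    ≈⟨ toℚᵘ-ι (a ℤ.+ b) ⟩
  (a ℤ.+ b) ℚᵘ./ 1                        ≈⟨ ℚᵘ.*≡* (lem a b) ⟩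
  (a ℚᵘ./ 1) ℚᵘ.+ (b ℚᵘ./ 1)              ≈⟨ ℚᵘ.+-cong (toℚᵘ-ι a) (toℚᵘ-ι b) ⟨
  ℚ.toℚᵘ (ι a) ℚᵘ.+ ℚ.toℚᵘ (ι b)          ≈⟨ ℚ.toℚᵘ-homo-+ (ι a) (ι b) ⟨
  ℚ.toℚᵘ (ι a ℚ.+ ι b)                    ∎)
  where
  open ℚᵘ.≃-Reasoning
  lem : ∀ a b → (a ℤ.+ b) ℤ.* (+ 1) ≡ (a ℤ.* (+ 1) ℤ.+ b ℤ.* (+ 1)) ℤ.* (+ 1)
  lem = solve-∀ ringℤ

ι-* : ∀ a b → ι (a ℤ.* b) ≡ ι a ℚ.* ι b
ι-* a b = ℚ.toℚᵘ-injective (begin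
  ℚ.toℚᵘ (ι (a ℤ.* b))                    ≈⟨ toℚᵘ-ι (a ℤ.* b) ⟩
  (a ℤ.* b) ℚᵘ./ 1                        ≈⟨ ℚᵘ.*≡* refl ⟩
  (a ℚᵘ./ 1) ℚᵘ.* (b ℚᵘ./ 1)              ≈⟨ ℚᵘ.*-cong (toℚᵘ-ι a) (toℚᵘ-ι b) ⟨
  ℚ.toℚᵘ (ι a) ℚᵘ.* ℚ.toℚᵘ (ι b)          ≈⟨ ℚ.toℚᵘ-homo-* (ι a) (ι b) ⟨
  ℚ.toℚᵘ (ι a ℚ.* ι b)                    ∎)
  where open ℚᵘ.≃-Reasoning

ι-≤ : ∀ {a b} → a ℤ.≤ b → ι a ℚ.≤ ι b
ι-≤ {a} {b} h = ℚ.toℚᵘ-cancel-≤ (ℚᵘ.≤-respˡ-≃ (ℚᵘ.≃-sym (toℚᵘ-ι a))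
  (ℚᵘ.≤-respʳ-≃ (ℚᵘ.≃-sym (toℚᵘ-ι b))
    (ℚᵘ.*≤* (subst₂ ℤ._≤_ (sym (ℤ.*-identityʳ a)) (sym (ℤ.*-identityʳ b)) h))))

ι-≤⁻¹ : ∀ {a b} → ι a ℚ.≤ ι b → a ℤ.≤ b
ι-≤⁻¹ {a} {b} h with ℚᵘ.≤-respˡ-≃ (toℚᵘ-ι a) (ℚᵘ.≤-respʳ-≃ (toℚᵘ-ι b) (ℚ.toℚᵘ-mono-≤ h))
... | ℚᵘ.*≤* h′ = subst₂ ℤ._≤_ (ℤ.*-identityʳ a) (ℤ.*-identityʳ b) h′

ι-injective : ∀ {a b} → ι a ≡ ι b → a ≡ b
ι-injective e = ℤ.≤-antisym (ι-≤⁻¹ (ℚ.≤-reflexive e)) (ι-≤⁻¹ (ℚ.≤-reflexive (sym e)))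

ι-< : ∀ {a b} → a ℤ.< b → ι a ℚ.< ι b
ι-< h = ℚ.≰⇒> (λ k → ℤ.<⇒≱ h (ι-≤⁻¹ k))

ι-neg : ∀ a → ι (ℤ.- a) ≡ ℚ.- ι a
ι-neg a = begin
  ι (ℤ.- a)                           ≡⟨ cancel (ι (ℤ.- a)) (ι a) ⟩
  (ι (ℤ.- a) ℚ.+ ι a) ℚ.+ ℚ.- ι a     ≡⟨ cong (ℚ._+ ℚ.- ι a) (ι-+ (ℤ.- a) a) ⟨
  ι (ℤ.- a ℤ.+ a) ℚ.+ ℚ.- ι a         ≡⟨ cong (λ t → ι t ℚ.+ ℚ.- ι a) (ℤ.+-inverseˡ a) ⟩
  0ℚ ℚ.+ ℚ.- ι a                      ≡⟨ ℚ.+-identityˡ _ ⟩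
  ℚ.- ι a                             ∎
  where
  open ≡-Reasoning
  cancel : ∀ x y → x ≡ (x ℚ.+ y) ℚ.+ ℚ.- y
  cancel = solve-∀ ringℚ

ι-- : ∀ a b → ι (a ℤ.- b) ≡ ι a ℚ.- ι b
ι-- a b = trans (ι-+ a (ℤ.- b)) (cong (ι a ℚ.+_) (ι-neg b))

module ℚL = Linear ℚ.+-*-commutativeRing
module ℤL = Linear ℤ.+-*-commutativeRing

-- Order in the form 0 ≤ y - x, so that inequalities reduce to ring identities.

0≤⇒≤ : ∀ {x y} → 0ℚ ℚ.≤ y ℚ.- x → x ℚ.≤ y
0≤⇒≤ {x} {y} h = subst₂ ℚ._≤_ (ℚ.+-identityˡ x) (lem x y) (ℚ.+-monoˡ-≤ x h)
  where
  lem : ∀ x y → y ℚ.- x ℚ.+ x ≡ y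
  lem = solve-∀ ringℚ

≤⇒0≤ : ∀ {x y} → x ℚ.≤ y → 0ℚ ℚ.≤ y ℚ.- x
≤⇒0≤ {x} {y} h = subst (ℚ._≤ y ℚ.- x) (ℚ.+-inverseʳ x) (ℚ.+-monoˡ-≤ (ℚ.- x) h)

0<⇒< : ∀ {x y} → 0ℚ ℚ.< y ℚ.- x → x ℚ.< y
0<⇒< {x} {y} h = subst₂ ℚ._<_ (ℚ.+-identityˡ x) (lem x y) (ℚ.+-monoˡ-< x h)
  where
  lem : ∀ x y → y ℚ.- x ℚ.+ x ≡ y
  lem = solve-∀ ringℚ

<⇒0< : ∀ {x y} → x ℚ.< y → 0ℚ ℚ.< y ℚ.- x
<⇒0< {x} {y} h = subst (ℚ._< y ℚ.- x) (ℚ.+-inverseʳ x) (ℚ.+-monoˡ-< (ℚ.- x) h)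

0≤+ : ∀ {x y} → 0ℚ ℚ.≤ x → 0ℚ ℚ.≤ y → 0ℚ ℚ.≤ x ℚ.+ y
0≤+ {x} {y} h k = ℚ.nonNegative⁻¹ (x ℚ.+ y) {{ℚ.nonNeg+nonNeg⇒nonNeg x {{ℚ.nonNegative h}} y {{ℚ.nonNegative k}}}}

0≤* : ∀ {x y} → 0ℚ ℚ.≤ x → 0ℚ ℚ.≤ y → 0ℚ ℚ.≤ x ℚ.* y
0≤* {x} {y} h k = ℚ.nonNegative⁻¹ (x ℚ.* y) {{ℚ.nonNeg*nonNeg⇒nonNeg x {{ℚ.nonNegative h}} y {{ℚ.nonNegative k}}}}

0<* : ∀ {x y} → 0ℚ ℚ.< x → 0ℚ ℚ.< y → 0ℚ ℚ.< x ℚ.* y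
0<* {x} {y} h k = ℚ.positive⁻¹ (x ℚ.* y) {{ℚ.pos*pos⇒pos x {{ℚ.positive h}} y {{ℚ.positive k}}}}

0≤sq : ∀ x → 0ℚ ℚ.≤ x ℚ.* x
0≤sq x with ℚ.≤-total 0ℚ x
... | inj₁ h = 0≤* h h
... | inj₂ h = subst (0ℚ ℚ.≤_) (lem x) (0≤* h′ h′)
  where
  lem : ∀ x → (0ℚ ℚ.- x) ℚ.* (0ℚ ℚ.- x) ≡ x ℚ.* x
  lem = solve-∀ ringℚ
  h′ = ≤⇒0≤ h

sq≡0 : ∀ x → x ℚ.* x ≡ 0ℚ → x ≡ 0ℚ
sq≡0 x e with ℚ.<-cmp x 0ℚ
... | tri≈ _ x≡0 _ = x≡0
... | tri> _ _ h = ⊥-elim (ℚ.<-irrefl (sym e) (0<* h h))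
... | tri< h _ _ = ⊥-elim (ℚ.<-irrefl (sym e) (subst (0ℚ ℚ.<_) (lem x) (0<* (<⇒0< h) (<⇒0< h))))
  where
  lem : ∀ x → (0ℚ ℚ.- x) ℚ.* (0ℚ ℚ.- x) ≡ x ℚ.* x
  lem = solve-∀ ringℚ

ℚ+≡0 : ∀ {x y} → 0ℚ ℚ.≤ x → 0ℚ ℚ.≤ y → x ℚ.+ y ≡ 0ℚ → x ≡ 0ℚ × y ≡ 0ℚ
ℚ+≡0 {x} {y} h k e = ℚ.≤-antisym (subst (x ℚ.≤_) e (subst (ℚ._≤ x ℚ.+ y) (ℚ.+-identityʳ x) (ℚ.+-monoʳ-≤ x k))) h
                   , ℚ.≤-antisym (subst (y ℚ.≤_) e (subst (ℚ._≤ x ℚ.+ y) (ℚ.+-identityˡ y) (ℚ.+-monoˡ-≤ y h))) k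

ℤ+≡0 : ∀ {x y} → + 0 ℤ.≤ x → + 0 ℤ.≤ y → x ℤ.+ y ≡ + 0 → x ≡ + 0 × y ≡ + 0
ℤ+≡0 {x} {y} h k e = ℤ.≤-antisym (subst (x ℤ.≤_) e (subst (ℤ._≤ x ℤ.+ y) (ℤ.+-identityʳ x) (ℤ.+-monoʳ-≤ x k))) h
                   , ℤ.≤-antisym (subst (y ℤ.≤_) e (subst (ℤ._≤ x ℤ.+ y) (ℤ.+-identityˡ y) (ℤ.+-monoˡ-≤ y h))) k

module ℚN = ℚL.Nonnegative (0ℚ ℚ.≤_) ℚ.≤-refl 0≤+ ℚ+≡0
module ℤN = ℤL.Nonnegative (+ 0 ℤ.≤_) ℤ.≤-refl ℤ.+-mono-≤ ℤ+≡0

sum-ι : ∀ {n} (f : Fin n → ℤ) → ι (ℤL.sum f) ≡ ℚL.sum (λ i → ι (f i))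
sum-ι {ℕ.zero}  f = refl
sum-ι {ℕ.suc n} f = trans (ι-+ (f zero) _) (cong (ι (f zero) ℚ.+_) (sum-ι (λ i → f (suc i))))

dot-ι : ∀ {n} (a x : Fin n → ℤ) → ι ℤL.⟨ a , x ⟩ ≡ ℚL.⟨ (λ i → ι (a i)) , (λ i → ι (x i)) ⟩
dot-ι a x = trans (sum-ι (λ i → a i ℤ.* x i)) (ℚL.sum-cong-≋ (λ i → ι-* (a i) (x i)))

argmax : ∀ {n} (h : Fin (ℕ.suc n) → ℚ) → ∃ λ m → ∀ i → h i ℚ.≤ h m
argmax {ℕ.zero}  h = zero , λ { zero → ℚ.≤-refl }
argmax {ℕ.suc n} h with argmax (λ i → h (suc i))
... | m , hm with ℚ.≤-total (h zero) (h (suc m))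
...   | inj₁ le = suc m , λ { zero → le ; (suc i) → hm i }
...   | inj₂ ge = zero , λ { zero → ℚ.≤-refl ; (suc i) → ℚ.≤-trans (hm i) ge }

open ℚL using () renaming (⟨_,_⟩ to ⟪_,_⟫; Fun to Funℚ)
open ℤL using (⟨_,_⟩) renaming (Fun to Funℤ)

-- Existence of edges

reciprocal : ∀ {x} → 0ℚ ℚ.< x → ∃ λ r → 0ℚ ℚ.< r × r ℚ.* x ≡ 1ℚ
reciprocal {x} h = (ℚ.1/ x) , ℚ.positive⁻¹ (ℚ.1/ x) {{ℚ.1/pos⇒pos x}} , ℚ.*-inverseˡ x
  where instance
    x-pos : ℚ.Positive x
    x-pos = ℚ.positive h
    x-nonZero : ℚ.NonZero x
    x-nonZero = ℚ.pos⇒nonZero x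

norm-≡0 : ∀ {d} (x : Funℚ d) → ⟪ x , x ⟫ ≡ 0ℚ → ∀ j → x j ≡ 0ℚ
norm-≡0 x e j = sq≡0 (x j) (ℚN.sum-≈0 (λ i → x i ℚ.* x i) (λ i → 0≤sq (x i)) e j)

norm-0≤ : ∀ {d} (x : Funℚ d) → 0ℚ ℚ.≤ ⟪ x , x ⟫
norm-0≤ x = ℚN.sum-0≤ (λ i → x i ℚ.* x i) (λ i → 0≤sq (x i))

norm-sub : ∀ {d} (x y : Funℚ d) →
  ⟪ (λ j → x j ℚ.- y j) , (λ j → x j ℚ.- y j) ⟫ ≡
  ⟪ x , x ⟫ ℚ.- (⟪ y , x ⟫ ℚ.+ ⟪ y , x ⟫) ℚ.+ ⟪ y , y ⟫
norm-sub x y = begin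
  ⟪ w , w ⟫                                             ≡⟨ ℚL.dot-- w x y ⟩
  ⟪ w , x ⟫ ℚ.- ⟪ w , y ⟫                               ≡⟨ cong₂ ℚ._-_ (ℚL.dot-comm w x) (ℚL.dot-comm w y) ⟩
  ⟪ x , w ⟫ ℚ.- ⟪ y , w ⟫                               ≡⟨ cong₂ ℚ._-_ (ℚL.dot-- x x y) (ℚL.dot-- y x y) ⟩
  (⟪ x , x ⟫ ℚ.- ⟪ x , y ⟫) ℚ.- (⟪ y , x ⟫ ℚ.- ⟪ y , y ⟫)
    ≡⟨ cong (λ z → (⟪ x , x ⟫ ℚ.- z) ℚ.- (⟪ y , x ⟫ ℚ.- ⟪ y , y ⟫)) (ℚL.dot-comm x y) ⟩
  (⟪ x , x ⟫ ℚ.- ⟪ y , x ⟫) ℚ.- (⟪ y , x ⟫ ℚ.- ⟪ y , y ⟫) ≡⟨ lem ⟪ x , x ⟫ ⟪ y , x ⟫ ⟪ y , y ⟫ ⟩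
  ⟪ x , x ⟫ ℚ.- (⟪ y , x ⟫ ℚ.+ ⟪ y , x ⟫) ℚ.+ ⟪ y , y ⟫ ∎
  where
  open ≡-Reasoning
  w = λ j → x j ℚ.- y j
  lem : ∀ a b c → (a ℚ.- b) ℚ.- (b ℚ.- c) ≡ a ℚ.- (b ℚ.+ b) ℚ.+ c
  lem = solve-∀ ringℚ

private
  lem-γ : ∀ gs ns gm nm M → (0ℚ ℚ.- gs) ℚ.* (M ℚ.- nm) ℚ.+ (M ℚ.* gm ℚ.+ (0ℚ ℚ.- gs) ℚ.* ns) ≡
          ((0ℚ ℚ.- gs) ℚ.* ns ℚ.- M ℚ.* gs) ℚ.- ((0ℚ ℚ.- gs) ℚ.* nm ℚ.- M ℚ.* gm)
  lem-γ = solve-∀ ringℚ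
  lem-gap : ∀ γ M gi ni gm nm x →
      0ℚ ℚ.- (((γ ℚ.+ γ) ℚ.* x ℚ.- M ℚ.* gi) ℚ.- ((γ ℚ.+ γ) ℚ.* nm ℚ.- M ℚ.* gm) ℚ.* 1ℚ) ≡
      ((γ ℚ.* nm ℚ.- M ℚ.* gm) ℚ.- (γ ℚ.* ni ℚ.- M ℚ.* gi)) ℚ.+ γ ℚ.* (ni ℚ.- (x ℚ.+ x) ℚ.+ nm)
  lem-gap = solve-∀ ringℚ
  lem-κ : ∀ κ → κ ℚ.- κ ℚ.* 1ℚ ≡ 0ℚ
  lem-κ = solve-∀ ringℚ
  lem-sub : ∀ x y → x ≡ (x ℚ.- y) ℚ.+ y
  lem-sub = solve-∀ ringℚ
  lem-assoc : ∀ F r x → F ℚ.* (r ℚ.* x) ≡ (r ℚ.* F) ℚ.* x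
  lem-assoc = solve-∀ ringℚ
  lem-neg : ∀ F G → 0ℚ ℚ.- F ℚ.* G ≡ F ℚ.* (0ℚ ℚ.- G)
  lem-neg = solve-∀ ringℚ

  sub≤0 : ∀ {x y} → x ℚ.≤ y → x ℚ.- y ℚ.≤ 0ℚ
  sub≤0 {x} {y} p = subst (x ℚ.- y ℚ.≤_) (ℚ.+-inverseʳ y) (ℚ.+-monoˡ-≤ (ℚ.- y) p)

-- With M large, the maximiser m of the strictly convex function γ |y|² - M g(y) has
-- g < 0; the tangent functional a at m, made homogeneous by f, is negative at the
-- other points.
module Tangent {n d} (f g : Funℚ d) (ū : Fin n → Funℚ d) (f-ū : ∀ i → ⟪ f , ū i ⟫ ≡ 1ℚ)
  (γ M : ℚ) (γ-pos : 0ℚ ℚ.< γ) (M≥0 : 0ℚ ℚ.≤ M) (N<M : ∀ i → ⟪ ū i , ū i ⟫ ℚ.< M)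
  (s : Fin n) (γ≡ : γ ≡ 0ℚ ℚ.- ⟪ g , ū s ⟫) (m : Fin n)
  (h≤hm : ∀ i → γ ℚ.* ⟪ ū i , ū i ⟫ ℚ.- M ℚ.* ⟪ g , ū i ⟫ ℚ.≤ γ ℚ.* ⟪ ū m , ū m ⟫ ℚ.- M ℚ.* ⟪ g , ū m ⟫)
  where
  open ≡-Reasoning

  N G h : Fin n → ℚ
  N i = ⟪ ū i , ū i ⟫
  G i = ⟪ g , ū i ⟫
  h i = γ ℚ.* N i ℚ.- M ℚ.* G i

  -- If `G m ≥ 0`, then `h m ≤ γ N m < γ M ≤ γ N s + M γ = h s`, against the choice of `m`. This is
  -- where `M` has to exceed the norms.
  Gm-neg : G m ℚ.< 0ℚ
  Gm-neg = ℚ.≰⇒> λ Gm≥0 → ℚ.<-irrefl refl (ℚ.<-≤-trans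
    (subst (0ℚ ℚ.<_) (trans (cong (λ γ → γ ℚ.* (M ℚ.- N m) ℚ.+ (M ℚ.* G m ℚ.+ γ ℚ.* N s)) γ≡)
                      (trans (lem-γ (G s) (N s) (G m) (N m) M)
                       (cong (λ γ → (γ ℚ.* N s ℚ.- M ℚ.* G s) ℚ.- (γ ℚ.* N m ℚ.- M ℚ.* G m)) (sym γ≡))))
      (ℚ.<-≤-trans (0<* γ-pos (<⇒0< (N<M m)))
        (subst (ℚ._≤ γ ℚ.* (M ℚ.- N m) ℚ.+ (M ℚ.* G m ℚ.+ γ ℚ.* N s)) (ℚ.+-identityʳ _)
          (ℚ.+-monoʳ-≤ (γ ℚ.* (M ℚ.- N m))
            (0≤+ (0≤* M≥0 Gm≥0) (0≤* (ℚ.<⇒≤ γ-pos) (norm-0≤ (ū s))))))))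
    (sub≤0 (h≤hm s)))

  -- The value at `ū m` of the derivative of `h` there; subtracting `κ f` makes `a` vanish at `ū m`,
  -- since `f` is 1 on the slice.
  κ : ℚ
  κ = (γ ℚ.+ γ) ℚ.* N m ℚ.- M ℚ.* G m
  a : Funℚ d
  a j = ((γ ℚ.+ γ) ℚ.* ū m j ℚ.- M ℚ.* g j) ℚ.- κ ℚ.* f j
  a-eval : ∀ x → ⟪ a , x ⟫ ≡ ((γ ℚ.+ γ) ℚ.* ⟪ ū m , x ⟫ ℚ.- M ℚ.* ⟪ g , x ⟫) ℚ.- κ ℚ.* ⟪ f , x ⟫
  a-eval x = begin
    ⟪ a , x ⟫  ≡⟨ ℚL.dot-comm a x ⟩
    ⟪ x , a ⟫  ≡⟨ ℚL.dot-- x (λ j → (γ ℚ.+ γ) ℚ.* ū m j ℚ.- M ℚ.* g j) (λ j → κ ℚ.* f j) ⟩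
    ⟪ x , (λ j → (γ ℚ.+ γ) ℚ.* ū m j ℚ.- M ℚ.* g j) ⟫ ℚ.- ⟪ x , (λ j → κ ℚ.* f j) ⟫
      ≡⟨ cong (ℚ._- ⟪ x , (λ j → κ ℚ.* f j) ⟫) (ℚL.dot-- x (λ j → (γ ℚ.+ γ) ℚ.* ū m j) (λ j → M ℚ.* g j)) ⟩
    (⟪ x , (λ j → (γ ℚ.+ γ) ℚ.* ū m j) ⟫ ℚ.- ⟪ x , (λ j → M ℚ.* g j) ⟫) ℚ.- ⟪ x , (λ j → κ ℚ.* f j) ⟫
      ≡⟨ cong₂ ℚ._-_ (cong₂ ℚ._-_ (flip (γ ℚ.+ γ) (ū m)) (flip M g)) (flip κ f) ⟩
    ((γ ℚ.+ γ) ℚ.* ⟪ ū m , x ⟫ ℚ.- M ℚ.* ⟪ g , x ⟫) ℚ.- κ ℚ.* ⟪ f , x ⟫ ∎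
    where
    flip : ∀ c y → ⟪ x , (λ j → c ℚ.* y j) ⟫ ≡ c ℚ.* ⟪ y , x ⟫
    flip c y = trans (ℚL.dot-* x c y) (cong (c ℚ.*_) (ℚL.dot-comm x y))

  dist : Fin n → ℚ
  dist i = ⟪ (λ j → ū i j ℚ.- ū m j) , (λ j → ū i j ℚ.- ū m j) ⟫
  -- `h` is quadratic, so its expansion at `ū m` is exact: on the slice the linear term is `a` and
  -- the remainder is `γ` times the squared distance. Both summands on the right are nonnegative,
  -- and the second one vanishes only at `ū m`.
  gap : ∀ i → 0ℚ ℚ.- ⟪ a , ū i ⟫ ≡ (h m ℚ.- h i) ℚ.+ γ ℚ.* dist i
  gap i = begin
    0ℚ ℚ.- ⟪ a , ū i ⟫
      ≡⟨ cong (λ z → 0ℚ ℚ.- z) (trans (a-eval (ū i)) (cong (λ z → E ℚ.- κ ℚ.* z) (f-ū i))) ⟩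
    0ℚ ℚ.- (E ℚ.- κ ℚ.* 1ℚ)
      ≡⟨ lem-gap γ M (G i) (N i) (G m) (N m) ⟪ ū m , ū i ⟫ ⟩
    (h m ℚ.- h i) ℚ.+ γ ℚ.* (N i ℚ.- (⟪ ū m , ū i ⟫ ℚ.+ ⟪ ū m , ū i ⟫) ℚ.+ N m)
      ≡⟨ cong (λ z → (h m ℚ.- h i) ℚ.+ γ ℚ.* z) (norm-sub (ū i) (ū m)) ⟨
    (h m ℚ.- h i) ℚ.+ γ ℚ.* dist i ∎
    where
    E = (γ ℚ.+ γ) ℚ.* ⟪ ū m , ū i ⟫ ℚ.- M ℚ.* ⟪ g , ū i ⟫

  a-ū : ∀ i → 0ℚ ℚ.≤ 0ℚ ℚ.- ⟪ a , ū i ⟫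
  a-ū i = subst (0ℚ ℚ.≤_) (sym (gap i)) (0≤+ (≤⇒0≤ (h≤hm i)) (0≤* (ℚ.<⇒≤ γ-pos) (norm-0≤ (λ j → ū i j ℚ.- ū m j))))

  a-ūm : ⟪ a , ū m ⟫ ≡ 0ℚ
  a-ūm = trans (a-eval (ū m)) (trans (cong (λ z → ((γ ℚ.+ γ) ℚ.* N m ℚ.- M ℚ.* G m) ℚ.- κ ℚ.* z) (f-ū m)) (lem-κ κ))

  a-ū≡0 : ∀ i → ⟪ a , ū i ⟫ ≡ 0ℚ → ∀ j → ū i j ≡ ū m j
  a-ū≡0 i e j = trans (lem-sub (ū i j) (ū m j))
    (trans (cong (ℚ._+ ū m j) (norm-≡0 (λ j → ū i j ℚ.- ū m j) dist≡0 j)) (ℚ.+-identityˡ _))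
    where
    γdist : γ ℚ.* dist i ≡ 0ℚ
    γdist = proj₂ (ℚ+≡0 (≤⇒0≤ (h≤hm i)) (0≤* (ℚ.<⇒≤ γ-pos) (norm-0≤ (λ j → ū i j ℚ.- ū m j)))
                   (trans (sym (gap i)) (cong (λ z → 0ℚ ℚ.- z) e)))
    dist≡0 : dist i ≡ 0ℚ
    dist≡0 with ℚ.<-cmp (dist i) 0ℚ
    ... | tri≈ _ q _ = q
    ... | tri< q _ _ = ⊥-elim (ℚ.<-irrefl refl (ℚ.<-≤-trans q (norm-0≤ (λ j → ū i j ℚ.- ū m j))))
    ... | tri> _ _ q = ⊥-elim (ℚ.<-irrefl (sym γdist) (0<* γ-pos q))

exposed-point : ∀ {n d} (f g : Funℚ d) (ū : Fin n → Funℚ d) → (∀ i → ⟪ f , ū i ⟫ ≡ 1ℚ) →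
  (s : Fin n) → ⟪ g , ū s ⟫ ℚ.< 0ℚ →
  Σ (Funℚ d) λ a → Σ (Fin n) λ m → ⟪ g , ū m ⟫ ℚ.< 0ℚ × ⟪ a , ū m ⟫ ≡ 0ℚ ×
    (∀ i → 0ℚ ℚ.≤ 0ℚ ℚ.- ⟪ a , ū i ⟫) × (∀ i → ⟪ a , ū i ⟫ ≡ 0ℚ → ∀ j → ū i j ≡ ū m j)
exposed-point {ℕ.suc n} f g ū f-ū s G-neg with argmax (λ i → ⟪ ū i , ū i ⟫)
-- Here `γ` is the positive number `- g (ū s)`, and `M` is one more than the largest norm, the 1
-- making the bound strict.
... | k , N≤Nk with argmax (λ i → (0ℚ ℚ.- ⟪ g , ū s ⟫) ℚ.* ⟪ ū i , ū i ⟫ ℚ.- (1ℚ ℚ.+ ⟪ ū k , ū k ⟫) ℚ.* ⟪ g , ū i ⟫)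
...   | m , h≤hm = T.a , m , T.Gm-neg , T.a-ūm , T.a-ū , T.a-ū≡0
  where
  N<M : ∀ i → ⟪ ū i , ū i ⟫ ℚ.< 1ℚ ℚ.+ ⟪ ū k , ū k ⟫
  N<M i = ℚ.≤-<-trans (N≤Nk i)
    (subst (ℚ._< 1ℚ ℚ.+ ⟪ ū k , ū k ⟫) (ℚ.+-identityˡ _) (ℚ.+-monoˡ-< ⟪ ū k , ū k ⟫ (ℚ.positive⁻¹ 1ℚ)))
  module T = Tangent f g ū f-ū (0ℚ ℚ.- ⟪ g , ū s ⟫) (1ℚ ℚ.+ ⟪ ū k , ū k ⟫) (<⇒0< G-neg)
    (ℚ.≤-trans (norm-0≤ (ū s)) (ℚ.<⇒≤ (N<M s))) N<M s refl m h≤hm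

-- Dividing each nonzero `u i` by its value of `f` moves it to the slice `f = 1`, where an exposed
-- point spans an exposed ray of the cone. This is a descent step of the simplex method: if `g` is
-- negative at some generator, it is negative along some extreme ray.
exposed-ray : ∀ {n d} (u : Fin n → Funℚ d) (f g : Funℚ d) (s : Fin n) →
  (∀ i → 0ℚ ℚ.< ⟪ f , u i ⟫ ⊎ (∀ j → u i j ≡ 0ℚ)) → ⟪ g , u s ⟫ ℚ.< 0ℚ →
  Σ (Funℚ d) λ a → Σ (Fin n) λ m →
    0ℚ ℚ.< ⟪ f , u m ⟫ × ⟪ g , u m ⟫ ℚ.< 0ℚ × ⟪ a , u m ⟫ ≡ 0ℚ ×
    (∀ i → ⟪ a , u i ⟫ ℚ.≤ 0ℚ) ×
    (∀ i → ⟪ a , u i ⟫ ≡ 0ℚ → ∃ λ t → 0ℚ ℚ.≤ t × (∀ j → u i j ≡ t ℚ.* u m j))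
exposed-ray {n} {d} u f g s f-pos g-neg = conclude (exposed-point f g ū f-ū s G-neg)
  where
  open ≡-Reasoning
  dot-zero : ∀ (b x : Funℚ d) → (∀ j → x j ≡ 0ℚ) → ⟪ b , x ⟫ ≡ 0ℚ
  dot-zero b x h = ℚL.sum-zero _ (λ j → trans (cong (b j ℚ.*_) (h j)) (ℚ.*-zeroʳ (b j)))

  s-pos : 0ℚ ℚ.< ⟪ f , u s ⟫
  s-pos with f-pos s
  ... | inj₁ p = p
  ... | inj₂ z = ⊥-elim (ℚ.<-irrefl (dot-zero g (u s) z) g-neg)

  -- The zero vectors cannot be rescaled and are replaced by u s.
  Rescaled : Fin n → Set
  Rescaled i = Σ (Fin n) λ k → Σ ℚ λ r → Σ ℚ λ F →
    0ℚ ℚ.< r × 0ℚ ℚ.< F × r ℚ.* F ≡ 1ℚ × F ≡ ⟪ f , u k ⟫ × (k ≡ i ⊎ (∀ j → u i j ≡ 0ℚ))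

  rescale : ∀ i k → 0ℚ ℚ.< ⟪ f , u k ⟫ → (k ≡ i ⊎ (∀ j → u i j ≡ 0ℚ)) → Rescaled i
  rescale i k p c with reciprocal p
  ... | r , r-pos , e = k , r , ⟪ f , u k ⟫ , r-pos , p , e , refl , c

  choose : ∀ i → Rescaled i
  choose i with f-pos i
  ... | inj₁ p = rescale i i p (inj₁ refl)
  ... | inj₂ z = rescale i s s-pos (inj₂ z)

  ū′ : ∀ {i} → Rescaled i → Funℚ d
  ū′ (k , r , _) j = r ℚ.* u k j
  ū : Fin n → Funℚ d
  ū i = ū′ (choose i)

  -- Like the other primed lemmas, stated for an arbitrary `Rescaled i`, so that the case
  -- distinction is a pattern match and does not go through `choose`.
  f-ū′ : ∀ {i} (c : Rescaled i) → ⟪ f , ū′ c ⟫ ≡ 1ℚ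
  f-ū′ (k , r , F , _ , _ , rF , F≡ , _) =
    trans (ℚL.dot-* f r (u k)) (trans (cong (r ℚ.*_) (sym F≡)) rF)
  f-ū : ∀ i → ⟪ f , ū i ⟫ ≡ 1ℚ
  f-ū i = f-ū′ (choose i)

  unscale : ∀ (b : Funℚ d) k r F → r ℚ.* F ≡ 1ℚ → ⟪ b , u k ⟫ ≡ F ℚ.* ⟪ b , (λ j → r ℚ.* u k j) ⟫
  unscale b k r F rF = sym (begin
    F ℚ.* ⟪ b , (λ j → r ℚ.* u k j) ⟫   ≡⟨ cong (F ℚ.*_) (ℚL.dot-* b r (u k)) ⟩
    F ℚ.* (r ℚ.* ⟪ b , u k ⟫)           ≡⟨ lem-assoc F r ⟪ b , u k ⟫ ⟩
    (r ℚ.* F) ℚ.* ⟪ b , u k ⟫           ≡⟨ cong (ℚ._* ⟪ b , u k ⟫) rF ⟩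
    1ℚ ℚ.* ⟪ b , u k ⟫                  ≡⟨ ℚ.*-identityˡ ⟪ b , u k ⟫ ⟩
    ⟪ b , u k ⟫                         ∎)

  G-neg′ : ∀ (c : Rescaled s) → ⟪ g , ū′ c ⟫ ℚ.< 0ℚ
  G-neg′ (k , r , F , r-pos , _ , _ , _ , inj₁ refl) =
    0<⇒< (subst (0ℚ ℚ.<_)
      (trans (sym (lem-neg r ⟪ g , u s ⟫)) (cong (λ z → 0ℚ ℚ.- z) (sym (ℚL.dot-* g r (u s)))))
      (0<* r-pos (<⇒0< g-neg)))
  G-neg′ (k , r , F , r-pos , _ , _ , _ , inj₂ z) = ⊥-elim (ℚ.<-irrefl (dot-zero g (u s) z) g-neg)
  G-neg : ⟪ g , ū s ⟫ ℚ.< 0ℚ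
  G-neg = G-neg′ (choose s)

  module _ (a : Funℚ d) (km : Fin n) (rm Fm : ℚ) (rm-pos : 0ℚ ℚ.< rm)
           (a-ū : ∀ i → 0ℚ ℚ.≤ 0ℚ ℚ.- ⟪ a , ū i ⟫)
           (a-ū≡0 : ∀ i → ⟪ a , ū i ⟫ ≡ 0ℚ → ∀ j → ū i j ≡ rm ℚ.* u km j) where
    a≤0′ : ∀ i (c : Rescaled i) → 0ℚ ℚ.≤ 0ℚ ℚ.- ⟪ a , ū′ c ⟫ → ⟪ a , u i ⟫ ℚ.≤ 0ℚ
    a≤0′ i (k , r , F , _ , F-pos , rF , _ , inj₁ refl) h =
      0≤⇒≤ (subst (0ℚ ℚ.≤_)
        (trans (sym (lem-neg F ⟪ a , (λ j → r ℚ.* u i j) ⟫)) (cong (λ z → 0ℚ ℚ.- z) (sym (unscale a i r F rF))))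
        (0≤* (ℚ.<⇒≤ F-pos) h))
    a≤0′ i (k , r , F , _ , _ , _ , _ , inj₂ z) h = ℚ.≤-reflexive (dot-zero a (u i) z)

    a≤0 : ∀ i → ⟪ a , u i ⟫ ℚ.≤ 0ℚ
    a≤0 i = a≤0′ i (choose i) (a-ū i)

    a≡0′ : ∀ i (c : Rescaled i) → (⟪ a , ū′ c ⟫ ≡ 0ℚ → ∀ j → ū′ c j ≡ rm ℚ.* u km j) →
           ⟪ a , u i ⟫ ≡ 0ℚ → ∃ λ t → 0ℚ ℚ.≤ t × (∀ j → u i j ≡ t ℚ.* u km j)
    a≡0′ i (k , r , F , _ , F-pos , rF , _ , inj₁ refl) h e =
      F ℚ.* rm , 0≤* (ℚ.<⇒≤ F-pos) (ℚ.<⇒≤ rm-pos) , λ j → begin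
        u i j                     ≡⟨ ℚ.*-identityˡ (u i j) ⟨
        1ℚ ℚ.* u i j              ≡⟨ cong (ℚ._* u i j) rF ⟨
        (r ℚ.* F) ℚ.* u i j       ≡⟨ lem-assoc F r (u i j) ⟨
        F ℚ.* (r ℚ.* u i j)       ≡⟨ cong (F ℚ.*_) (h a-ūi≡0 j) ⟩
        F ℚ.* (rm ℚ.* u km j)     ≡⟨ ℚ.*-assoc F rm (u km j) ⟨
        (F ℚ.* rm) ℚ.* u km j     ∎
      where
      a-ūi≡0 : ⟪ a , (λ j → r ℚ.* u i j) ⟫ ≡ 0ℚ
      a-ūi≡0 = trans (ℚL.dot-* a r (u i)) (trans (cong (r ℚ.*_) e) (ℚ.*-zeroʳ r))
    a≡0′ i (k , r , F , _ , _ , _ , _ , inj₂ z) h e =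
      0ℚ , ℚ.≤-refl , λ j → trans (z j) (sym (ℚ.*-zeroˡ (u km j)))

    a≡0 : ∀ i → ⟪ a , u i ⟫ ≡ 0ℚ → ∃ λ t → 0ℚ ℚ.≤ t × (∀ j → u i j ≡ t ℚ.* u km j)
    a≡0 i = a≡0′ i (choose i) (a-ū≡0 i)

  Goal : Set
  Goal = Σ (Funℚ d) λ a → Σ (Fin n) λ m →
    0ℚ ℚ.< ⟪ f , u m ⟫ × ⟪ g , u m ⟫ ℚ.< 0ℚ × ⟪ a , u m ⟫ ≡ 0ℚ ×
    (∀ i → ⟪ a , u i ⟫ ℚ.≤ 0ℚ) ×
    (∀ i → ⟪ a , u i ⟫ ≡ 0ℚ → ∃ λ t → 0ℚ ℚ.≤ t × (∀ j → u i j ≡ t ℚ.* u m j))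

  conclude′ : ∀ {i} (c : Rescaled i) a → ⟪ g , ū′ c ⟫ ℚ.< 0ℚ → ⟪ a , ū′ c ⟫ ≡ 0ℚ →
    (∀ i → 0ℚ ℚ.≤ 0ℚ ℚ.- ⟪ a , ū i ⟫) → (∀ i → ⟪ a , ū i ⟫ ≡ 0ℚ → ∀ j → ū i j ≡ ū′ c j) → Goal
  conclude′ (k , r , F , r-pos , F-pos , rF , F≡ , _) a g-ūm a-ūm a-ū a-ū≡0 =
    a , k , subst (0ℚ ℚ.<_) F≡ F-pos
    , 0<⇒< (subst (0ℚ ℚ.<_)
        (trans (sym (lem-neg F ⟪ g , (λ j → r ℚ.* u k j) ⟫)) (cong (λ z → 0ℚ ℚ.- z) (sym (unscale g k r F rF))))
        (0<* F-pos (<⇒0< g-ūm)))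
    , trans (unscale a k r F rF) (trans (cong (F ℚ.*_) a-ūm) (ℚ.*-zeroʳ F))
    , a≤0 a k r F r-pos a-ū a-ū≡0 , a≡0 a k r F r-pos a-ū a-ū≡0

  conclude : (Σ (Funℚ d) λ a → Σ (Fin n) λ m → ⟪ g , ū m ⟫ ℚ.< 0ℚ × ⟪ a , ū m ⟫ ≡ 0ℚ ×
    (∀ i → 0ℚ ℚ.≤ 0ℚ ℚ.- ⟪ a , ū i ⟫) × (∀ i → ⟪ a , ū i ⟫ ≡ 0ℚ → ∀ j → ū i j ≡ ū m j)) → Goal
  conclude (a , m , g-ūm , a-ūm , a-ū , a-ū≡0) = conclude′ (choose m) a g-ūm a-ūm a-ū a-ū≡0

-- Convex hulls of coordinate functions.

private
  sub-add : ∀ x y → (x ℚ.- y) ℚ.+ y ≡ x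
  sub-add = solve-∀ ringℚ
  sub-flip : ∀ x y → 0ℚ ℚ.- (x ℚ.- y) ≡ y ℚ.- x
  sub-flip = solve-∀ ringℚ
  lem-− : ∀ l b y → l ℚ.* (b ℚ.- y) ≡ b ℚ.* l ℚ.- l ℚ.* y
  lem-− = solve-∀ ringℚ

sum-- : ∀ {n} (f g : Funℚ n) → ℚL.sum (λ i → f i ℚ.- g i) ≡ ℚL.sum f ℚ.- ℚL.sum g
sum-- {n} f g = begin
  ℚL.sum (λ i → f i ℚ.- g i)                   ≡⟨ ones (λ i → f i ℚ.- g i) ⟨
  ⟪ (λ _ → 1ℚ) , (λ i → f i ℚ.- g i) ⟫         ≡⟨ ℚL.dot-- (λ _ → 1ℚ) f g ⟩
  ⟪ (λ _ → 1ℚ) , f ⟫ ℚ.- ⟪ (λ _ → 1ℚ) , g ⟫    ≡⟨ cong₂ ℚ._-_ (ones f) (ones g) ⟩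
  ℚL.sum f ℚ.- ℚL.sum g                        ∎
  where
  open ≡-Reasoning
  ones : ∀ (h : Funℚ n) → ⟪ (λ _ → 1ℚ) , h ⟫ ≡ ℚL.sum h
  ones h = ℚL.sum-cong-≋ (λ i → ℚ.*-identityˡ (h i))

-- The weights sum to 1, so the constant `b` can be distributed over them. A bound on a hull thereby
-- becomes the nonnegativity of a sum of nonnegative terms.
sum-affine : ∀ {n} (l y : Funℚ n) b → ℚL.sum l ≡ 1ℚ → ℚL.sum (λ i → l i ℚ.* (b ℚ.- y i)) ≡ b ℚ.- ⟪ l , y ⟫
sum-affine l y b l≡1 = begin
  ℚL.sum (λ i → l i ℚ.* (b ℚ.- y i))                      ≡⟨ ℚL.sum-cong-≋ (λ i → lem-− (l i) b (y i)) ⟩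
  ℚL.sum (λ i → b ℚ.* l i ℚ.- l i ℚ.* y i)                ≡⟨ sum-- (λ i → b ℚ.* l i) (λ i → l i ℚ.* y i) ⟩
  ℚL.sum (λ i → b ℚ.* l i) ℚ.- ⟪ l , y ⟫                  ≡⟨ cong (ℚ._- ⟪ l , y ⟫) (ℚL.*-distribˡ-sum b l) ⟨
  b ℚ.* ℚL.sum l ℚ.- ⟪ l , y ⟫                            ≡⟨ cong (λ z → b ℚ.* z ℚ.- ⟪ l , y ⟫) l≡1 ⟩
  b ℚ.* 1ℚ ℚ.- ⟪ l , y ⟫                                  ≡⟨ cong (ℚ._- ⟪ l , y ⟫) (ℚ.*-identityʳ b) ⟩
  b ℚ.- ⟪ l , y ⟫                                         ∎
  where open ≡-Reasoning

sum-affine′ : ∀ {n} (l y : Funℚ n) b → ℚL.sum l ≡ 1ℚ → ℚL.sum (λ i → l i ℚ.* (y i ℚ.- b)) ≡ ⟪ l , y ⟫ ℚ.- b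
sum-affine′ l y b l≡1 = begin
  ℚL.sum (λ i → l i ℚ.* (y i ℚ.- b))                 ≡⟨ ℚL.dot-- l y (λ _ → b) ⟩
  ⟪ l , y ⟫ ℚ.- ℚL.sum (λ i → l i ℚ.* b)             ≡⟨ cong (λ z → ⟪ l , y ⟫ ℚ.- z) (ℚL.*-distribʳ-sum b l) ⟨
  ⟪ l , y ⟫ ℚ.- ℚL.sum l ℚ.* b                       ≡⟨ cong (λ z → ⟪ l , y ⟫ ℚ.- z ℚ.* b) l≡1 ⟩
  ⟪ l , y ⟫ ℚ.- 1ℚ ℚ.* b                             ≡⟨ cong (λ z → ⟪ l , y ⟫ ℚ.- z) (ℚ.*-identityˡ b) ⟩
  ⟪ l , y ⟫ ℚ.- b                                    ∎
  where open ≡-Reasoning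

-- The counterpart of `InConv` on coordinate functions. Points are compared coordinate by
-- coordinate, which avoids equality of functions.
Hull : ∀ {n d} → (Fin n → Funℚ d) → Funℚ d → Set
Hull {n} X f = Σ (Funℚ n) λ l → (∀ i → 0ℚ ℚ.≤ l i) × ℚL.sum l ≡ 1ℚ × (∀ j → f j ≡ ℚL.sum (λ i → l i ℚ.* X i j))

hull-resp : ∀ {n d} {X : Fin n → Funℚ d} {f f′} → (∀ j → f′ j ≡ f j) → Hull X f → Hull X f′
hull-resp e (l , l≥0 , l≡1 , h) = l , l≥0 , l≡1 , λ j → trans (e j) (h j)

hull-point : ∀ {n d} (X : Fin n → Funℚ d) i → Hull X (X i)
hull-point X i = ℚL.δ i , δ≥0 i , δ≡1 , λ j → sym (ℚL.dot-δ i (λ k → X k j))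
  where
  δ≥0 : ∀ {n} (i : Fin n) k → 0ℚ ℚ.≤ ℚL.δ i k
  δ≥0 zero    zero    = ℚ.<⇒≤ (ℚ.positive⁻¹ 1ℚ)
  δ≥0 zero    (suc k) = ℚ.≤-refl
  δ≥0 (suc i) zero    = ℚ.≤-refl
  δ≥0 (suc i) (suc k) = δ≥0 i k
  δ≡1 : ℚL.sum (ℚL.δ i) ≡ 1ℚ
  δ≡1 = trans (ℚL.sum-cong-≋ (λ k → sym (ℚ.*-identityʳ (ℚL.δ i k)))) (ℚL.dot-δ i (λ _ → 1ℚ))

hull-dot : ∀ {n d} {X : Fin n → Funℚ d} {f} (a : Funℚ d) (h : Hull X f) →
           ⟪ a , f ⟫ ≡ ⟪ proj₁ h , (λ i → ⟪ a , X i ⟫) ⟫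
hull-dot {X = X} a (l , _ , _ , h) = trans (ℚL.dot-cong a h) (ℚL.dot-sum a l X)

hull-≤ : ∀ {n d} {X : Fin n → Funℚ d} {f} (a : Funℚ d) b → (∀ i → ⟪ a , X i ⟫ ℚ.≤ b) → Hull X f → ⟪ a , f ⟫ ℚ.≤ b
hull-≤ {X = X} {f} a b le h@(l , l≥0 , l≡1 , _) = 0≤⇒≤ (subst (0ℚ ℚ.≤_)
  (trans (sum-affine l (λ i → ⟪ a , X i ⟫) b l≡1) (cong (λ z → b ℚ.- z) (sym (hull-dot a h))))
  (ℚN.sum-0≤ (λ i → l i ℚ.* (b ℚ.- ⟪ a , X i ⟫)) (λ i → 0≤* (l≥0 i) (≤⇒0≤ (le i)))))

hull-trans : ∀ {m n d} {X : Fin n → Funℚ d} {Y : Fin m → Funℚ d} {f} → (∀ i → Hull X (Y i)) → Hull Y f → Hull X f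
hull-trans {m} {n} {d} {X} {Y} {f} hY (l , l≥0 , l≡1 , h) =
  w , (λ k → ℚN.sum-0≤ _ (λ i → 0≤* (l≥0 i) (proj₁ (proj₂ (hY i)) k))) , w≡1 , f≡
  where
  open ≡-Reasoning
  c : Fin m → Funℚ n
  c i = proj₁ (hY i)
  w : Funℚ n
  w k = ℚL.sum (λ i → l i ℚ.* c i k)
  w≡1 : ℚL.sum w ≡ 1ℚ
  w≡1 = begin
    ℚL.sum (λ k → ℚL.sum (λ i → l i ℚ.* c i k))    ≡⟨ ℚL.∑-comm (λ k i → l i ℚ.* c i k) ⟩
    ℚL.sum (λ i → ℚL.sum (λ k → l i ℚ.* c i k))    ≡⟨ ℚL.sum-cong-≋ (λ i → ℚL.*-distribˡ-sum (l i) (c i)) ⟨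
    ℚL.sum (λ i → l i ℚ.* ℚL.sum (c i))            ≡⟨ ℚL.sum-cong-≋ (λ i → cong (l i ℚ.*_) (proj₁ (proj₂ (proj₂ (hY i))))) ⟩
    ℚL.sum (λ i → l i ℚ.* 1ℚ)                      ≡⟨ ℚL.sum-cong-≋ (λ i → ℚ.*-identityʳ (l i)) ⟩
    ℚL.sum l                                       ≡⟨ l≡1 ⟩
    1ℚ                                             ∎
  f≡ : ∀ j → f j ≡ ℚL.sum (λ k → w k ℚ.* X k j)
  f≡ j = begin
    f j                                            ≡⟨ h j ⟩
    ⟪ l , (λ i → Y i j) ⟫                          ≡⟨ ℚL.dot-cong l (λ i → trans (proj₂ (proj₂ (proj₂ (hY i))) j) (ℚL.dot-comm (c i) (λ k → X k j))) ⟩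
    ⟪ l , (λ i → ⟪ (λ k → X k j) , c i ⟫) ⟫        ≡⟨ ℚL.dot-sum (λ k → X k j) l c ⟨
    ⟪ (λ k → X k j) , w ⟫                          ≡⟨ ℚL.dot-comm (λ k → X k j) w ⟩
    ⟪ w , (λ k → X k j) ⟫                          ∎

-- Edges at an exposed point.

≗? : ∀ {d} (f g : Funℚ d) → Dec (∀ j → f j ≡ g j)
≗? f g = Fin.all? (λ j → f j ℚ.≟ g j)

module Polytope {n d} (X : Fin n → Funℚ d) where

  Exposed : Funℚ d → Set
  Exposed z = Σ (Funℚ d) λ c → ∀ f → Hull X f → ¬ (∀ j → f j ≡ z j) → ⟪ c , f ⟫ ℚ.< ⟪ c , z ⟫

  exposed-≤ : ∀ {z} ((c , _) : Exposed z) → ∀ f → Hull X f → ⟪ c , f ⟫ ℚ.≤ ⟪ c , z ⟫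
  exposed-≤ {z} (c , e) f h with ≗? f z
  ... | yes f≡z = ℚ.≤-reflexive (ℚL.dot-cong c f≡z)
  ... | no f≢z = ℚ.<⇒≤ (e f h f≢z)

  IsEdge : Funℚ d → Fin n → Funℚ d → Set
  IsEdge z m a = ¬ (∀ j → z j ≡ X m j) × ⟪ a , X m ⟫ ≡ ⟪ a , z ⟫ ×
    (∀ f → Hull X f → ⟪ a , f ⟫ ℚ.≤ ⟪ a , z ⟫) ×
    (∀ f → Hull X f → ⟪ a , f ⟫ ≡ ⟪ a , z ⟫ →
      ∃ λ t → 0ℚ ℚ.≤ t × t ℚ.≤ 1ℚ × (∀ j → f j ℚ.- z j ≡ t ℚ.* (X m j ℚ.- z j)))

  module _ (all-exposed : ∀ i → Exposed (X i)) (z : Funℚ d) (z∈ : Hull X z) (z-exp : Exposed z) where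
    private
      u : Fin n → Funℚ d
      u i j = X i j ℚ.- z j

      dot-u : ∀ a i → ⟪ a , u i ⟫ ≡ ⟪ a , X i ⟫ ℚ.- ⟪ a , z ⟫
      dot-u a i = ℚL.dot-- a (X i) z

      negc : Funℚ d → Funℚ d
      negc c j = ℚ.- c j

      dot-negc : ∀ c i → ⟪ negc c , u i ⟫ ≡ ⟪ c , z ⟫ ℚ.- ⟪ c , X i ⟫
      dot-negc c i = begin
        ⟪ negc c , u i ⟫                  ≡⟨ ℚL.dot-comm (negc c) (u i) ⟩
        ⟪ u i , negc c ⟫                  ≡⟨ ℚL.dot-neg (u i) c ⟩
        ℚ.- ⟪ u i , c ⟫                   ≡⟨ cong ℚ.-_ (trans (ℚL.dot-comm (u i) c) (dot-u c i)) ⟩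
        ℚ.- (⟪ c , X i ⟫ ℚ.- ⟪ c , z ⟫)   ≡⟨ lem ⟪ c , X i ⟫ ⟪ c , z ⟫ ⟩
        ⟪ c , z ⟫ ℚ.- ⟪ c , X i ⟫         ∎
        where
        open ≡-Reasoning
        lem : ∀ x y → ℚ.- (x ℚ.- y) ≡ y ℚ.- x
        lem = solve-∀ ringℚ

      u≡0 : ∀ i → (∀ j → X i j ≡ z j) → ∀ j → u i j ≡ 0ℚ
      u≡0 i e j = trans (cong (ℚ._- z j) (e j)) (ℚ.+-inverseʳ (z j))

      -- The functional exposing `z`, negated, is positive at every generator other than `z`. This
      -- is the pointedness of the cone that `exposed-ray` asks for.
      f-pos : ∀ i → 0ℚ ℚ.< ⟪ negc (proj₁ z-exp) , u i ⟫ ⊎ (∀ j → u i j ≡ 0ℚ)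
      f-pos i with ≗? (X i) z
      ... | yes e = inj₂ (u≡0 i e)
      ... | no ne = inj₁ (subst (0ℚ ℚ.<_) (sym (dot-negc (proj₁ z-exp) i))
                     (<⇒0< (proj₂ z-exp (X i) (hull-point X i) ne)))

      -- X m is a vertex, so no X i lies beyond it on the ray from z.
      t≤1 : ∀ i m t → 0ℚ ℚ.< ⟪ negc (proj₁ z-exp) , u m ⟫ → (∀ j → u i j ≡ t ℚ.* u m j) → t ℚ.≤ 1ℚ
      t≤1 i m t um-pos e = ℚ.≮⇒≥ λ 1<t → ℚ.<-irrefl refl (ℚ.<-≤-trans (0<* (<⇒0< 1<t) cm-pos)
          (subst (ℚ._≤ 0ℚ) (trans (cong (ℚ._- ⟪ c , u m ⟫) ci) (lem t ⟪ c , u m ⟫)) ci-cm))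
        where
        c = proj₁ (all-exposed m)
        lem : ∀ t x → t ℚ.* x ℚ.- x ≡ (t ℚ.- 1ℚ) ℚ.* x
        lem = solve-∀ ringℚ
        lem₂ : ∀ x y w → x ℚ.- y ≡ (x ℚ.- w) ℚ.- (y ℚ.- w)
        lem₂ = solve-∀ ringℚ
        z≢ : ¬ (∀ j → z j ≡ X m j)
        z≢ q = ℚ.<-irrefl (sym (ℚL.sum-zero _ (λ j → trans (cong (negc (proj₁ z-exp) j ℚ.*_) (u≡0 m (λ j → sym (q j)) j))
                 (ℚ.*-zeroʳ (negc (proj₁ z-exp) j))))) um-pos
        cm-pos : 0ℚ ℚ.< ⟪ c , u m ⟫
        cm-pos = subst (0ℚ ℚ.<_) (sym (dot-u c m)) (<⇒0< (proj₂ (all-exposed m) z z∈ z≢))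
        ci : ⟪ c , u i ⟫ ≡ t ℚ.* ⟪ c , u m ⟫
        ci = trans (ℚL.dot-cong c e) (ℚL.dot-* c t (u m))
        ci-cm : ⟪ c , u i ⟫ ℚ.- ⟪ c , u m ⟫ ℚ.≤ 0ℚ
        ci-cm = subst₂ ℚ._≤_ (trans (lem₂ ⟪ c , X i ⟫ ⟪ c , X m ⟫ ⟪ c , z ⟫) (cong₂ ℚ._-_ (sym (dot-u c i)) (sym (dot-u c m))))
          (ℚ.+-inverseʳ ⟪ c , X m ⟫)
          (ℚ.+-monoˡ-≤ (ℚ.- ⟪ c , X m ⟫) (exposed-≤ (all-exposed m) (X i) (hull-point X i)))

    module Ray (g a : Funℚ d) (m : Fin n) (um-pos : 0ℚ ℚ.< ⟪ negc (proj₁ z-exp) , u m ⟫)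
      (gm-neg : ⟪ g , u m ⟫ ℚ.< 0ℚ) (am≡0 : ⟪ a , u m ⟫ ≡ 0ℚ) (a≤0 : ∀ i → ⟪ a , u i ⟫ ℚ.≤ 0ℚ)
      (a≡0 : ∀ i → ⟪ a , u i ⟫ ≡ 0ℚ → ∃ λ t → 0ℚ ℚ.≤ t × (∀ j → u i j ≡ t ℚ.* u m j)) where
      open ≡-Reasoning
      z≢ : ¬ (∀ j → z j ≡ X m j)
      z≢ q = ℚ.<-irrefl (ℚL.sum-zero (λ j → g j ℚ.* u m j) (λ j → trans (cong (g j ℚ.*_) (u≡0 m (λ j → sym (q j)) j)) (ℚ.*-zeroʳ (g j)))) gm-neg
      am≡ : ⟪ a , X m ⟫ ≡ ⟪ a , z ⟫
      am≡ = trans (sym (sub-add ⟪ a , X m ⟫ ⟪ a , z ⟫))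
        (trans (cong (ℚ._+ ⟪ a , z ⟫) (trans (sym (dot-u a m)) am≡0)) (ℚ.+-identityˡ ⟪ a , z ⟫))
      aX≤ : ∀ i → ⟪ a , X i ⟫ ℚ.≤ ⟪ a , z ⟫
      aX≤ i = 0≤⇒≤ (subst (0ℚ ℚ.≤_) (trans (cong (λ w → 0ℚ ℚ.- w) (dot-u a i)) (sub-flip ⟪ a , X i ⟫ ⟪ a , z ⟫)) (≤⇒0≤ (a≤0 i)))
      face : ∀ f → Hull X f → ⟪ a , f ⟫ ≡ ⟪ a , z ⟫ →
        ∃ λ t → 0ℚ ℚ.≤ t × t ℚ.≤ 1ℚ × (∀ j → f j ℚ.- z j ≡ t ℚ.* (X m j ℚ.- z j))
      face f h@(l , l≥0 , l≡1 , f≡) af≡ = τ , τ≥0 , τ≤1 , f≡τ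
        where
        -- Complementary slackness: `a` attains its maximum at `f`, so a generator of positive
        -- weight attains it as well and is a multiple of `u m` seen from `z`.
        tight : ∀ i → l i ℚ.* (⟪ a , z ⟫ ℚ.- ⟪ a , X i ⟫) ≡ 0ℚ
        tight = ℚN.sum-≈0 (λ i → l i ℚ.* (⟪ a , z ⟫ ℚ.- ⟪ a , X i ⟫)) (λ i → 0≤* (l≥0 i) (≤⇒0≤ (aX≤ i)))
          (trans (sum-affine l (λ i → ⟪ a , X i ⟫) ⟪ a , z ⟫ l≡1)
            (trans (cong (λ w → ⟪ a , z ⟫ ℚ.- w) (trans (sym (hull-dot a h)) af≡)) (ℚ.+-inverseʳ ⟪ a , z ⟫)))
        Piece : Fin n → Set
        Piece i = Σ ℚ λ t → 0ℚ ℚ.≤ t × t ℚ.≤ 1ℚ × (∀ j → l i ℚ.* u i j ≡ (l i ℚ.* t) ℚ.* u m j)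
        au≡0 : ∀ i → 0ℚ ℚ.< l i → ⟪ a , u i ⟫ ≡ 0ℚ
        au≡0 i li>0 with ℚ.<-cmp ⟪ a , u i ⟫ 0ℚ
        ... | tri≈ _ q _ = q
        ... | tri> _ _ q = ⊥-elim (ℚ.<-irrefl refl (ℚ.<-≤-trans q (a≤0 i)))
        ... | tri< q _ _ = ⊥-elim (ℚ.<-irrefl (sym (trans (cong (l i ℚ.*_)
                (trans (cong (λ w → 0ℚ ℚ.- w) (dot-u a i)) (sub-flip ⟪ a , X i ⟫ ⟪ a , z ⟫))) (tight i))) (0<* li>0 (<⇒0< q)))
        piece : ∀ i → Piece i
        piece i with ℚ.<-cmp (l i) 0ℚ
        ... | tri< q _ _ = ⊥-elim (ℚ.<-irrefl refl (ℚ.<-≤-trans q (l≥0 i)))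
        -- A generator of weight 0 need not lie on the ray; any factor in the unit interval serves,
        -- and 0 is taken.
        ... | tri≈ _ q _ = 0ℚ , ℚ.≤-refl , ℚ.<⇒≤ (ℚ.positive⁻¹ 1ℚ) , λ j →
          trans (trans (cong (ℚ._* u i j) q) (ℚ.*-zeroˡ (u i j)))
            (sym (trans (cong (ℚ._* u m j) (ℚ.*-zeroʳ (l i))) (ℚ.*-zeroˡ (u m j))))
        ... | tri> _ _ q with a≡0 i (au≡0 i q)
        ...   | t , t≥0 , e = t , t≥0 , t≤1 i m t um-pos e , λ j →
          trans (cong (l i ℚ.*_) (e j)) (sym (ℚ.*-assoc (l i) t (u m j)))
        t : Fin n → ℚ
        t i = proj₁ (piece i)
        τ : ℚ
        τ = ℚL.sum (λ i → l i ℚ.* t i)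
        τ≥0 : 0ℚ ℚ.≤ τ
        τ≥0 = ℚN.sum-0≤ (λ i → l i ℚ.* t i) (λ i → 0≤* (l≥0 i) (proj₁ (proj₂ (piece i))))
        τ≤1 : τ ℚ.≤ 1ℚ
        τ≤1 = 0≤⇒≤ (subst (0ℚ ℚ.≤_) (sum-affine l t 1ℚ l≡1)
          (ℚN.sum-0≤ (λ i → l i ℚ.* (1ℚ ℚ.- t i)) (λ i → 0≤* (l≥0 i) (≤⇒0≤ (proj₁ (proj₂ (proj₂ (piece i))))))))
        f≡τ : ∀ j → f j ℚ.- z j ≡ τ ℚ.* u m j
        f≡τ j = begin
          f j ℚ.- z j                               ≡⟨ cong (ℚ._- z j) (f≡ j) ⟩
          ⟪ l , (λ i → X i j) ⟫ ℚ.- z j             ≡⟨ sum-affine′ l (λ i → X i j) (z j) l≡1 ⟨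
          ℚL.sum (λ i → l i ℚ.* u i j)              ≡⟨ ℚL.sum-cong-≋ (λ i → proj₂ (proj₂ (proj₂ (piece i))) j) ⟩
          ℚL.sum (λ i → (l i ℚ.* t i) ℚ.* u m j)    ≡⟨ ℚL.*-distribʳ-sum (u m j) (λ i → l i ℚ.* t i) ⟨
          τ ℚ.* u m j                               ∎

    -- The exposed ray on which `g` is negative meets the hull in the segment from `z` to `X m`: the
    -- generators in the face of `a` lie on this ray, and none of them lies beyond the exposed point
    -- `X m`. With a dual functional as `g`, this is what puts the polytope into the cone of its
    -- edge directions.
    edge-exists : ∀ (g : Funℚ d) s → ⟪ g , (λ j → X s j ℚ.- z j) ⟫ ℚ.< 0ℚ →
      Σ (Funℚ d) λ a → Σ (Fin n) λ m → ⟪ g , (λ j → X m j ℚ.- z j) ⟫ ℚ.< 0ℚ × IsEdge z m a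
    edge-exists g s g-neg = conclude (exposed-ray u (negc (proj₁ z-exp)) g s f-pos g-neg)
      where
      conclude : _ → _
      conclude (a , m , um-pos , gm-neg , am≡0 , a≤0 , a≡0) =
        a , m , gm-neg , z≢ , am≡ , (λ f → hull-≤ a ⟪ a , z ⟫ aX≤) , face
        where open Ray g a m um-pos gm-neg am≡0 a≤0 a≡0

-- Vectors read as coordinate functions.

vec-ext : ∀ {A : Set} {n} {x y : Vec A n} → (∀ i → Vec.lookup x i ≡ Vec.lookup y i) → x ≡ y
vec-ext {x = x} {y} h = trans (sym (Vec.tabulate∘lookup x)) (trans (Vec.tabulate-cong h) (Vec.tabulate∘lookup y))

lookup-embed : ∀ {d} (z : Vec ℤ d) j → Vec.lookup (embed z) j ≡ ι (Vec.lookup z j)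
lookup-embed z j = Vec.lookup-map j ι z

dot-lookup : ∀ {d} (c x : Point d) → dot c x ≡ ⟪ Vec.lookup c , Vec.lookup x ⟫
dot-lookup []      []      = refl
dot-lookup (a ∷ c) (b ∷ x) = cong (a ℚ.* b ℚ.+_) (dot-lookup c x)

sumℚ-lookup : ∀ {n} (l : Vec ℚ n) → sumℚ l ≡ ℚL.sum (Vec.lookup l)
sumℚ-lookup []      = refl
sumℚ-lookup (a ∷ l) = cong (a ℚ.+_) (sumℚ-lookup l)

lincomb-lookup : ∀ {n d} (l : Vec ℚ n) (X : Vec (Point d) n) j →
  Vec.lookup (lincomb l X) j ≡ ℚL.sum (λ i → Vec.lookup l i ℚ.* Vec.lookup (Vec.lookup X i) j)
lincomb-lookup []      []      j = Vec.lookup-replicate j 0ℚ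
lincomb-lookup (a ∷ l) (x ∷ X) j = trans (Vec.lookup-zipWith ℚ._+_ j (a • x) (lincomb l X))
  (cong₂ ℚ._+_ (Vec.lookup-map j (a ℚ.*_) x) (lincomb-lookup l X j))

zlincomb-lookup : ∀ {n d} (l : Vec ℤ n) (X : Vec (Vec ℤ d) n) j →
  Vec.lookup (zlincomb l X) j ≡ ℤL.sum (λ i → Vec.lookup l i ℤ.* Vec.lookup (Vec.lookup X i) j)
zlincomb-lookup []      []      j = Vec.lookup-replicate j (+ 0)
zlincomb-lookup (a ∷ l) (x ∷ X) j = trans (Vec.lookup-zipWith ℤ._+_ j (Vec.map (a ℤ.*_) x) (zlincomb l X))
  (cong₂ ℤ._+_ (Vec.lookup-map j (a ℤ.*_) x) (zlincomb-lookup l X j))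

InConv⇒Hull : ∀ {n d} {X : Vec (Point d) n} {x} {Y : Fin n → Funℚ d} → (∀ i j → Vec.lookup (Vec.lookup X i) j ≡ Y i j) →
  InConv X x → Hull Y (Vec.lookup x)
InConv⇒Hull {X = X} e (l , l≥0 , l≡1 , x≡) = Vec.lookup l , l≥0 , trans (sym (sumℚ-lookup l)) l≡1 ,
  λ j → trans (trans (cong (λ x → Vec.lookup x j) x≡) (lincomb-lookup l X j))
              (ℚL.sum-cong-≋ (λ i → cong (Vec.lookup l i ℚ.*_) (e i j)))

Hull⇒InConv : ∀ {n d} {X : Vec (Point d) n} {x} {Y : Fin n → Funℚ d} → (∀ i j → Vec.lookup (Vec.lookup X i) j ≡ Y i j) →
  Hull Y (Vec.lookup x) → InConv X x
Hull⇒InConv {X = X} {x} e (l , l≥0 , l≡1 , x≡) = Vec.tabulate l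
  , (λ i → subst (0ℚ ℚ.≤_) (sym (Vec.lookup∘tabulate l i)) (l≥0 i))
  , trans (sumℚ-lookup (Vec.tabulate l)) (trans (ℚL.sum-cong-≋ (Vec.lookup∘tabulate l)) l≡1)
  , vec-ext (λ j → trans (x≡ j) (sym (trans (lincomb-lookup (Vec.tabulate l) X j)
      (ℚL.sum-cong-≋ (λ i → cong₂ ℚ._*_ (Vec.lookup∘tabulate l i) (e i j))))))

lookup-⊖ : ∀ {d} (x y : Point d) j → Vec.lookup (x ⊖ y) j ≡ Vec.lookup x j ℚ.- Vec.lookup y j
lookup-⊖ x y j = Vec.lookup-zipWith ℚ._-_ j x y

hull-segment : ∀ {n d} {X : Fin n → Funℚ d} {f g h : Funℚ d} t → 0ℚ ℚ.≤ t → t ℚ.≤ 1ℚ → Hull X f → Hull X g →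
  (∀ j → h j ℚ.- f j ≡ t ℚ.* (g j ℚ.- f j)) → Hull X h
hull-segment {n} {d} {X} {f} {g} {h} t t≥0 t≤1 hf hg e = hull-trans {Y = Y} Y∈ (l , l≥0 , l≡1 , h≡)
  where
  Y : Fin 2 → Funℚ d
  Y zero    = f
  Y (suc _) = g
  Y∈ : ∀ i → Hull X (Y i)
  Y∈ zero    = hf
  Y∈ (suc _) = hg
  l : Funℚ 2
  l zero    = 1ℚ ℚ.- t
  l (suc _) = t
  l≥0 : ∀ i → 0ℚ ℚ.≤ l i
  l≥0 zero    = ≤⇒0≤ t≤1
  l≥0 (suc _) = t≥0
  lem₁ : ∀ o t → (o ℚ.- t) ℚ.+ (t ℚ.+ 0ℚ) ≡ o
  lem₁ = solve-∀ ringℚ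
  l≡1 : ℚL.sum l ≡ 1ℚ
  l≡1 = lem₁ 1ℚ t
  lem₂ : ∀ h f → h ≡ (h ℚ.- f) ℚ.+ f
  lem₂ = solve-∀ ringℚ
  lem₃ : ∀ t f g → t ℚ.* (g ℚ.- f) ℚ.+ f ≡ (1ℚ ℚ.- t) ℚ.* f ℚ.+ (t ℚ.* g ℚ.+ 0ℚ)
  lem₃ = solve-∀ ringℚ
  h≡ : ∀ j → h j ≡ ℚL.sum (λ i → l i ℚ.* Y i j)
  h≡ j = trans (lem₂ (h j) (f j)) (trans (cong (ℚ._+ f j) (e j)) (lem₃ t (f j) (g j)))

InConv-pair : ∀ {d} {u w x : Point d} t → 0ℚ ℚ.≤ t → t ℚ.≤ 1ℚ →
  (∀ j → Vec.lookup x j ℚ.- Vec.lookup u j ≡ t ℚ.* (Vec.lookup w j ℚ.- Vec.lookup u j)) → InConv (u ∷ w ∷ []) x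
InConv-pair {u = u} {w} {x} t t≥0 t≤1 e =
  Hull⇒InConv {X = u ∷ w ∷ []} {x} {Y} (λ i j → refl)
    (hull-segment {X = Y} t t≥0 t≤1 (hull-point Y zero) (hull-point Y (suc zero)) e)
  where
  Y : Fin 2 → Funℚ _
  Y i j = Vec.lookup (Vec.lookup (u ∷ w ∷ []) i) j

-- Lattice bases with their dual bases.

record Basis (d : ℕ) : Set where
  field
    q φ    : Fin d → Funℤ d
    dual   : ∀ k j → ⟨ φ k , q j ⟩ ≡ ℤL.δ k j
    expand : ∀ z i → z i ≡ ℤL.sum (λ k → ⟨ φ k , z ⟩ ℤ.* q k i)

basis : ∀ {d} (p : Vec (Vec ℤ d) d) → IsBasis p →
  Σ (Basis d) λ B → ∀ k i → Basis.q B k i ≡ Vec.lookup (Vec.lookup p k) i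
basis {d} p (gen , ind) = record { q = q ; φ = φ ; dual = dual ; expand = expand } , λ _ _ → refl
  where
  open ≡-Reasoning
  q φ : Fin d → Funℤ d
  q k i = Vec.lookup (Vec.lookup p k) i
  -- The coefficients of the `j`-th unit vector, supplied by `gen`, form column `j` of the dual
  -- basis.
  φ k j = Vec.lookup (proj₁ (gen (Vec.tabulate (ℤL.δ j)))) k
  δ-expand : ∀ j i → ℤL.δ j i ≡ ℤL.sum (λ k → φ k j ℤ.* q k i)
  δ-expand j i = trans (sym (Vec.lookup∘tabulate (ℤL.δ j) i))
    (trans (cong (λ x → Vec.lookup x i) (proj₂ (gen (Vec.tabulate (ℤL.δ j)))))
      (zlincomb-lookup (proj₁ (gen (Vec.tabulate (ℤL.δ j)))) p i))
  expand : ∀ z i → z i ≡ ℤL.sum (λ k → ⟨ φ k , z ⟩ ℤ.* q k i)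
  expand z i = begin
    z i                                                     ≡⟨ ℤL.dot-δ i z ⟨
    ⟨ ℤL.δ i , z ⟩                                          ≡⟨ ℤL.dot-comm (ℤL.δ i) z ⟩
    ⟨ z , ℤL.δ i ⟩                                          ≡⟨ ℤL.dot-cong z (λ j → trans (ℤL.δ-sym i j) (δ-expand j i)) ⟩
    ⟨ z , (λ j → ℤL.sum (λ k → φ k j ℤ.* q k i)) ⟩          ≡⟨ ℤL.dot-cong z (λ j → ℤL.dot-comm (λ k → φ k j) (λ k → q k i)) ⟩
    ⟨ z , (λ j → ℤL.sum (λ k → q k i ℤ.* φ k j)) ⟩          ≡⟨ ℤL.dot-sum z (λ k → q k i) φ ⟩
    ℤL.sum (λ k → q k i ℤ.* ⟨ z , φ k ⟩)                    ≡⟨ ℤL.sum-cong-≋ (λ k → trans (ℤ.*-comm (q k i) ⟨ z , φ k ⟩) (cong (ℤ._* q k i) (ℤL.dot-comm z (φ k)))) ⟩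
    ℤL.sum (λ k → ⟨ φ k , z ⟩ ℤ.* q k i)                    ∎
  dual : ∀ k j → ⟨ φ k , q j ⟩ ≡ ℤL.δ k j
  dual k j = begin
    ⟨ φ k , q j ⟩                       ≡⟨ lem ⟨ φ k , q j ⟩ (ℤL.δ j k) ⟩
    c k ℤ.+ ℤL.δ j k                    ≡⟨ cong (ℤ._+ ℤL.δ j k) (Vec.lookup∘tabulate c k) ⟨
    Vec.lookup (Vec.tabulate c) k ℤ.+ ℤL.δ j k ≡⟨ cong (λ x → Vec.lookup x k ℤ.+ ℤL.δ j k) (ind (Vec.tabulate c) c≡0) ⟩
    Vec.lookup (Vec.replicate d (+ 0)) k ℤ.+ ℤL.δ j k ≡⟨ cong (ℤ._+ ℤL.δ j k) (Vec.lookup-replicate k (+ 0)) ⟩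
    + 0 ℤ.+ ℤL.δ j k                    ≡⟨ ℤ.+-identityˡ (ℤL.δ j k) ⟩
    ℤL.δ j k                            ≡⟨ ℤL.δ-sym j k ⟩
    ℤL.δ k j                            ∎
    where
    lem : ∀ x y → x ≡ (x ℤ.- y) ℤ.+ y
    lem = solve-∀ ringℤ
    -- The coordinates of `q j` given by `expand`, minus the obvious ones. They are the coefficients
    -- of a relation, so independence makes them vanish.
    c : Funℤ d
    c k = ⟨ φ k , q j ⟩ ℤ.- ℤL.δ j k
    c≡0 : zlincomb (Vec.tabulate c) p ≡ Vec.replicate d (+ 0)
    c≡0 = vec-ext λ i → begin
      Vec.lookup (zlincomb (Vec.tabulate c) p) i     ≡⟨ zlincomb-lookup (Vec.tabulate c) p i ⟩
      ℤL.sum (λ k → Vec.lookup (Vec.tabulate c) k ℤ.* q k i) ≡⟨ ℤL.sum-cong-≋ (λ k → trans (cong (ℤ._* q k i) (Vec.lookup∘tabulate c k)) (ℤ.*-comm (c k) (q k i))) ⟩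
      ⟨ (λ k → q k i) , c ⟩                      ≡⟨ ℤL.dot-- (λ k → q k i) (λ k → ⟨ φ k , q j ⟩) (ℤL.δ j) ⟩
      ⟨ (λ k → q k i) , (λ k → ⟨ φ k , q j ⟩) ⟩ ℤ.- ⟨ (λ k → q k i) , ℤL.δ j ⟩
        ≡⟨ cong₂ ℤ._-_ (ℤL.dot-comm (λ k → q k i) (λ k → ⟨ φ k , q j ⟩)) (ℤL.dot-comm (λ k → q k i) (ℤL.δ j)) ⟩
      ⟨ (λ k → ⟨ φ k , q j ⟩) , (λ k → q k i) ⟩ ℤ.- ⟨ ℤL.δ j , (λ k → q k i) ⟩
        ≡⟨ cong₂ ℤ._-_ (sym (expand (q j) i)) (ℤL.dot-δ j (λ k → q k i)) ⟩
      q j i ℤ.- q j i                            ≡⟨ ℤ.+-inverseʳ (q j i) ⟩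
      + 0                                        ≡⟨ Vec.lookup-replicate i (+ 0) ⟨
      Vec.lookup (Vec.replicate d (+ 0)) i           ∎

-- Frames at lattice points

hull-≥ : ∀ {n d} {X : Fin n → Funℚ d} {f} (a : Funℚ d) b → (∀ i → b ℚ.≤ ⟪ a , X i ⟫) → Hull X f → b ℚ.≤ ⟪ a , f ⟫
hull-≥ {X = X} {f} a b le h@(l , l≥0 , l≡1 , _) = 0≤⇒≤ (subst (0ℚ ℚ.≤_)
  (trans (sum-affine′ l (λ i → ⟪ a , X i ⟫) b l≡1) (cong (ℚ._- b) (sym (hull-dot a h))))
  (ℚN.sum-0≤ (λ i → l i ℚ.* (⟪ a , X i ⟫ ℚ.- b)) (λ i → 0≤* (l≥0 i) (≤⇒0≤ (le i)))))

dot-ι-- : ∀ {d} (a x y : Funℤ d) → ι ⟨ a , (λ j → x j ℤ.- y j) ⟩ ≡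
  ⟪ (λ j → ι (a j)) , (λ j → ι (x j)) ⟫ ℚ.- ⟪ (λ j → ι (a j)) , (λ j → ι (y j)) ⟫
dot-ι-- a x y = trans (cong ι (ℤL.dot-- a x y)) (trans (ι-- ⟨ a , x ⟩ ⟨ a , y ⟩) (cong₂ ℚ._-_ (dot-ι a x) (dot-ι a y)))

private
  x+y-x : ∀ x y → (x ℚ.+ y) ℚ.- x ≡ y
  x+y-x = solve-∀ ringℚ
  lone₁ : ∀ x y → y ≡ (x ℚ.+ y) ℚ.- x
  lone₁ = solve-∀ ringℚ
  lone₂ : ∀ x y N → (N ℚ.- 1ℚ) ℚ.* y ℚ.+ ((x ℚ.+ y) ℚ.- (x ℚ.+ N ℚ.* y)) ≡ 0ℚ
  lone₂ = solve-∀ ringℚ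

record Frame {d} (V : Funℤ d → Set) (v : Funℤ d) : Set where
  field
    lattice-basis : Basis d
  open Basis lattice-basis public
  field
    nbr : ∀ k → V (λ j → v j ℤ.+ q k j)
    pos : ∀ k {x} → V x → + 0 ℤ.≤ ⟨ φ k , (λ j → x j ℤ.- v j) ⟩

dot-ι-line : ∀ {d} (c : Funℚ d) (x y : Funℤ d) N → ⟪ c , (λ j → ι (x j ℤ.+ N ℤ.* y j)) ⟫ ≡
  ⟪ c , (λ j → ι (x j)) ⟫ ℚ.+ ι N ℚ.* ⟪ c , (λ j → ι (y j)) ⟫
dot-ι-line {d} c x y N = begin
  ⟪ c , (λ j → ι (x j ℤ.+ N ℤ.* y j)) ⟫       ≡⟨ ℚL.dot-cong c e ⟩
  ⟪ c , (λ j → xℚ j ℚ.+ ι N ℚ.* yℚ j) ⟫       ≡⟨ ℚL.dot-+ c xℚ (λ j → ι N ℚ.* yℚ j) ⟩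
  ⟪ c , xℚ ⟫ ℚ.+ ⟪ c , (λ j → ι N ℚ.* yℚ j) ⟫ ≡⟨ cong (λ t → ⟪ c , xℚ ⟫ ℚ.+ t) (ℚL.dot-* c (ι N) yℚ) ⟩
  ⟪ c , xℚ ⟫ ℚ.+ ι N ℚ.* ⟪ c , yℚ ⟫           ∎
  where
  open ≡-Reasoning
  xℚ yℚ : Funℚ d
  xℚ j = ι (x j)
  yℚ j = ι (y j)
  e : ∀ j → ι (x j ℤ.+ N ℤ.* y j) ≡ xℚ j ℚ.+ ι N ℚ.* yℚ j
  e j = trans (ι-+ (x j) (N ℤ.* y j)) (cong (λ t → ι (x j) ℚ.+ t) (ι-* N (y j)))

-- Along the line the functional has slope `cy` per step. The first inequality makes `cy` positive,
-- the second makes `(N - 1) cy` negative.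
no-interior-max : ∀ {cx cy cm cN N} → cm ≡ cx ℚ.+ cy → cN ≡ cx ℚ.+ N ℚ.* cy → 1ℚ ℚ.< N → cx ℚ.< cm → cN ℚ.< cm → ⊥
no-interior-max {cx} {cy} {N = N} refl refl 1<N cx<cm cN<cm =
  ℚ.<-irrefl refl (subst (0ℚ ℚ.<_) (lone₂ cx cy N) (ℚ.+-mono-< (0<* (<⇒0< 1<N) cy>0) (<⇒0< cN<cm)))
  where
  cy>0 : 0ℚ ℚ.< cy
  cy>0 = subst (0ℚ ℚ.<_) (sym (lone₁ cx cy)) (<⇒0< cx<cm)

module LatticePoints {n d} (S : Fin n → Funℤ d) where

  X : Fin n → Funℚ d
  X i j = ι (S i j)

  -- A record and not a synonym of `Hull`, so that unification recovers `z` from `V z`.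
  record V (z : Funℤ d) : Set where
    constructor mkV
    field
      hull : Hull X (λ j → ι (z j))
  open V public

  V-resp : ∀ {z z′} → (∀ j → z′ j ≡ z j) → V z → V z′
  V-resp {z} {z′} e (mkV h) = mkV (hull-resp {f = λ j → ι (z j)} {λ j → ι (z′ j)} (λ j → cong ι (e j)) h)

  V-gen : ∀ i → V (S i)
  V-gen i = mkV (hull-point X i)

  open Polytope X

  pos-hull : ∀ {v} (a : Funℤ d) → (∀ i → + 0 ℤ.≤ ⟨ a , (λ j → S i j ℤ.- v j) ⟩) → ∀ {f} → Hull X f →
             ⟪ (λ j → ι (a j)) , (λ j → ι (v j)) ⟫ ℚ.≤ ⟪ (λ j → ι (a j)) , f ⟫
  pos-hull {v} a h = hull-≥ (λ j → ι (a j)) _ (λ i → 0≤⇒≤ (subst (0ℚ ℚ.≤_) (dot-ι-- a (S i) v) (ι-≤ (h i))))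

  pos-lattice : ∀ {v} (a : Funℤ d) → (∀ i → + 0 ℤ.≤ ⟨ a , (λ j → S i j ℤ.- v j) ⟩) → ∀ {x} → V x →
                + 0 ℤ.≤ ⟨ a , (λ j → x j ℤ.- v j) ⟩
  pos-lattice {v} a h {x} vx = ι-≤⁻¹ (subst (0ℚ ℚ.≤_) (sym (dot-ι-- a x v)) (≤⇒0≤ (pos-hull {v} a h (hull vx))))

  -- The point `x + y` sits at parameter `1/N` on the segment from `x` to `x + N y`.
  between : ∀ (x y : Funℤ d) (N : ℤ) → + 1 ℤ.≤ N → V x → V (λ j → x j ℤ.+ N ℤ.* y j) → V (λ j → x j ℤ.+ y j)
  between x y N N≥1 (mkV vx) (mkV vxN) with reciprocal (ι-< {+ 0} {N} (ℤ.<-≤-trans (ℤ.+<+ (ℕ.s≤s ℕ.z≤n)) N≥1))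
  ... | r , r>0 , rN = mkV (hull-segment {X = X} {λ j → ι (x j)} {λ j → ι (x j ℤ.+ N ℤ.* y j)} {λ j → ι (x j ℤ.+ y j)} r (ℚ.<⇒≤ r>0) r≤1 vx vxN (λ j → begin
      ι (x j ℤ.+ y j) ℚ.- ι (x j)                        ≡⟨ cong (ℚ._- ι (x j)) (ι-+ (x j) (y j)) ⟩
      (ι (x j) ℚ.+ ι (y j)) ℚ.- ι (x j)                  ≡⟨ x+y-x (ι (x j)) (ι (y j)) ⟩
      ι (y j)                                            ≡⟨ ℚ.*-identityˡ (ι (y j)) ⟨
      1ℚ ℚ.* ι (y j)                                     ≡⟨ cong (ℚ._* ι (y j)) rN ⟨
      (r ℚ.* ι N) ℚ.* ι (y j)                            ≡⟨ ℚ.*-assoc r (ι N) (ι (y j)) ⟩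
      r ℚ.* (ι N ℚ.* ι (y j))                            ≡⟨ cong (r ℚ.*_) (ι-* N (y j)) ⟨
      r ℚ.* ι (N ℤ.* y j)                                ≡⟨ cong (r ℚ.*_) (x+y-x (ι (x j)) (ι (N ℤ.* y j))) ⟨
      r ℚ.* ((ι (x j) ℚ.+ ι (N ℤ.* y j)) ℚ.- ι (x j))    ≡⟨ cong (λ w → r ℚ.* (w ℚ.- ι (x j))) (ι-+ (x j) (N ℤ.* y j)) ⟨
      r ℚ.* (ι (x j ℤ.+ N ℤ.* y j) ℚ.- ι (x j))          ∎))
    where
    open ≡-Reasoning
    r≤1 : r ℚ.≤ 1ℚ
    r≤1 = subst₂ ℚ._≤_ (ℚ.*-identityʳ r) rN (ℚ.*-monoˡ-≤-nonNeg r {{ℚ.nonNegative (ℚ.<⇒≤ r>0)}} (ι-≤ N≥1))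

  module _ (exposed : ∀ z → V z → Exposed (λ j → ι (z j))) where

    -- Otherwise the lattice point x + y would lie inside a segment, so it is not a vertex.
    lonely : ∀ (x y : Funℤ d) (N : ℤ) → + 2 ℤ.≤ N → V x → V (λ j → x j ℤ.+ N ℤ.* y j) → ∀ j → y j ≡ + 0
    lonely x y N N≥2 vx vxN j with y j ℤ.≟ + 0
    ... | yes q = q
    ... | no yj≢0 = ⊥-elim (no-interior-max
        (trans (ℚL.dot-cong c (λ j → ι-+ (x j) (y j))) (ℚL.dot-+ c (λ j → ι (x j)) (λ j → ι (y j))))
        (dot-ι-line c x y N) (ι-< (ℤ.<-≤-trans (ℤ.+<+ (ℕ.s≤s (ℕ.s≤s ℕ.z≤n))) N≥2))
        (proj₂ (exposed m vm) (λ j → ι (x j)) (hull vx) x≢m)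
        (proj₂ (exposed m vm) (λ j → ι (x j ℤ.+ N ℤ.* y j)) (hull vxN) xN≢m))
      where
      open ≡-Reasoning
      m : Funℤ d
      m j = x j ℤ.+ y j
      vm : V m
      vm = between x y N (ℤ.≤-trans (ℤ.+≤+ (ℕ.s≤s ℕ.z≤n)) N≥2) vx vxN
      c : Funℚ d
      c = proj₁ (exposed m vm)
      cancel : ∀ x y → y ≡ (x ℤ.+ y) ℤ.- x
      cancel = solve-∀ ringℤ
      cancel₂ : ∀ x y N → (+ 1 ℤ.- N) ℤ.* y ≡ (x ℤ.+ y) ℤ.- (x ℤ.+ N ℤ.* y)
      cancel₂ = solve-∀ ringℤ
      x≢m : ¬ (∀ j → ι (x j) ≡ ι (m j))
      x≢m q = yj≢0 (trans (cancel (x j) (y j)) (trans (cong (ℤ._- x j) (sym (ι-injective {x j} {m j} (q j)))) (ℤ.+-inverseʳ (x j))))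
      N≢1 : + 1 ℤ.- N ≢ + 0
      N≢1 q = ℤ.<⇒≱ (ℤ.+<+ (ℕ.s≤s (ℕ.s≤s ℕ.z≤n))) (subst (+ 2 ℤ.≤_) (sym (ℤ.i-j≡0⇒i≡j (+ 1) N q)) N≥2)
      xN≢m : ¬ (∀ j → ι (x j ℤ.+ N ℤ.* y j) ≡ ι (m j))
      xN≢m q with ℤ.i*j≡0⇒i≡0∨j≡0 (+ 1 ℤ.- N) {y j} (trans (cancel₂ (x j) (y j) N)
                    (trans (cong (λ w → m j ℤ.- w) (ι-injective {x j ℤ.+ N ℤ.* y j} {m j} (q j))) (ℤ.+-inverseʳ (m j))))
      ... | inj₁ p = N≢1 p
      ... | inj₂ p = yj≢0 p

    module _ {z : Funℤ d} (vz : V z) (B : Basis d)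
      (nbrs : ∀ k → ∃ λ l → 0ℚ ℚ.< l × Hull X (λ j → ι (z j) ℚ.+ l ℚ.* ι (Basis.q B k j)))
      (edges : ∀ a m → IsEdge (λ j → ι (z j)) m a →
               ∃ λ k → ∃ λ l → 0ℚ ℚ.< l × (∀ j → X m j ℚ.- ι (z j) ≡ l ℚ.* ι (Basis.q B k j))) where
      open Basis B
      private
        u : Fin n → Funℚ d
        u i j = X i j ℚ.- ι (z j)
        φℚ : Fin d → Funℚ d
        φℚ k j = ι (φ k j)
        δ≥0 : ∀ {n} (i k : Fin n) → + 0 ℤ.≤ ℤL.δ i k
        δ≥0 zero    zero    = ℤ.+≤+ ℕ.z≤n
        δ≥0 zero    (suc k) = ℤ.≤-refl
        δ≥0 (suc i) zero    = ℤ.≤-refl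
        δ≥0 (suc i) (suc k) = δ≥0 i k
        N : Fin n → Fin d → ℤ
        N i k = ⟨ φ k , (λ j → S i j ℤ.- z j) ⟩
        ιN : ∀ i k → ι (N i k) ≡ ⟪ φℚ k , u i ⟫
        ιN i k = trans (dot-ι-- (φ k) (S i) z) (sym (ℚL.dot-- (φℚ k) (X i) (λ j → ι (z j))))
        -- Every edge at `z` runs along some `q k′`, on which `φ k` is 0 or 1 by duality, so `φ k`
        -- cannot descend along an edge. Together with `edge-exists` this makes all coordinates
        -- `N i k` of the generators nonnegative.
        no-neg-edge : ∀ k → (Σ (Funℚ d) λ a → Σ (Fin n) λ m → ⟪ φℚ k , u m ⟫ ℚ.< 0ℚ × IsEdge (λ j → ι (z j)) m a) → ⊥
        no-neg-edge k (a , m , neg , e) with edges a m e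
        ... | k′ , l , l>0 , um = ℚ.<-irrefl refl (ℚ.<-≤-trans neg (subst (0ℚ ℚ.≤_) (sym φum)
                (0≤* (ℚ.<⇒≤ l>0) (ι-≤ (δ≥0 k k′)))))
          where
          φum : ⟪ φℚ k , u m ⟫ ≡ l ℚ.* ι (ℤL.δ k k′)
          φum = trans (ℚL.dot-cong (φℚ k) um) (trans (ℚL.dot-* (φℚ k) l (λ j → ι (q k′ j)))
            (cong (l ℚ.*_) (trans (sym (dot-ι (φ k) (q k′))) (cong ι (dual k k′)))))

        N≥0 : ∀ i k → + 0 ℤ.≤ N i k
        N≥0 i k = ℤ.≮⇒≥ λ neg → no-neg-edge k (edge-exists (λ i → exposed (S i) (V-gen i)) (λ j → ι (z j)) (hull vz) (exposed z vz)
          (φℚ k) i (subst (ℚ._< 0ℚ) (ιN i k) (ι-< neg)))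

        weights : ∀ k l → (h : Hull X (λ j → ι (z j) ℚ.+ l ℚ.* ι (q k j))) → ∀ j →
          ℚL.sum (λ i → proj₁ h i ℚ.* ι (N i j)) ≡ l ℚ.* ι (ℤL.δ j k)
        weights k l h@(w , w≥0 , w≡1 , e) j = begin
          ℚL.sum (λ i → w i ℚ.* ι (N i j))          ≡⟨ ℚL.sum-cong-≋ (λ i → cong (w i ℚ.*_) (dot-ι-- (φ j) (S i) z)) ⟩
          ℚL.sum (λ i → w i ℚ.* (⟪ φℚ j , X i ⟫ ℚ.- ⟪ φℚ j , zℚ ⟫)) ≡⟨ sum-affine′ w (λ i → ⟪ φℚ j , X i ⟫) ⟪ φℚ j , zℚ ⟫ w≡1 ⟩
          ⟪ w , (λ i → ⟪ φℚ j , X i ⟫) ⟫ ℚ.- ⟪ φℚ j , zℚ ⟫ ≡⟨ cong (ℚ._- ⟪ φℚ j , zℚ ⟫) (hull-dot (φℚ j) h) ⟨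
          ⟪ φℚ j , (λ i → zℚ i ℚ.+ l ℚ.* ι (q k i)) ⟫ ℚ.- ⟪ φℚ j , zℚ ⟫
            ≡⟨ cong (ℚ._- ⟪ φℚ j , zℚ ⟫) (ℚL.dot-+ (φℚ j) zℚ (λ i → l ℚ.* ι (q k i))) ⟩
          (⟪ φℚ j , zℚ ⟫ ℚ.+ ⟪ φℚ j , (λ i → l ℚ.* ι (q k i)) ⟫) ℚ.- ⟪ φℚ j , zℚ ⟫ ≡⟨ x+y-x ⟪ φℚ j , zℚ ⟫ _ ⟩
          ⟪ φℚ j , (λ i → l ℚ.* ι (q k i)) ⟫        ≡⟨ ℚL.dot-* (φℚ j) l (λ i → ι (q k i)) ⟩
          l ℚ.* ⟪ φℚ j , (λ i → ι (q k i)) ⟫        ≡⟨ cong (l ℚ.*_) (trans (sym (dot-ι (φ j) (q k))) (cong ι (dual j k))) ⟩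
          l ℚ.* ι (ℤL.δ j k)                        ∎
          where
          open ≡-Reasoning
          zℚ : Funℚ d
          zℚ j = ι (z j)

        -- Write the rational point `z + l q k` as a convex combination of generators. Its
        -- coordinates other than `k` vanish, hence so do those of each generator of positive
        -- weight; its coordinate `k` is positive, hence so is that of one of them. This generator
        -- is `z + N q k` with an integer `N ≥ 1`, and `between` brings it back to `z + q k`.
        nbr′ : ∀ k → (∃ λ l → 0ℚ ℚ.< l × Hull X (λ j → ι (z j) ℚ.+ l ℚ.* ι (q k j))) → V (λ j → z j ℤ.+ q k j)
        nbr′ k (l , l>0 , h@(w , w≥0 , w≡1 , e)) = conclude (ℚL.sum-≉0 ℚ._≟_ (λ i → w i ℚ.* ι (N i k)) Σ≢0)
          where
          open ≡-Reasoning
          Σ≢0 : ℚL.sum (λ i → w i ℚ.* ι (N i k)) ≢ 0ℚ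
          Σ≢0 q = ℚ.<-irrefl (trans (sym q) (trans (weights k l h k)
            (trans (cong (λ t → l ℚ.* ι t) (ℤL.δ-refl k)) (ℚ.*-identityʳ l)))) l>0
          Σ≡0 : ∀ j → j ≢ k → ∀ i → w i ℚ.* ι (N i j) ≡ 0ℚ
          Σ≡0 j j≢k = ℚN.sum-≈0 (λ i → w i ℚ.* ι (N i j)) (λ i → 0≤* (w≥0 i) (ι-≤ (N≥0 i j)))
            (trans (weights k l h j) (trans (cong (λ t → l ℚ.* ι t) (ℤL.δ-≢ j k j≢k)) (ℚ.*-zeroʳ l)))
          conclude : (∃ λ i → ¬ (w i ℚ.* ι (N i k) ≡ 0ℚ)) → V (λ j → z j ℤ.+ q k j)
          conclude (i , wN≢0) = between z (q k) (N i k) N≥1 vz (V-resp Si≡ (V-gen i))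
            where
            w>0 : 0ℚ ℚ.< w i
            w>0 = ℚ.≰⇒> λ w≤0 → wN≢0 (trans (cong (ℚ._* ι (N i k)) (ℚ.≤-antisym w≤0 (w≥0 i))) (ℚ.*-zeroˡ (ι (N i k))))
            N≥1 : + 1 ℤ.≤ N i k
            N≥1 = ℤ.i<j⇒suc[i]≤j (ℤ.≤∧≢⇒< (N≥0 i k) λ 0≡N → wN≢0 (trans (cong (λ t → w i ℚ.* ι t) (sym 0≡N)) (ℚ.*-zeroʳ (w i))))
            N≡0 : ∀ j → j ≢ k → N i j ≡ + 0
            N≡0 j j≢k = ℤ.≤-antisym (ℤ.≮⇒≥ λ 0<N → ℚ.<-irrefl (sym (Σ≡0 j j≢k i)) (0<* w>0 (ι-< 0<N))) (N≥0 i j)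
            lem : ∀ s z → s ≡ z ℤ.+ (s ℤ.- z)
            lem = solve-∀ ringℤ
            Nδ : ∀ j → N i j ≡ N i k ℤ.* ℤL.δ k j
            Nδ j with j Fin.≟ k
            ... | yes refl = sym (trans (cong (N i k ℤ.*_) (ℤL.δ-refl k)) (ℤ.*-identityʳ (N i k)))
            ... | no j≢k = trans (N≡0 j j≢k) (sym (trans (cong (N i k ℤ.*_) (ℤL.δ-≢ k j (λ e → j≢k (sym e)))) (ℤ.*-zeroʳ (N i k))))
            Si≡ : ∀ j → z j ℤ.+ N i k ℤ.* q k j ≡ S i j
            Si≡ j = sym (begin
              S i j                                                ≡⟨ lem (S i j) (z j) ⟩
              z j ℤ.+ (S i j ℤ.- z j)                              ≡⟨ cong (λ t → z j ℤ.+ t) (expand (λ j → S i j ℤ.- z j) j) ⟩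
              z j ℤ.+ ℤL.sum (λ m → N i m ℤ.* q m j)               ≡⟨ cong (λ t → z j ℤ.+ t) (ℤL.sum-cong-≋ (λ m → trans (cong (ℤ._* q m j) (Nδ m)) (ℤ.*-assoc (N i k) (ℤL.δ k m) (q m j)))) ⟩
              z j ℤ.+ ℤL.sum (λ m → N i k ℤ.* (ℤL.δ k m ℤ.* q m j)) ≡⟨ cong (λ t → z j ℤ.+ t) (ℤL.*-distribˡ-sum (N i k) (λ m → ℤL.δ k m ℤ.* q m j)) ⟨
              z j ℤ.+ N i k ℤ.* ⟨ ℤL.δ k , (λ m → q m j) ⟩          ≡⟨ cong (λ t → z j ℤ.+ N i k ℤ.* t) (ℤL.dot-δ k (λ m → q m j)) ⟩
              z j ℤ.+ N i k ℤ.* q k j                              ∎)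

      frame-of : Frame V z
      frame-of = record { lattice-basis = B ; nbr = λ k → nbr′ k (nbrs k) ; pos = λ k → pos-lattice {z} (φ k) (λ i → N≥0 i k) }

-- Moving a frame along an edge

term≤sum : ∀ {n} (x : Funℤ n) → (∀ i → + 0 ℤ.≤ x i) → ∀ i → x i ℤ.≤ ℤL.sum x
term≤sum x h zero    = subst (ℤ._≤ ℤL.sum x) (ℤ.+-identityʳ (x zero)) (ℤ.+-monoʳ-≤ (x zero) (ℤN.sum-0≤ (λ i → x (suc i)) (λ i → h (suc i))))
term≤sum x h (suc i) = ℤ.≤-trans (term≤sum (λ i → x (suc i)) (λ i → h (suc i)) i)
  (subst (ℤ._≤ ℤL.sum x) (ℤ.+-identityˡ (ℤL.sum (λ i → x (suc i)))) (ℤ.+-monoˡ-≤ (ℤL.sum (λ i → x (suc i))) (h zero)))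

two-terms≤sum : ∀ {n} (x : Funℤ n) → (∀ i → + 0 ℤ.≤ x i) → ∀ i j → i ≢ j → x i ℤ.+ x j ℤ.≤ ℤL.sum x
two-terms≤sum x h zero    zero    i≢j = ⊥-elim (i≢j refl)
two-terms≤sum x h zero    (suc j) i≢j = ℤ.+-monoʳ-≤ (x zero) (term≤sum (λ i → x (suc i)) (λ i → h (suc i)) j)
two-terms≤sum x h (suc i) zero    i≢j = subst (ℤ._≤ ℤL.sum x) (ℤ.+-comm (x zero) (x (suc i)))
  (ℤ.+-monoʳ-≤ (x zero) (term≤sum (λ i → x (suc i)) (λ i → h (suc i)) i))
two-terms≤sum x h (suc i) (suc j) i≢j = ℤ.≤-trans (two-terms≤sum (λ i → x (suc i)) (λ i → h (suc i)) i j (λ e → i≢j (cong suc e)))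
  (subst (ℤ._≤ ℤL.sum x) (ℤ.+-identityˡ (ℤL.sum (λ i → x (suc i)))) (ℤ.+-monoˡ-≤ (ℤL.sum (λ i → x (suc i))) (h zero)))

0≤*ℤ : ∀ {a b} → + 0 ℤ.≤ a → + 0 ℤ.≤ b → + 0 ℤ.≤ a ℤ.* b
0≤*ℤ {a} {b} p q = subst (ℤ._≤ a ℤ.* b) (ℤ.*-zeroʳ a) (ℤ.*-monoˡ-≤-nonNeg a {{ℤ.nonNegative p}} q)

≢0⇒1≤ : ∀ {a} → + 0 ℤ.≤ a → a ≢ + 0 → + 1 ℤ.≤ a
≢0⇒1≤ p ne = ℤ.i<j⇒suc[i]≤j (ℤ.≤∧≢⇒< p (λ e → ne (sym e)))

*≢0ˡ : ∀ {a} b → a ℤ.* b ≢ + 0 → a ≢ + 0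
*≢0ˡ b ne refl = ne refl

*≢0ʳ : ∀ a {b} → a ℤ.* b ≢ + 0 → b ≢ + 0
*≢0ʳ a ne refl = ne (ℤ.*-zeroʳ a)

*≤1⇒≡1 : ∀ {a b} → + 1 ℤ.≤ a → + 1 ℤ.≤ b → a ℤ.* b ℤ.≤ + 1 → b ≡ + 1
*≤1⇒≡1 {a} {b} p q r = ℤ.≤-antisym (ℤ.≤-trans (subst (ℤ._≤ a ℤ.* b) (ℤ.*-identityˡ b)
  (ℤ.*-monoʳ-≤-nonNeg b {{ℤ.nonNegative (ℤ.≤-trans (ℤ.+≤+ ℕ.z≤n) q)}} p)) r) q

*-neg≡1 : ∀ m {n} → + 1 ℤ.≤ n → m ℤ.* ℤ.- n ≡ + 1 → n ≡ + 1 × m ≡ ℤ.- + 1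
*-neg≡1 m {n} p e = n≡1 , trans (lem m) (cong ℤ.-_ (trans (cong (λ k → m ℤ.* ℤ.- k) (sym n≡1)) e))
  where
  lem : ∀ m → m ≡ ℤ.- (m ℤ.* ℤ.- + 1)
  lem = solve-∀ ringℤ
  n≡1 : n ≡ + 1
  n≡1 = trans (sym (ℤ.0≤i⇒+∣i∣≡i (ℤ.≤-trans (ℤ.+≤+ ℕ.z≤n) p))) (cong +_
    (trans (sym (ℤ.∣-i∣≡∣i∣ n)) (ℕ.m*n≡1⇒n≡1 ℤ.∣ m ∣ ℤ.∣ ℤ.- n ∣ (trans (sym (ℤ.abs-* m (ℤ.- n))) (cong ℤ.∣_∣ e)))))

+1≢+0 : + 1 ≢ + 0
+1≢+0 ()

module _ {d} (B : Basis d) where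
  open Basis B

  dot-expand : ∀ a y → ⟨ a , y ⟩ ≡ ℤL.sum (λ k → ⟨ φ k , y ⟩ ℤ.* ⟨ a , q k ⟩)
  dot-expand a y = trans (ℤL.dot-cong a (expand y)) (ℤL.dot-sum a (λ k → ⟨ φ k , y ⟩) q)

  coords-injective : ∀ {x y} → (∀ k → ⟨ φ k , x ⟩ ≡ ⟨ φ k , y ⟩) → ∀ j → x j ≡ y j
  coords-injective {x} {y} h j = trans (expand x j)
    (trans (ℤL.sum-cong-≋ (λ k → cong (ℤ._* q k j) (h k))) (sym (expand y j)))

  φq-refl : ∀ k → ⟨ φ k , q k ⟩ ≡ + 1
  φq-refl k = trans (dual k k) (ℤL.δ-refl k)

  φq-≢ : ∀ {k j} → k ≢ j → ⟨ φ k , q j ⟩ ≡ + 0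
  φq-≢ {k} {j} ne = trans (dual k j) (ℤL.δ-≢ k j ne)

-- In `Core` and `Directions` the polytope enters only through its set `V` of lattice points:
-- `lonely` stands for the hypothesis on lattice points, `frame` for smoothness.
module Core {d} (V : Funℤ d → Set) (V-resp : ∀ {z z′} → (∀ j → z′ j ≡ z j) → V z → V z′)
  (lonely : ∀ (x y : Funℤ d) (N : ℤ) → + 2 ℤ.≤ N → V x → V (λ j → x j ℤ.+ N ℤ.* y j) → ∀ j → y j ≡ + 0)
  (frame : ∀ v → V v → Frame V v) where

  infixl 6 _⊞_
  _⊞_ _⊟_ : Funℤ d → Funℤ d → Funℤ d
  (x ⊞ y) j = x j ℤ.+ y j
  (x ⊟ y) j = x j ℤ.- y j

  dot-⊞ : ∀ a x y → ⟨ a , x ⊞ y ⟩ ≡ ⟨ a , x ⟩ ℤ.+ ⟨ a , y ⟩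
  dot-⊞ = ℤL.dot-+

  dot-⊟ : ∀ a x y → ⟨ a , x ⊟ y ⟩ ≡ ⟨ a , x ⟩ ℤ.- ⟨ a , y ⟩
  dot-⊟ = ℤL.dot--

  -- The frame at the end w of an edge v, v + q i.  The direction back to v is a
  -- direction q′ k₀ of the new frame; any other old direction q j is turned into q j or
  -- q j - q i, according to whether v + q i + q j is a lattice point.
  module Pivot (v : Funℤ d) (F : Frame V v) (i : Fin d) where
    open Frame F
    w : Funℤ d
    w = v ⊞ q i
    F′ : Frame V w
    F′ = frame w (nbr i)
    open Frame F′ using () renaming (q to q′; φ to φ′; nbr to nbr′; pos to pos′; lattice-basis to B′)
    B : Basis d
    B = lattice-basis

    private
      shift : ∀ v a b → ((v ℤ.+ a) ℤ.+ b) ℤ.- v ≡ a ℤ.+ b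
      shift = solve-∀ ringℤ
      back : ∀ v a → v ℤ.- (v ℤ.+ a) ≡ ℤ.- a
      back = solve-∀ ringℤ
      across : ∀ v a b → (v ℤ.+ b) ℤ.- (v ℤ.+ a) ≡ b ℤ.- a
      across = solve-∀ ringℤ
      1-0 : ∀ {x y} → x ≡ + 1 → y ≡ + 0 → x ℤ.- y ≡ + 1
      1-0 refl refl = refl

    φq′ : ∀ l k → + 0 ℤ.≤ ⟨ φ l , q i ⟩ ℤ.+ ⟨ φ l , q′ k ⟩
    φq′ l k = subst (+ 0 ℤ.≤_) (trans (ℤL.dot-cong (φ l) (λ j → shift (v j) (q i j) (q′ k j))) (dot-⊞ (φ l) (q i) (q′ k)))
      (pos l (nbr′ k))

    φq′≥0 : ∀ {l} → l ≢ i → ∀ k → + 0 ℤ.≤ ⟨ φ l , q′ k ⟩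
    φq′≥0 {l} l≢i k = subst (+ 0 ℤ.≤_) (trans (cong (ℤ._+ ⟨ φ l , q′ k ⟩) (φq-≢ B l≢i)) (ℤ.+-identityˡ ⟨ φ l , q′ k ⟩)) (φq′ l k)

    -- For `l ≢ i` the step `q i` does not change the coordinate `l`, so `φ l` is nonnegative on all
    -- new directions. If it vanishes on a vector of the new cone, it vanishes on every direction
    -- occurring in that vector.
    face : ∀ {l} → l ≢ i → ∀ y → (∀ k → + 0 ℤ.≤ ⟨ φ′ k , y ⟩) → ⟨ φ l , y ⟩ ≡ + 0 →
           ∀ k → ⟨ φ′ k , y ⟩ ≢ + 0 → ⟨ φ l , q′ k ⟩ ≡ + 0
    face {l} l≢i y y≥0 e k ne with ℤ.i*j≡0⇒i≡0∨j≡0 ⟨ φ′ k , y ⟩ {⟨ φ l , q′ k ⟩}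
      (ℤN.sum-≈0 (λ k → ⟨ φ′ k , y ⟩ ℤ.* ⟨ φ l , q′ k ⟩) (λ k → 0≤*ℤ (y≥0 k) (φq′≥0 l≢i k)) (trans (sym (dot-expand B′ (φ l) y)) e) k)
    ... | inj₁ p = ⊥-elim (ne p)
    ... | inj₂ p = p

    occurs : ∀ a y → ⟨ a , y ⟩ ≢ + 0 → ∃ λ k → ⟨ φ′ k , y ⟩ ℤ.* ⟨ a , q′ k ⟩ ≢ + 0
    occurs a y ne = ℤL.sum-≉0 ℤ._≟_ (λ k → ⟨ φ′ k , y ⟩ ℤ.* ⟨ a , q′ k ⟩) (λ e → ne (trans (dot-expand B′ a y) e))

    module _ (vv : V v) where
      -qi : Funℤ d
      -qi j = ℤ.- q i j
      -qi≥0 : ∀ k → + 0 ℤ.≤ ⟨ φ′ k , -qi ⟩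
      -qi≥0 k = subst (+ 0 ℤ.≤_) (ℤL.dot-cong (φ′ k) (λ j → back (v j) (q i j))) (pos′ k vv)

      abstract
        -- Seen from `w`, the point `v` is `- q i`, a vector of the new cone. By `face` a direction
        -- occurring in it is a multiple `m q i`; pairing with its dual functional gives
        -- `m (- n) = 1` with an integer `n ≥ 1`, which leaves only `m = -1`.
        reverse : ∃ λ k₀ → (∀ j → q′ k₀ j ≡ ℤ.- q i j) × ⟨ φ′ k₀ , q i ⟩ ≡ ℤ.- + 1
        reverse with occurs (φ i) -qi φi≢0
          where
          φi≢0 : ⟨ φ i , -qi ⟩ ≢ + 0
          φi≢0 e with trans (sym e) (trans (ℤL.dot-neg (φ i) (q i)) (cong ℤ.-_ (φq-refl B i)))
          ... | ()
        ... | k₀ , ne = k₀ , q′k₀ , ψqi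
          where
          n≢0 : ⟨ φ′ k₀ , -qi ⟩ ≢ + 0
          n≢0 = *≢0ˡ ⟨ φ i , q′ k₀ ⟩ ne
          m : ℤ
          m = ⟨ φ i , q′ k₀ ⟩
          coords : ∀ l → ⟨ φ l , q′ k₀ ⟩ ≡ ⟨ φ l , (λ j → m ℤ.* q i j) ⟩
          coords l with l Fin.≟ i
          ... | yes refl = sym (trans (ℤL.dot-* (φ l) m (q l)) (trans (cong (m ℤ.*_) (φq-refl B l)) (ℤ.*-identityʳ m)))
          ... | no l≢i = trans (face l≢i -qi -qi≥0 (trans (ℤL.dot-neg (φ l) (q i)) (cong ℤ.-_ (φq-≢ B l≢i))) k₀ n≢0)
            (sym (trans (ℤL.dot-* (φ l) m (q i)) (trans (cong (m ℤ.*_) (φq-≢ B l≢i)) (ℤ.*-zeroʳ m))))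
          q′≡ : ∀ j → q′ k₀ j ≡ m ℤ.* q i j
          q′≡ = coords-injective B coords
          φ′-neg : ∀ x → ⟨ φ′ k₀ , x ⟩ ≡ ℤ.- ⟨ φ′ k₀ , (λ j → ℤ.- x j) ⟩
          φ′-neg x = trans (sym (ℤ.neg-involutive ⟨ φ′ k₀ , x ⟩)) (cong ℤ.-_ (sym (ℤL.dot-neg (φ′ k₀) x)))
          nm : ⟨ φ′ k₀ , -qi ⟩ ≡ + 1 × m ≡ ℤ.- + 1
          nm = *-neg≡1 m (≢0⇒1≤ (-qi≥0 k₀) n≢0) (trans (cong (m ℤ.*_) (sym (φ′-neg (q i))))
            (trans (sym (ℤL.dot-* (φ′ k₀) m (q i))) (trans (ℤL.dot-cong (φ′ k₀) (λ j → sym (q′≡ j))) (φq-refl B′ k₀))))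
          ψqi : ⟨ φ′ k₀ , q i ⟩ ≡ ℤ.- + 1
          ψqi = trans (φ′-neg (q i)) (cong ℤ.-_ (proj₁ nm))
          q′k₀ : ∀ j → q′ k₀ j ≡ ℤ.- q i j
          q′k₀ j = trans (q′≡ j) (trans (cong (ℤ._* q i j) (proj₂ nm)) (ℤ.-1*i≡-i (q i j)))

      k₀ : Fin d
      k₀ = proj₁ reverse
      q′k₀ : ∀ j → q′ k₀ j ≡ ℤ.- q i j
      q′k₀ = proj₁ (proj₂ reverse)
      ψ : Funℤ d
      ψ = φ′ k₀
      ψqi : ⟨ ψ , q i ⟩ ≡ ℤ.- + 1
      ψqi = proj₂ (proj₂ reverse)

      -- `ψ` is nonnegative when measured from `w`, and from `v` to `w` it changes by -1. As `ψ`
      -- turns out to be -1 on `q i` and on the turned directions and 0 on the kept ones, this is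
      -- the inequality `x_i + Σ x_j ≤ 1`.
      ψ-bound : ∀ {x} → V x → ℤ.- + 1 ℤ.≤ ⟨ ψ , x ⊟ v ⟩
      ψ-bound {x} vx = ℤ.0≤i-j⇒j≤i (subst (+ 0 ℤ.≤_) e (pos′ k₀ vx))
        where
        lem : ∀ x v a → x ℤ.- (v ℤ.+ a) ≡ (x ℤ.- v) ℤ.- a
        lem = solve-∀ ringℤ
        e : ⟨ ψ , x ⊟ w ⟩ ≡ ⟨ ψ , x ⊟ v ⟩ ℤ.- (ℤ.- + 1)
        e = trans (ℤL.dot-cong ψ (λ j → lem (x j) (v j) (q i j))) (trans (dot-⊟ ψ (x ⊟ v) (q i)) (cong (λ t → ⟨ ψ , x ⊟ v ⟩ ℤ.- t) ψqi))

      Kept Turned : Fin d → Set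
      Kept j = V (v ⊞ q i ⊞ q j) × ⟨ ψ , q j ⟩ ≡ + 0 × ∃ λ k → k ≢ k₀ × (∀ l → q′ k l ≡ q j l)
      Turned j = ⟨ ψ , q j ⟩ ≡ ℤ.- + 1

      module _ {j} (j≢i : j ≢ i) where
        private
          y : Funℤ d
          y = q j ⊟ q i
          y≥0 : ∀ k → + 0 ℤ.≤ ⟨ φ′ k , y ⟩
          y≥0 k = subst (+ 0 ℤ.≤_) (ℤL.dot-cong (φ′ k) (λ l → across (v l) (q i l) (q j l))) (pos′ k (nbr j))
          φjy : ⟨ φ j , y ⟩ ≡ + 1
          φjy = trans (dot-⊟ (φ j) (q j) (q i)) (1-0 (φq-refl B j) (φq-≢ B j≢i))
          φly : ∀ {l} → l ≢ i → l ≢ j → ⟨ φ l , y ⟩ ≡ + 0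
          φly {l} l≢i l≢j = trans (dot-⊟ (φ l) (q j) (q i)) (cong₂ ℤ._-_ (φq-≢ B l≢j) (φq-≢ B l≢i))
          1≢0 : ⟨ φ j , y ⟩ ≢ + 0
          1≢0 e = +1≢+0 (trans (sym φjy) e)

        abstract
          -- The vector `y` leads from `w` to `v + q j`, so it lies in the new cone, and `φ j y = 1`
          -- is a sum of nonnegative integers. A nonzero summand therefore has both factors 1. With
          -- `face` for the remaining coordinates, the new direction is `q j + m q i` with `m ≥ -1`;
          -- `m = -1` and `m = 0` are the two cases.
          turn′ : (∃ λ k → ⟨ φ′ k , y ⟩ ℤ.* ⟨ φ j , q′ k ⟩ ≢ + 0) → Kept j ⊎ Turned j
          turn′ (k , ne) = conclude (m+1 ℤ.≟ + 0) (m+1 ℤ.≟ + 1)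
            where
            n≢0 : ⟨ φ′ k , y ⟩ ≢ + 0
            n≢0 = *≢0ˡ ⟨ φ j , q′ k ⟩ ne
            b≡1 : ⟨ φ j , q′ k ⟩ ≡ + 1
            b≡1 = *≤1⇒≡1 {⟨ φ′ k , y ⟩} (≢0⇒1≤ (y≥0 k) n≢0) (≢0⇒1≤ (φq′≥0 j≢i k) (*≢0ʳ ⟨ φ′ k , y ⟩ ne))
              (subst (⟨ φ′ k , y ⟩ ℤ.* ⟨ φ j , q′ k ⟩ ℤ.≤_) (trans (sym (dot-expand B′ (φ j) y)) φjy)
                (term≤sum (λ k → ⟨ φ′ k , y ⟩ ℤ.* ⟨ φ j , q′ k ⟩) (λ k → 0≤*ℤ (y≥0 k) (φq′≥0 j≢i k)) k))
            m m+1 : ℤ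
            m = ⟨ φ i , q′ k ⟩
            m+1 = + 1 ℤ.+ m
            miq : Funℤ d
            miq l = m ℤ.* q i l
            dot-rhs : ∀ a → ⟨ a , q j ⊞ miq ⟩ ≡ ⟨ a , q j ⟩ ℤ.+ m ℤ.* ⟨ a , q i ⟩
            dot-rhs a = trans (dot-⊞ a (q j) miq) (cong (λ t → ⟨ a , q j ⟩ ℤ.+ t) (ℤL.dot-* a m (q i)))
            arith : ∀ {x y a b} → x ≡ a → y ≡ b → x ℤ.+ m ℤ.* y ≡ a ℤ.+ m ℤ.* b
            arith refl refl = refl
            0+m1 : ∀ m → + 0 ℤ.+ m ℤ.* + 1 ≡ m
            0+m1 = solve-∀ ringℤ
            1+m0 : ∀ m → + 1 ℤ.+ m ℤ.* + 0 ≡ + 1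
            1+m0 = solve-∀ ringℤ
            0+m0 : ∀ m → + 0 ℤ.+ m ℤ.* + 0 ≡ + 0
            0+m0 = solve-∀ ringℤ
            coords : ∀ l → ⟨ φ l , q′ k ⟩ ≡ ⟨ φ l , q j ⊞ miq ⟩
            coords l with l Fin.≟ i | l Fin.≟ j
            ... | yes refl | _ = sym (trans (dot-rhs (φ l)) (trans (arith (φq-≢ B (λ e → j≢i (sym e))) (φq-refl B l)) (0+m1 m)))
            ... | no l≢i | yes refl = trans b≡1 (sym (trans (dot-rhs (φ l)) (trans (arith (φq-refl B l) (φq-≢ B l≢i)) (1+m0 m))))
            ... | no l≢i | no l≢j = trans (face l≢i y y≥0 (φly l≢i l≢j) k n≢0)
              (sym (trans (dot-rhs (φ l)) (trans (arith (φq-≢ B l≢j) (φq-≢ B l≢i)) (0+m0 m))))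
            q′≡ : ∀ l → q′ k l ≡ (q j ⊞ miq) l
            q′≡ = coords-injective B coords
            k≢k₀ : k ≢ k₀
            k≢k₀ e = +1≢+0 (begin
              + 1                          ≡⟨ b≡1 ⟨
              ⟨ φ j , q′ k ⟩               ≡⟨ cong (λ k → ⟨ φ j , q′ k ⟩) e ⟩
              ⟨ φ j , q′ k₀ ⟩              ≡⟨ ℤL.dot-cong (φ j) q′k₀ ⟩
              ⟨ φ j , -qi ⟩                ≡⟨ ℤL.dot-neg (φ j) (q i) ⟩
              ℤ.- ⟨ φ j , q i ⟩            ≡⟨ cong ℤ.-_ (φq-≢ B j≢i) ⟩
              + 0                          ∎)
              where open ≡-Reasoning
            -- Apply `ψ` to `q′ k = q j + m q i`: the left side gives 0, as `k ≢ k₀`, and `ψ` is -1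
            -- on `q i`.
            ψqj : ⟨ ψ , q j ⟩ ≡ m
            ψqj = begin
              ⟨ ψ , q j ⟩                               ≡⟨ lem ⟨ ψ , q j ⟩ m ⟩
              (⟨ ψ , q j ⟩ ℤ.+ m ℤ.* ℤ.- + 1) ℤ.+ m     ≡⟨ cong (λ t → (⟨ ψ , q j ⟩ ℤ.+ m ℤ.* t) ℤ.+ m) ψqi ⟨
              (⟨ ψ , q j ⟩ ℤ.+ m ℤ.* ⟨ ψ , q i ⟩) ℤ.+ m ≡⟨ cong (λ t → t ℤ.+ m) (dot-rhs ψ) ⟨
              ⟨ ψ , q j ⊞ miq ⟩ ℤ.+ m                   ≡⟨ cong (λ t → t ℤ.+ m) (ℤL.dot-cong ψ q′≡) ⟨
              ⟨ ψ , q′ k ⟩ ℤ.+ m                        ≡⟨ cong (λ t → t ℤ.+ m) (φq-≢ B′ (λ e → k≢k₀ (sym e))) ⟩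
              + 0 ℤ.+ m                                 ≡⟨ ℤ.+-identityˡ m ⟩
              m                                         ∎
              where
              open ≡-Reasoning
              lem : ∀ x m → x ≡ (x ℤ.+ m ℤ.* ℤ.- + 1) ℤ.+ m
              lem = solve-∀ ringℤ
            m+1≥0 : + 0 ℤ.≤ m+1
            m+1≥0 = subst (λ t → + 0 ℤ.≤ t ℤ.+ m) (φq-refl B i) (φq′ i k)
            on-line : ∀ v a b m → (v ℤ.+ b) ℤ.+ (+ 1 ℤ.+ m) ℤ.* a ≡ (v ℤ.+ a) ℤ.+ (b ℤ.+ m ℤ.* a)
            on-line = solve-∀ ringℤ
            -- Seen from `v + q j`, the new neighbour is `m + 1` steps away along `q i`; two or more
            -- steps contradict `lonely`.
            V-line : V (λ l → (v ⊞ q j) l ℤ.+ m+1 ℤ.* q i l)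
            V-line = V-resp (λ l → trans (on-line (v l) (q i l) (q j l) m) (cong (λ t → w l ℤ.+ t) (sym (q′≡ l)))) (nbr′ k)
            qi≢0 : ¬ (∀ l → q i l ≡ + 0)
            qi≢0 e = +1≢+0 (trans (sym (φq-refl B i))
              (ℤL.sum-zero (λ l → φ i l ℤ.* q i l) (λ l → trans (cong (φ i l ℤ.*_) (e l)) (ℤ.*-zeroʳ (φ i l)))))
            m≡ : ∀ {c} → m+1 ≡ c → m ≡ c ℤ.- + 1
            m≡ e = trans (lem m) (cong (ℤ._- + 1) e)
              where
              lem : ∀ m → m ≡ (+ 1 ℤ.+ m) ℤ.- + 1
              lem = solve-∀ ringℤ
            conclude : Dec (m+1 ≡ + 0) → Dec (m+1 ≡ + 1) → Kept j ⊎ Turned j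
            conclude (yes e) _ = inj₂ (trans ψqj (m≡ e))
            conclude (no _) (yes e) = inj₁ (V-resp (λ l → cong (λ t → w l ℤ.+ t) (sym (q′≡j l))) (nbr′ k)
                                            , trans ψqj (m≡ e) , k , k≢k₀ , q′≡j)
              where
              lem : ∀ a b → b ℤ.+ + 0 ℤ.* a ≡ b
              lem = solve-∀ ringℤ
              q′≡j : ∀ l → q′ k l ≡ q j l
              q′≡j l = trans (q′≡ l) (trans (cong (λ t → q j l ℤ.+ t ℤ.* q i l) (m≡ e)) (lem (q i l) (q j l)))
            conclude (no ne₀) (no ne₁) = ⊥-elim (qi≢0 (lonely (v ⊞ q j) (q i) m+1
              (ℤ.i<j⇒suc[i]≤j (ℤ.≤∧≢⇒< (≢0⇒1≤ m+1≥0 ne₀) (λ e → ne₁ (sym e)))) (nbr j) V-line))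

        turn : Kept j ⊎ Turned j
        turn = turn′ (occurs (φ j) y 1≢0)

-- Compatible and conflicting directions at a lattice point.

private
  two-steps : ∀ v a b → ((v ℤ.+ a) ℤ.+ b) ℤ.- v ≡ a ℤ.+ b
  two-steps = solve-∀ ringℤ
  two-steps-back : ∀ v a b c → ((v ℤ.+ b) ℤ.+ c) ℤ.- (v ℤ.+ a) ≡ (b ℤ.+ c) ℤ.+ ℤ.- a
  two-steps-back = solve-∀ ringℤ
  swap-steps : ∀ v a b → (v ℤ.+ b) ℤ.+ a ≡ (v ℤ.+ a) ℤ.+ b
  swap-steps = solve-∀ ringℤ
  x*1 : ∀ x {y} → y ≡ ℤ.- + 1 → x ℤ.* ℤ.- y ≡ x
  x*1 x refl = ℤ.*-identityʳ x
  1+0+0 : ∀ {x y z} → x ≡ + 1 → y ≡ + 0 → z ≡ + 0 → (x ℤ.+ y) ℤ.+ z ≡ + 1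
  1+0+0 refl refl refl = refl
  0+1+0 : ∀ {x y z} → x ≡ + 0 → y ≡ + 1 → z ≡ + 0 → (x ℤ.+ y) ℤ.+ z ≡ + 1
  0+1+0 refl refl refl = refl
  2≰1 : ∀ {x y} → x ≡ + 1 → y ≡ + 1 → ¬ (x ℤ.+ y ℤ.≤ + 1)
  2≰1 refl refl (ℤ.+≤+ (ℕ.s≤s ()))
  -1≰-2 : ∀ {x y} → x ≡ ℤ.- + 1 → y ≡ ℤ.- + 1 → ¬ (ℤ.- + 1 ℤ.≤ x ℤ.+ y)
  -1≰-2 refl refl (ℤ.-≤- ())
  0≤neg : ∀ {x} → x ≡ ℤ.- + 1 ⊎ x ≡ + 0 → + 0 ℤ.≤ ℤ.- x
  0≤neg (inj₁ refl) = ℤ.+≤+ ℕ.z≤n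
  0≤neg (inj₂ refl) = ℤ.+≤+ ℕ.z≤n

module Directions {d} (V : Funℤ d → Set) (V-resp : ∀ {z z′} → (∀ j → z′ j ≡ z j) → V z → V z′)
  (lonely : ∀ (x y : Funℤ d) (N : ℤ) → + 2 ℤ.≤ N → V x → V (λ j → x j ℤ.+ N ℤ.* y j) → ∀ j → y j ≡ + 0)
  (frame : ∀ v → V v → Frame V v) where

  open Core V V-resp lonely frame

  dot-steps : ∀ (a v x y : Funℤ d) → ⟨ a , (v ⊞ x ⊞ y) ⊟ v ⟩ ≡ ⟨ a , x ⟩ ℤ.+ ⟨ a , y ⟩
  dot-steps a v x y = trans (ℤL.dot-cong a (λ j → two-steps (v j) (x j) (y j))) (dot-⊞ a x y)

  module At (v : Funℤ d) (vv : V v) where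
    F : Frame V v
    F = frame v vv
    open Frame F public
    module P (i : Fin d) = Pivot v F i

    Compat : Fin d → Fin d → Set
    Compat a b = V (v ⊞ q a ⊞ q b)

    Turned : Fin d → Fin d → Set
    Turned i j = P.Turned i vv j

    ψ : Fin d → Funℤ d
    ψ i = P.ψ i vv

    compat-sym : ∀ {a b} → Compat a b → Compat b a
    compat-sym {a} {b} = V-resp (λ j → swap-steps (v j) (q a j) (q b j))

    -- `ψ i` is -1 on `q i` and on each turned direction. On a sum of two of these it is -2, which
    -- `ψ-bound` forbids at a lattice point; `turned-turned` rests on the same count.
    turned⇒¬compat : ∀ {i j} → Turned i j → ¬ Compat i j
    turned⇒¬compat {i} {j} t c = -1≰-2 (P.ψqi i vv) t
      (subst (ℤ.- + 1 ℤ.≤_) (dot-steps (ψ i) v (q i) (q j)) (P.ψ-bound i vv c))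

    turned-turned : ∀ {i j k} → Turned i j → Turned i k → ¬ Compat j k
    turned-turned {i} {j} {k} t t′ c = -1≰-2 t t′
      (subst (ℤ.- + 1 ℤ.≤_) (dot-steps (ψ i) v (q j) (q k)) (P.ψ-bound i vv c))

    compat? : ∀ {i j} → j ≢ i → Dec (Compat i j)
    compat? {i} j≢i with P.turn i vv j≢i
    ... | inj₁ (c , _) = yes c
    ... | inj₂ t = no (turned⇒¬compat t)

    ¬compat⇒turned : ∀ {i j} → j ≢ i → ¬ Compat i j → Turned i j
    ¬compat⇒turned {i} j≢i nc with P.turn i vv j≢i
    ... | inj₁ (c , _) = ⊥-elim (nc c)
    ... | inj₂ t = t

    -- Move along the middle direction `b`: both `a` and `c` are turned there, and two directions
    -- turned at the same place conflict.
    ¬compat-trans : ∀ {a b c} → a ≢ b → c ≢ b → ¬ Compat a b → ¬ Compat b c → ¬ Compat a c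
    ¬compat-trans a≢b c≢b nab nbc =
      turned-turned (¬compat⇒turned a≢b (λ c → nab (compat-sym c))) (¬compat⇒turned c≢b nbc)

    coord : Fin d → Funℤ d → ℤ
    coord k x = ⟨ φ k , x ⊟ v ⟩

    module _ (i : Fin d) {x : Funℤ d} (vx : V x) where
      private
        -- The terms of `- ψ i` at `x - v` in the basis at `v`. None is negative and their sum is at
        -- most 1, so the same bound holds for one term or for two.
        summand : Fin d → ℤ
        summand k = coord k x ℤ.* ℤ.- ⟨ ψ i , q k ⟩
        ψq : ∀ k → ⟨ ψ i , q k ⟩ ≡ ℤ.- + 1 ⊎ ⟨ ψ i , q k ⟩ ≡ + 0
        ψq k with k Fin.≟ i
        ... | yes refl = inj₁ (P.ψqi i vv)
        ... | no k≢i with P.turn i vv k≢i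
        ...   | inj₁ (_ , e , _) = inj₂ e
        ...   | inj₂ t = inj₁ t
        summand≥0 : ∀ k → + 0 ℤ.≤ summand k
        summand≥0 k = 0≤*ℤ (pos k vx) (0≤neg (ψq k))
        sum≤1 : ℤL.sum summand ℤ.≤ + 1
        sum≤1 = subst (ℤ._≤ + 1) (sym e) (ℤ.neg-mono-≤ (P.ψ-bound i vv vx))
          where
          e : ℤL.sum summand ≡ ℤ.- ⟨ ψ i , x ⊟ v ⟩
          e = trans (ℤL.dot-neg (λ k → coord k x) (λ k → ⟨ ψ i , q k ⟩)) (cong ℤ.-_ (sym (dot-expand lattice-basis (ψ i) (x ⊟ v))))

      coord≤1 : coord i x ℤ.≤ + 1
      coord≤1 = ℤ.≤-trans (subst (ℤ._≤ ℤL.sum summand) (x*1 (coord i x) (P.ψqi i vv)) (term≤sum summand summand≥0 i)) sum≤1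

      ¬compat⇒coords≤1 : ∀ {j} → j ≢ i → ¬ Compat i j → coord i x ℤ.+ coord j x ℤ.≤ + 1
      ¬compat⇒coords≤1 {j} j≢i nc = ℤ.≤-trans
        (subst (ℤ._≤ ℤL.sum summand)
          (cong₂ ℤ._+_ (x*1 (coord i x) (P.ψqi i vv)) (x*1 (coord j x) (¬compat⇒turned j≢i nc)))
          (two-terms≤sum summand summand≥0 i j (λ e → j≢i (sym e)))) sum≤1

  module _ (v : Funℤ d) (vv : V v) where
    open At v vv

    kept : ∀ {s t} → t ≢ s → Compat s t →
           ∃ λ k → k ≢ P.k₀ s vv × (∀ l → At.q (v ⊞ q s) (nbr s) k l ≡ q t l)
    kept {s} t≢s c with P.turn s vv t≢s
    ... | inj₁ (_ , _ , r) = r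
    ... | inj₂ t = ⊥-elim (turned⇒¬compat t c)

    -- If t and r were in conflict at v + q s, then the point v + q t + q r, which is
    -- q t + q r - q s seen from there, would violate the bound for that conflict.
    triple : ∀ {s t r} → t ≢ s → r ≢ s → r ≢ t → Compat s t → Compat s r → Compat t r →
             V (v ⊞ q s ⊞ q t ⊞ q r)
    triple {s} {t} {r} t≢s r≢s r≢t cst csr ctr with kept t≢s cst | kept r≢s csr
    ... | kt , kt≢k₀ , et | kr , kr≢k₀ , er = conclude (W.compat? kr≢kt)
      where
      w : Funℤ d
      w = v ⊞ q s
      module W = At w (nbr s)
      k₀ = P.k₀ s vv
      kr≢kt : kr ≢ kt
      kr≢kt e = +1≢+0 (trans (sym (φq-refl lattice-basis t)) (trans (ℤL.dot-cong (φ t) q≡)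
                  (φq-≢ lattice-basis (λ e → r≢t (sym e)))))
        where
        q≡ : ∀ l → q t l ≡ q r l
        q≡ l = trans (sym (et l)) (trans (cong (λ k → W.q k l) (sym e)) (er l))
      x : Funℤ d
      x = v ⊞ q t ⊞ q r
      -- `- q s` is the basis direction `k₀` at `w`, distinct from `kt` and `kr`, so the coordinates
      -- `kt` and `kr` of `x` are both 1.
      coord-w : ∀ k → W.coord k x ≡ (⟨ W.φ k , W.q kt ⟩ ℤ.+ ⟨ W.φ k , W.q kr ⟩) ℤ.+ ⟨ W.φ k , W.q k₀ ⟩
      coord-w k = trans (ℤL.dot-cong (W.φ k) x≡) (trans (dot-⊞ (W.φ k) (W.q kt ⊞ W.q kr) (W.q k₀))
        (cong (λ c → c ℤ.+ ⟨ W.φ k , W.q k₀ ⟩) (dot-⊞ (W.φ k) (W.q kt) (W.q kr))))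
        where
        x≡ : ∀ l → (x ⊟ w) l ≡ (W.q kt ⊞ W.q kr ⊞ W.q k₀) l
        x≡ l = trans (two-steps-back (v l) (q s l) (q t l) (q r l))
          (sym (cong₂ ℤ._+_ (cong₂ ℤ._+_ (et l) (er l)) (P.q′k₀ s vv l)))
      conclude : Dec (W.Compat kt kr) → V (v ⊞ q s ⊞ q t ⊞ q r)
      conclude (yes c) = V-resp (λ l → cong₂ (λ a b → (w l ℤ.+ a) ℤ.+ b) (sym (et l)) (sym (er l))) c
      conclude (no nc) = ⊥-elim (2≰1
        (trans (coord-w kt) (1+0+0 (φq-refl W.lattice-basis kt) (φq-≢ W.lattice-basis (λ e → kr≢kt (sym e))) (φq-≢ W.lattice-basis kt≢k₀)))
        (trans (coord-w kr) (0+1+0 (φq-≢ W.lattice-basis kr≢kt) (φq-refl W.lattice-basis kr) (φq-≢ W.lattice-basis kr≢k₀)))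
        (W.¬compat⇒coords≤1 kt ctr kr≢kt nc))

  -- Induction on the number of directions: after the step along the first one, `kept` makes the
  -- others directions of the new frame and `triple` keeps them pairwise compatible. The directions
  -- are given as vectors, because their indices change from frame to frame.
  many : ∀ {m} (v : Funℤ d) (vv : V v) (Y : Fin m → Funℤ d) → (∀ a → ∃ λ k → ∀ l → At.q v vv k l ≡ Y a l) →
    (∀ a b → a ≢ b → ¬ (∀ l → Y a l ≡ Y b l)) → (∀ a b → a ≢ b → V (v ⊞ Y a ⊞ Y b)) →
    V (λ l → v l ℤ.+ ℤL.sum (λ a → Y a l))
  many {ℕ.zero} v vv Y dir distinct compat = V-resp (λ l → ℤ.+-identityʳ (v l)) vv
  many {ℕ.suc m} v vv Y dir distinct compat =
    V-resp (λ l → trans (sym (ℤ.+-assoc (v l) (Y zero l) (ℤL.sum (λ a → Y (suc a) l))))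
                        (cong (λ t → (v l ℤ.+ t) ℤ.+ ℤL.sum (λ a → Y (suc a) l)) (sym (es l))))
      (many w (nbr s) (λ a → Y (suc a)) dir′ (λ a b a≢b → distinct (suc a) (suc b) (λ { refl → a≢b refl })) compat′)
    where
    open At v vv
    s : Fin d
    s = proj₁ (dir zero)
    es : ∀ l → q s l ≡ Y zero l
    es = proj₂ (dir zero)
    w : Funℤ d
    w = v ⊞ q s
    t : Fin m → Fin d
    t a = proj₁ (dir (suc a))
    et : ∀ a l → q (t a) l ≡ Y (suc a) l
    et a = proj₂ (dir (suc a))
    t≢s : ∀ a → t a ≢ s
    t≢s a e = distinct (suc a) zero (λ ()) (λ l → trans (sym (et a l)) (trans (cong (λ k → q k l) e) (es l)))
    cs : ∀ a → Compat s (t a)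
    cs a = V-resp (λ l → cong₂ (λ x y → (v l ℤ.+ x) ℤ.+ y) (es l) (et a l)) (compat zero (suc a) (λ ()))
    dir′ : ∀ a → ∃ λ k → ∀ l → At.q w (nbr s) k l ≡ Y (suc a) l
    dir′ a = proj₁ keep , λ l → trans (proj₂ (proj₂ keep) l) (et a l)
      where
      keep : ∃ λ k → k ≢ P.k₀ s vv × (∀ l → At.q (v ⊞ q s) (nbr s) k l ≡ q (t a) l)
      keep = kept v vv {s} {t a} (t≢s a) (cs a)
    compat′ : ∀ a b → a ≢ b → V (w ⊞ Y (suc a) ⊞ Y (suc b))
    compat′ a b a≢b = V-resp (λ l → cong₂ (λ x y → (w l ℤ.+ x) ℤ.+ y) (sym (et a l)) (sym (et b l)))
      (triple v vv {s} {t a} {t b} (t≢s a) (t≢s b) tb≢ta (cs a) (cs b)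
        (V-resp (λ l → cong₂ (λ x y → (v l ℤ.+ x) ℤ.+ y) (et a l) (et b l)) (compat (suc a) (suc b) sa≢sb)))
      where
      sa≢sb : suc a ≢ suc b
      sa≢sb refl = a≢b refl
      tb≢ta : t b ≢ t a
      tb≢ta e = distinct (suc a) (suc b) sa≢sb (λ l → trans (sym (et a l)) (trans (cong (λ k → q k l) (sym e)) (et b l)))

-- Products of simplices

idMat-lookup : ∀ {d} (i j : Fin d) → Vec.lookup (Vec.lookup (idMat {d}) i) j ≡ ℤL.δ i j
-- The entry function is local to `idMat`. The entry appears as `_` in an annotated equation, so
-- that abstracting `i ≟ j` evaluates it there too.
idMat-lookup {d} i j with i Fin.≟ j | ((Vec.lookup (Vec.lookup (idMat {d}) i) j ≡ _) ∋
  trans (cong (λ r → Vec.lookup r j) (Vec.lookup∘tabulate _ i)) (Vec.lookup∘tabulate _ j))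
... | yes refl | e = trans e (sym (ℤL.δ-refl i))
... | no ne | e = trans e (sym (ℤL.δ-≢ i j ne))

ι-δ : ∀ {d} (i j : Fin d) → ι (ℤL.δ i j) ≡ ℚL.δ i j
ι-δ zero    zero    = refl
ι-δ zero    (suc j) = refl
ι-δ (suc i) zero    = refl
ι-δ (suc i) (suc j) = ι-δ i j

simplexPoint : ∀ {k} → Fin (ℕ.suc k) → Fin k → ℚ
simplexPoint zero    j = 0ℚ
simplexPoint (suc i) j = ℚL.δ i j

simplex-lookup : ∀ k i j → Vec.lookup (Vec.lookup (simplexVerts k) i) j ≡ simplexPoint i j
simplex-lookup k zero    j = Vec.lookup-replicate j 0ℚ
simplex-lookup k (suc i) j with i Fin.≟ j | ((Vec.lookup (Vec.lookup (simplexVerts k) (suc i)) j ≡ _) ∋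
  trans (cong (λ r → Vec.lookup r j) (Vec.lookup∘tabulate _ i))
    (trans (Vec.lookup-map j (λ z → z ℚ./ 1) (Vec.tabulate _)) (cong (λ z → z ℚ./ 1) (Vec.lookup∘tabulate _ j))))
... | yes refl | e = trans e (trans (cong ι (sym (ℤL.δ-refl i))) (ι-δ i i))
... | no ne    | e = trans e (trans (cong ι (sym (ℤL.δ-≢ i j ne))) (ι-δ i j))

InSimplex : ∀ {k} → (Fin k → ℚ) → Set
InSimplex y = (∀ i → 0ℚ ℚ.≤ y i) × ℚL.sum y ℚ.≤ 1ℚ

-- The origin contributes nothing, so the weights of a point in the simplex are its coordinates, and
-- the origin takes what is missing to 1.
simplex-sum : ∀ {k} (l : Fin (ℕ.suc k) → ℚ) j → ℚL.sum (λ i → l i ℚ.* simplexPoint i j) ≡ l (suc j)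
simplex-sum l j = begin
  l zero ℚ.* 0ℚ ℚ.+ ℚL.sum (λ i → l (suc i) ℚ.* ℚL.δ i j)
    ≡⟨ cong₂ ℚ._+_ (ℚ.*-zeroʳ (l zero)) (ℚL.dot-cong (l ∘ suc) (λ i → ℚL.δ-sym i j)) ⟩
  0ℚ ℚ.+ ℚL.⟨ l ∘ suc , ℚL.δ j ⟩
    ≡⟨ ℚ.+-identityˡ ℚL.⟨ l ∘ suc , ℚL.δ j ⟩ ⟩
  ℚL.⟨ l ∘ suc , ℚL.δ j ⟩
    ≡⟨ trans (ℚL.dot-comm (l ∘ suc) (ℚL.δ j)) (ℚL.dot-δ j (l ∘ suc)) ⟩
  l (suc j) ∎
  where open ≡-Reasoning

InConv⇒InSimplex : ∀ {k} {y : Point k} → InConv (simplexVerts k) y → InSimplex (Vec.lookup y)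
InConv⇒InSimplex {k} {y} c with InConv⇒Hull (simplex-lookup k) c
... | l , l≥0 , l≡1 , e = (λ i → subst (0ℚ ℚ.≤_) (sym (y≡ i)) (l≥0 (suc i)))
    , subst₂ ℚ._≤_ (ℚL.sum-cong-≋ (λ i → sym (y≡ i))) l≡1
        (subst (ℚ._≤ ℚL.sum l) (ℚ.+-identityˡ (ℚL.sum (l ∘ suc))) (ℚ.+-monoˡ-≤ (ℚL.sum (l ∘ suc)) (l≥0 zero)))
  where
  y≡ : ∀ i → Vec.lookup y i ≡ l (suc i)
  y≡ i = trans (e i) (simplex-sum l i)

InSimplex⇒InConv : ∀ {k} {y : Point k} → InSimplex (Vec.lookup y) → InConv (simplexVerts k) y
InSimplex⇒InConv {k} {y} (y≥0 , s≤1) = Hull⇒InConv {X = simplexVerts k} (simplex-lookup k)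
  (l , l≥0 , lem 1ℚ (ℚL.sum (Vec.lookup y)) , λ j → sym (simplex-sum l j))
  where
  l : Fin (ℕ.suc k) → ℚ
  l zero    = 1ℚ ℚ.- ℚL.sum (Vec.lookup y)
  l (suc i) = Vec.lookup y i
  l≥0 : ∀ i → 0ℚ ℚ.≤ l i
  l≥0 zero    = ≤⇒0≤ s≤1
  l≥0 (suc i) = y≥0 i
  lem : ∀ o s → (o ℚ.- s) ℚ.+ s ≡ o
  lem = solve-∀ ringℚ

-- Sums over lists and enumeration block by block.

module ListSum (R : CommutativeRing 0ℓ 0ℓ) where
  open CommutativeRing R using (Carrier; _≈_; _+_; 0#; +-cong; +-assoc; +-comm; +-identityˡ; setoid)
    renaming (refl to ≈-refl; sym to ≈-sym; trans to ≈-trans)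
  module L = Linear R

  sumList : ∀ {A : Set} → (A → Carrier) → List A → Carrier
  sumList g []       = 0#
  sumList g (a ∷ as) = g a + sumList g as

  sumList-++ : ∀ {A : Set} (g : A → Carrier) as bs → sumList g (as List.++ bs) ≈ sumList g as + sumList g bs
  sumList-++ g []       bs = ≈-sym (+-identityˡ (sumList g bs))
  sumList-++ g (a ∷ as) bs = ≈-trans (+-cong ≈-refl (sumList-++ g as bs)) (≈-sym (+-assoc (g a) (sumList g as) (sumList g bs)))

  sumList-↭ : ∀ {A : Set} (g : A → Carrier) {as bs} → as ↭ bs → sumList g as ≈ sumList g bs
  sumList-↭ g Perm.refl = ≈-refl
  sumList-↭ g (prep x p) = +-cong ≈-refl (sumList-↭ g p)
  sumList-↭ g (Perm.swap x y p) = ≈-trans (≈-sym (+-assoc (g x) (g y) _))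
    (≈-trans (+-cong (+-comm (g x) (g y)) (sumList-↭ g p)) (+-assoc (g y) (g x) _))
  sumList-↭ g (Perm.trans p q) = ≈-trans (sumList-↭ g p) (sumList-↭ g q)

  sumList-toList : ∀ {A : Set} (g : A → Carrier) {n} (v : Vec A n) → sumList g (Vec.toList v) ≈ L.sum (λ k → g (Vec.lookup v k))
  sumList-toList g []       = ≈-refl
  sumList-toList g (a ∷ as) = +-cong ≈-refl (sumList-toList g as)

  sumList-lookup : ∀ {A : Set} (g : A → Carrier) as → sumList g as ≈ L.sum (λ k → g (List.lookup as k))
  sumList-lookup g []       = ≈-refl
  sumList-lookup g (a ∷ as) = +-cong ≈-refl (sumList-lookup g as)

  sumList-tabulate : ∀ {A : Set} (g : A → Carrier) {n} (h : Fin n → A) → sumList g (List.tabulate h) ≈ L.sum (g ∘ h)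
  sumList-tabulate g {ℕ.zero}  h = ≈-refl
  sumList-tabulate g {ℕ.suc n} h = +-cong ≈-refl (sumList-tabulate g (h ∘ suc))

  sum-reindex : ∀ {n d} (v : Vec (Fin d) n) → Vec.toList v ↭ List.allFin d → (g : Fin d → Carrier) →
                L.sum (λ k → g (Vec.lookup v k)) ≈ L.sum g
  sum-reindex v p g = ≈-trans (≈-sym (sumList-toList g v)) (≈-trans (sumList-↭ g p) (sumList-tabulate g (λ i → i)))

module ℚS = ListSum ℚ.+-*-commutativeRing
module ℤS = ListSum ℤ.+-*-commutativeRing

-- The order of the coordinates in the product. The length is written as a sum of block lengths to
-- agree with the type of `InProdSimplex`.
index : ∀ {A : Set} (bs : List (List A)) → Vec A (sum (List.map List.length bs))
index []       = []
index (b ∷ bs) = Vec.fromList b Vec.++ index bs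

toList-index : ∀ {A : Set} (bs : List (List A)) → Vec.toList (index bs) ≡ List.concat bs
toList-index []       = refl
toList-index (b ∷ bs) = trans (Vec.toList-++ (Vec.fromList b) (index bs)) (cong₂ List._++_ (Vec.toList∘fromList b) (toList-index bs))

lookup-unique : ∀ {A : Set} {n} (v : Vec A n) → Unique (Vec.toList v) → ∀ i j → Vec.lookup v i ≡ Vec.lookup v j → i ≡ j
lookup-unique (x ∷ v) (p ∷ u) zero    zero    e = refl
lookup-unique (x ∷ v) (p ∷ u) zero    (suc j) e = ⊥-elim (All.lookup p (∈-toList⁺ (VM.∈-lookup j v)) e)
lookup-unique (x ∷ v) (p ∷ u) (suc i) zero    e = ⊥-elim (All.lookup p (∈-toList⁺ (VM.∈-lookup i v)) (sym e))
lookup-unique (x ∷ v) (p ∷ u) (suc i) (suc j) e = cong suc (lookup-unique v u i j e)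

list-lookup-unique : ∀ {A : Set} (xs : List A) → Unique xs → ∀ i j → List.lookup xs i ≡ List.lookup xs j → i ≡ j
list-lookup-unique (x ∷ xs) (p ∷ u) zero    zero    e = refl
list-lookup-unique (x ∷ xs) (p ∷ u) zero    (suc j) e = ⊥-elim (All.lookup p (∈-lookup j) e)
list-lookup-unique (x ∷ xs) (p ∷ u) (suc i) zero    e = ⊥-elim (All.lookup p (∈-lookup i) (sym e))
list-lookup-unique (x ∷ xs) (p ∷ u) (suc i) (suc j) e = cong suc (list-lookup-unique xs u i j e)

unique-resp-↭ : ∀ {A : Set} {xs ys : List A} → xs ↭ ys → Unique xs → Unique ys
unique-resp-↭ Perm.refl u = u
unique-resp-↭ (prep x p) (px ∷ u) = Perm.All-resp-↭ p px ∷ unique-resp-↭ p u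
unique-resp-↭ (Perm.swap x y p) ((x≢y ∷ px) ∷ (py ∷ u)) =
  ((λ e → x≢y (sym e)) ∷ Perm.All-resp-↭ p py) ∷ Perm.All-resp-↭ p px ∷ unique-resp-↭ p u
unique-resp-↭ (Perm.trans p q) u = unique-resp-↭ q (unique-resp-↭ p u)

unique-concat⁻ : ∀ {A : Set} (bs : List (List A)) → Unique (List.concat bs) → All Unique bs
unique-concat⁻ []       u = []
unique-concat⁻ (b ∷ bs) u = left b u ∷ unique-concat⁻ bs (right b u)
  where
  left : ∀ {A : Set} (xs : List A) {ys} → Unique (xs List.++ ys) → Unique xs
  left []       u       = []
  left (x ∷ xs) (p ∷ u) = All.++⁻ˡ xs p ∷ left xs u
  right : ∀ {A : Set} (xs : List A) {ys} → Unique (xs List.++ ys) → Unique ys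
  right []       u       = u
  right (x ∷ xs) (p ∷ u) = right xs u

InBlock : ∀ {A : Set} → (A → ℚ) → List A → Set
InBlock f b = InSimplex (λ i → f (List.lookup b i))

lookup-map-fromList : ∀ {A : Set} (f : A → ℚ) b i → Vec.lookup (Vec.map f (Vec.fromList b)) i ≡ f (List.lookup b i)
lookup-map-fromList f (x ∷ b) zero    = refl
lookup-map-fromList f (x ∷ b) (suc i) = lookup-map-fromList f b i

take-index : ∀ {A : Set} (f : A → ℚ) b bs → Vec.take (List.length b) (Vec.map f (index (b ∷ bs))) ≡ Vec.map f (Vec.fromList b)
take-index f []      bs = refl
take-index f (x ∷ b) bs = cong (f x ∷_) (take-index f b bs)

drop-index : ∀ {A : Set} (f : A → ℚ) b bs → Vec.drop (List.length b) (Vec.map f (index (b ∷ bs))) ≡ Vec.map f (index bs)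
drop-index f []      bs = refl
drop-index f (x ∷ b) bs = drop-index f b bs

InSimplex-resp : ∀ {k} {x y : Fin k → ℚ} → (∀ i → x i ≡ y i) → InSimplex x → InSimplex y
InSimplex-resp e (x≥0 , s≤1) = (λ i → subst (0ℚ ℚ.≤_) (e i) (x≥0 i)) , subst (ℚ._≤ 1ℚ) (ℚL.sum-cong-≋ e) s≤1

product⇒blocks : ∀ {A : Set} (f : A → ℚ) bs →
  InProdSimplex (List.map List.length bs) (Vec.map f (index bs)) → All (InBlock f) bs
product⇒blocks f []       _       = []
product⇒blocks f (b ∷ bs) (p , r) =
  InSimplex-resp (lookup-map-fromList f b) (InConv⇒InSimplex (subst (InConv (simplexVerts _)) (take-index f b bs) p))
  ∷ product⇒blocks f bs (subst (InProdSimplex (List.map List.length bs)) (drop-index f b bs) r)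

blocks⇒product : ∀ {A : Set} (f : A → ℚ) bs → All (InBlock f) bs →
  InProdSimplex (List.map List.length bs) (Vec.map f (index bs))
blocks⇒product f []       []       = _
blocks⇒product f (b ∷ bs) (p ∷ ps) =
  subst (InConv (simplexVerts _)) (sym (take-index f b bs)) (InSimplex⇒InConv (InSimplex-resp (λ i → sym (lookup-map-fromList f b i)) p))
  , subst (InProdSimplex (List.map List.length bs)) (sym (drop-index f b bs)) (blocks⇒product f bs ps)

-- A block is a class of R, kept as a pair of a representative and the other members.
module Partition {A : Set} (R : A → A → Set) (R? : ∀ a b → Dec (R a b))
  (R-refl : ∀ {a} → R a a) (R-sym : ∀ {a b} → R a b → R b a) (R-trans : ∀ {a b c} → R a b → R b c → R a c) where

  Block : Set
  Block = A × List A

  members : Block → List A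
  members (h , t) = h ∷ t

  insert : A → List Block → List Block
  insert x [] = (x , []) ∷ []
  insert x ((h , t) ∷ bs) with R? x h
  ... | yes _ = (h , x ∷ t) ∷ bs
  ... | no _  = (h , t) ∷ insert x bs

  elements : List Block → List A
  elements bs = List.concat (List.map members bs)

  insert-↭ : ∀ x bs → elements (insert x bs) ↭ x ∷ elements bs
  insert-↭ x [] = ↭-refl
  insert-↭ x ((h , t) ∷ bs) with R? x h
  ... | yes _ = Perm.swap h x ↭-refl
  ... | no _  = ↭-trans (Perm.++⁺ˡ (h ∷ t) (insert-↭ x bs)) (Perm.shift x (h ∷ t) (elements bs))

  Related : Block → Set
  Related (h , t) = All (R h) t

  Unrelated : Block → Block → Set
  Unrelated (h , _) (h′ , _) = ¬ R h h′

  insert-related : ∀ x bs → All Related bs → All Related (insert x bs)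
  insert-related x [] [] = [] ∷ []
  insert-related x ((h , t) ∷ bs) (p ∷ ps) with R? x h
  ... | yes r = (R-sym r ∷ p) ∷ ps
  ... | no _  = p ∷ insert-related x bs ps

  insert-All : ∀ x bs c → ¬ R (proj₁ c) x → All (Unrelated c) bs → All (Unrelated c) (insert x bs)
  insert-All x [] c n [] = n ∷ []
  insert-All x ((h , t) ∷ bs) c n (p ∷ ps) with R? x h
  ... | yes _ = p ∷ ps
  ... | no _  = p ∷ insert-All x bs c n ps

  insert-unrelated : ∀ x bs → AllPairs Unrelated bs → AllPairs Unrelated (insert x bs)
  insert-unrelated x [] [] = [] ∷ []
  insert-unrelated x ((h , t) ∷ bs) (p ∷ ps) with R? x h
  ... | yes _ = p ∷ ps
  ... | no n  = insert-All x bs (h , t) (λ r → n (R-sym r)) p ∷ insert-unrelated x bs ps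

  classes : List A → List Block
  classes = List.foldr insert []

  classes-↭ : ∀ xs → elements (classes xs) ↭ xs
  classes-↭ []       = ↭-refl
  classes-↭ (x ∷ xs) = ↭-trans (insert-↭ x (classes xs)) (prep x (classes-↭ xs))

  classes-related : ∀ xs → All Related (classes xs)
  classes-related []       = []
  classes-related (x ∷ xs) = insert-related x (classes xs) (classes-related xs)

  classes-unrelated : ∀ xs → AllPairs Unrelated (classes xs)
  classes-unrelated []       = []
  classes-unrelated (x ∷ xs) = insert-unrelated x (classes xs) (classes-unrelated xs)

  head-related : ∀ {b a} → Related b → a ∈ members b → R (proj₁ b) a
  head-related p (here refl) = R-refl
  head-related p (there a∈t) = All.lookup p a∈t

  SameClass : List A → Set
  SameClass b = ∀ {a a′} → a ∈ b → a′ ∈ b → R a a′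

  OtherClass : List A → List A → Set
  OtherClass b b′ = ∀ {a a′} → a ∈ b → a′ ∈ b′ → ¬ R a a′

  blocks : List A → List (List A)
  blocks xs = List.map members (classes xs)

  blocks-same : ∀ xs → All SameClass (blocks xs)
  blocks-same xs = go (classes-related xs)
    where
    go : ∀ {bs} → All Related bs → All SameClass (List.map members bs)
    go []       = []
    go (p ∷ ps) = (λ a∈ a′∈ → R-trans (R-sym (head-related p a∈)) (head-related p a′∈)) ∷ go ps

  -- `insert` compares only representatives; transitivity through the two representatives carries
  -- the separation to all members.
  blocks-other : ∀ xs → AllPairs OtherClass (blocks xs)
  blocks-other xs = go (classes-related xs) (classes-unrelated xs)
    where
    go₁ : ∀ {b bs} → Related b → All Related bs → All (Unrelated b) bs → All (OtherClass (members b)) (List.map members bs)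
    go₁ r []       []       = []
    go₁ r (q ∷ qs) (p ∷ ps) = (λ a∈ a′∈ aRa′ → p (R-trans (head-related r a∈) (R-trans aRa′ (R-sym (head-related q a′∈))))) ∷ go₁ r qs ps
    go : ∀ {bs} → All Related bs → AllPairs Unrelated bs → AllPairs OtherClass (List.map members bs)
    go []       []       = []
    go (q ∷ qs) (p ∷ ps) = go₁ q qs p ∷ go qs ps

-- At most one of the integers is nonzero: if the first is at least 1, every other is at most 0.
-- Over the rationals this fails, as three halves show, so the bound has to be proved at lattice
-- points before it passes to the hull.
pairwise≤1⇒sum≤1 : ∀ {m} (c : Funℤ m) → (∀ i → + 0 ℤ.≤ c i) → (∀ i → c i ℤ.≤ + 1) →
  (∀ i j → i ≢ j → c i ℤ.+ c j ℤ.≤ + 1) → ℤL.sum c ℤ.≤ + 1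
pairwise≤1⇒sum≤1 {ℕ.zero}  c c≥0 c≤1 cc = ℤ.+≤+ ℕ.z≤n
pairwise≤1⇒sum≤1 {ℕ.suc m} c c≥0 c≤1 cc with c zero ℤ.≟ + 0
... | yes c₀≡0 = subst (ℤ._≤ + 1) (sym (trans (cong (ℤ._+ ℤL.sum (λ i → c (suc i))) c₀≡0) (ℤ.+-identityˡ (ℤL.sum (λ i → c (suc i))))))
  (pairwise≤1⇒sum≤1 (λ i → c (suc i)) (λ i → c≥0 (suc i)) (λ i → c≤1 (suc i)) (λ i j i≢j → cc (suc i) (suc j) (λ { refl → i≢j refl })))
... | no c₀≢0 = subst (ℤ._≤ + 1) (sym (trans (cong (λ t → c zero ℤ.+ t) (ℤL.sum-zero (λ i → c (suc i)) rest≡0)) (ℤ.+-identityʳ (c zero)))) (c≤1 zero)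
  where
  lem : ∀ x → (+ 1 ℤ.+ x) ℤ.- + 1 ≡ x
  lem = solve-∀ ringℤ
  rest≡0 : ∀ i → c (suc i) ≡ + 0
  rest≡0 i = ℤ.≤-antisym (subst (ℤ._≤ + 0) (lem (c (suc i))) (ℤ.i≤j⇒i-j≤0
    (ℤ.≤-trans (ℤ.+-monoˡ-≤ (c (suc i)) (≢0⇒1≤ (c≥0 zero) c₀≢0)) (cc zero (suc i) (λ ()))))) (c≥0 (suc i))

module BasisChange {d} (B : Basis d) where
  open Basis B

  δ-expand : ∀ i j → ℤL.sum (λ k → q k i ℤ.* φ k j) ≡ ℤL.δ i j
  δ-expand i j = begin
    ℤL.sum (λ k → q k i ℤ.* φ k j)             ≡⟨ ℤL.dot-comm (λ k → q k i) (λ k → φ k j) ⟩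
    ℤL.sum (λ k → φ k j ℤ.* q k i)             ≡⟨ ℤL.sum-cong-≋ (λ k → cong (ℤ._* q k i) (trans (ℤL.dot-comm (φ k) (ℤL.δ j)) (ℤL.dot-δ j (φ k)))) ⟨
    ℤL.sum (λ k → ⟨ φ k , ℤL.δ j ⟩ ℤ.* q k i)  ≡⟨ expand (ℤL.δ j) i ⟨
    ℤL.δ j i                                   ≡⟨ ℤL.δ-sym j i ⟩
    ℤL.δ i j                                   ∎
    where open ≡-Reasoning

  -- By linearity from the unit vectors, whose expansion is integral.
  expandℚ : ∀ (y : Funℚ d) i → y i ≡ ℚL.sum (λ k → ⟪ (λ j → ι (φ k j)) , y ⟫ ℚ.* ι (q k i))
  expandℚ y i = begin
    y i                                                            ≡⟨ ℚL.dot-δ i y ⟨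
    ⟪ ℚL.δ i , y ⟫                                                 ≡⟨ ℚL.dot-comm (ℚL.δ i) y ⟩
    ⟪ y , ℚL.δ i ⟫                                                 ≡⟨ ℚL.dot-cong y δι ⟩
    ⟪ y , (λ j → ℚL.sum (λ k → ι (q k i) ℚ.* ι (φ k j))) ⟫         ≡⟨ ℚL.dot-sum y (λ k → ι (q k i)) (λ k j → ι (φ k j)) ⟩
    ℚL.sum (λ k → ι (q k i) ℚ.* ⟪ y , (λ j → ι (φ k j)) ⟫)         ≡⟨ ℚL.sum-cong-≋ (λ k → trans (ℚ.*-comm (ι (q k i)) _) (cong (ℚ._* ι (q k i)) (ℚL.dot-comm y (λ j → ι (φ k j))))) ⟩
    ℚL.sum (λ k → ⟪ (λ j → ι (φ k j)) , y ⟫ ℚ.* ι (q k i))         ∎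
    where
    open ≡-Reasoning
    δι : ∀ j → ℚL.δ i j ≡ ℚL.sum (λ k → ι (q k i) ℚ.* ι (φ k j))
    δι j = trans (sym (ι-δ i j)) (trans (cong ι (sym (δ-expand i j))) (trans (sum-ι (λ k → q k i ℤ.* φ k j))
      (ℚL.sum-cong-≋ (λ k → ι-* (q k i) (φ k j)))))

-- The polytope as the product of the simplices of its classes.

module Decomposition {n d} (S : Fin n → Funℤ d)
  (lonely : ∀ (x y : Funℤ d) (N : ℤ) → + 2 ℤ.≤ N → LatticePoints.V S x → LatticePoints.V S (λ j → x j ℤ.+ N ℤ.* y j) → ∀ j → y j ≡ + 0)
  (frame : ∀ v → LatticePoints.V S v → Frame (LatticePoints.V S) v)
  (v : Funℤ d) (vv : LatticePoints.V S v) where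

  open LatticePoints S using (X; V; hull; V-resp; V-gen; pos-hull)
  open Directions V V-resp lonely frame
  open Core V V-resp lonely frame using (_⊞_; _⊟_)
  open At v vv

  R : Fin d → Fin d → Set
  R a b = a ≡ b ⊎ ¬ Compat a b

  R? : ∀ a b → Dec (R a b)
  R? a b with a Fin.≟ b
  ... | yes e = yes (inj₁ e)
  ... | no a≢b with compat? {a} {b} (λ e → a≢b (sym e))
  ...   | yes c = no λ { (inj₁ e) → a≢b e ; (inj₂ nc) → nc c }
  ...   | no nc = yes (inj₂ nc)

  R-sym : ∀ {a b} → R a b → R b a
  R-sym (inj₁ e)  = inj₁ (sym e)
  R-sym {a} {b} (inj₂ nc) = inj₂ (λ c → nc (compat-sym {b} {a} c))

  R-trans : ∀ {a b c} → R a b → R b c → R a c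
  R-trans (inj₁ refl) r = r
  R-trans (inj₂ nc) (inj₁ refl) = inj₂ nc
  R-trans {a} {b} {c} (inj₂ nab) (inj₂ nbc) with a Fin.≟ b | c Fin.≟ b
  ... | yes refl | _ = inj₂ nbc
  ... | no _ | yes refl = inj₂ nab
  ... | no a≢b | no c≢b = inj₂ (¬compat-trans a≢b c≢b nab nbc)

  ¬R⇒compat : ∀ {a b} → ¬ R a b → Compat a b
  ¬R⇒compat {a} {b} nr with compat? {a} {b} (λ e → nr (inj₁ (sym e)))
  ... | yes c = c
  ... | no nc = ⊥-elim (nr (inj₂ nc))

  open Partition R R? (inj₁ refl) R-sym R-trans public

  φℚ qℚ : Fin d → Funℚ d
  φℚ a j = ι (φ a j)
  qℚ a j = ι (q a j)
  vℚ : Funℚ d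
  vℚ j = ι (v j)

  height : Funℚ d → Fin d → ℚ
  height x a = ⟪ φℚ a , x ⟫ ℚ.- ⟪ φℚ a , vℚ ⟫

  -- Distinct directions of a class conflict, so their coordinates add up to at most 1 in pairs.
  lattice-block-sum : ∀ {b} → Unique b → SameClass b → ∀ {x} → V x → ℤL.sum (λ i → coord (List.lookup b i) x) ℤ.≤ + 1
  lattice-block-sum {b} u same {x} vx = pairwise≤1⇒sum≤1 (λ i → coord (List.lookup b i) x)
    (λ i → pos (List.lookup b i) vx) (λ i → coord≤1 (List.lookup b i) vx) pair
    where
    pair : ∀ i j → i ≢ j → coord (List.lookup b i) x ℤ.+ coord (List.lookup b j) x ℤ.≤ + 1
    pair i j i≢j with same (∈-lookup {xs = b} i) (∈-lookup {xs = b} j)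
    ... | inj₁ e = ⊥-elim (i≢j (list-lookup-unique b u i j e))
    ... | inj₂ nc = ¬compat⇒coords≤1 (List.lookup b i) vx (λ e → i≢j (sym (list-lookup-unique b u j i e))) nc

  -- The heights of `x` are the averages of the coordinates of the generators, with the weights of
  -- `x`. Generators are lattice points, where the bound is known.
  hull⇒block : ∀ {b} → Unique b → SameClass b → ∀ {x} → Hull X x → InBlock (height x) b
  hull⇒block {b} u same {x} h@(l , l≥0 , l≡1 , _) = (λ i → ≤⇒0≤ (pos-hull {v} (φ (List.lookup b i)) (λ s → pos (List.lookup b i) (V-gen s)) h)) , 0≤⇒≤ (subst (0ℚ ℚ.≤_) Σ≡ Σ≥0)
    where
    open ≡-Reasoning
    c : Fin n → Fin (List.length b) → ℚ
    c s i = ι (coord (List.lookup b i) (S s))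
    height≡ : ∀ a → height x a ≡ ℚL.sum (λ s → l s ℚ.* ι (coord a (S s)))
    height≡ a = begin
      ⟪ φℚ a , x ⟫ ℚ.- ⟪ φℚ a , vℚ ⟫                           ≡⟨ cong (ℚ._- ⟪ φℚ a , vℚ ⟫) (hull-dot (φℚ a) h) ⟩
      ⟪ l , (λ s → ⟪ φℚ a , X s ⟫) ⟫ ℚ.- ⟪ φℚ a , vℚ ⟫         ≡⟨ sum-affine′ l (λ s → ⟪ φℚ a , X s ⟫) ⟪ φℚ a , vℚ ⟫ l≡1 ⟨
      ℚL.sum (λ s → l s ℚ.* (⟪ φℚ a , X s ⟫ ℚ.- ⟪ φℚ a , vℚ ⟫)) ≡⟨ ℚL.sum-cong-≋ (λ s → cong (l s ℚ.*_) (dot-ι-- (φ a) (S s) v)) ⟨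
      ℚL.sum (λ s → l s ℚ.* ι (coord a (S s)))                 ∎
    total : Funℚ n
    total s = ℚL.sum (c s)
    total≤1 : ∀ s → total s ℚ.≤ 1ℚ
    total≤1 s = subst (ℚ._≤ 1ℚ) (sum-ι (λ i → coord (List.lookup b i) (S s))) (ι-≤ (lattice-block-sum u same (V-gen s)))
    Σ≥0 : 0ℚ ℚ.≤ ℚL.sum (λ s → l s ℚ.* (1ℚ ℚ.- total s))
    Σ≥0 = ℚN.sum-0≤ (λ s → l s ℚ.* (1ℚ ℚ.- total s)) (λ s → 0≤* (l≥0 s) (≤⇒0≤ (total≤1 s)))
    Σ≡ : ℚL.sum (λ s → l s ℚ.* (1ℚ ℚ.- total s)) ≡ 1ℚ ℚ.- ℚL.sum (λ i → height x (List.lookup b i))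
    Σ≡ = trans (sum-affine l total 1ℚ l≡1) (cong (λ t → 1ℚ ℚ.- t) (begin
      ℚL.sum (λ s → l s ℚ.* ℚL.sum (c s))               ≡⟨ ℚL.sum-cong-≋ (λ s → ℚL.*-distribˡ-sum (l s) (c s)) ⟩
      ℚL.sum (λ s → ℚL.sum (λ i → l s ℚ.* c s i))       ≡⟨ ℚL.∑-comm (λ s i → l s ℚ.* c s i) ⟩
      ℚL.sum (λ i → ℚL.sum (λ s → l s ℚ.* c s i))       ≡⟨ ℚL.sum-cong-≋ (λ i → height≡ (List.lookup b i)) ⟨
      ℚL.sum (λ i → height x (List.lookup b i))         ∎))

  q-injective : ∀ {a b} → (∀ l → q a l ≡ q b l) → a ≡ b
  q-injective {a} {b} e with a Fin.≟ b
  ... | yes a≡b = a≡b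
  ... | no a≢b = ⊥-elim (+1≢+0 (trans (sym (φq-refl lattice-basis a)) (trans (ℤL.dot-cong (φ a) e) (φq-≢ lattice-basis a≢b))))

  -- An intermediate point: blocks already treated contribute the chosen directions `T`, those in
  -- `bs` still contribute with their coefficients `f`.
  offset : ∀ {m} → (Fin m → Fin d) → (Fin d → ℚ) → List (List (Fin d)) → Funℚ d
  offset T f bs j = (vℚ j ℚ.+ ℚL.sum (λ i → qℚ (T i) j)) ℚ.+ ℚS.sumList (λ a → f a ℚ.* qℚ a j) (List.concat bs)

  -- The chosen directions T are joined, block by block, by at most one direction of
  -- every block; a point of the product is a convex combination of these choices.
  blocks⇒hull : ∀ (f : Fin d → ℚ) bs → AllPairs OtherClass bs → All (InBlock f) bs →
    ∀ {m} (T : Fin m → Fin d) → (∀ i j → i ≢ j → ¬ R (T i) (T j)) →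
    All (λ b → ∀ {a} → a ∈ b → ∀ i → ¬ R (T i) a) bs → Hull X (offset T f bs)
  blocks⇒hull f [] [] [] T nr [] = hull-resp eq
    (hull (many v vv (λ i → q (T i)) (λ i → T i , λ _ → refl) (λ i j i≢j e → nr i j i≢j (inj₁ (q-injective e))) (λ i j i≢j → ¬R⇒compat (nr i j i≢j))))
    where
    eq : ∀ j → offset T f [] j ≡ ι (v j ℤ.+ ℤL.sum (λ i → q (T i) j))
    eq j = trans (ℚ.+-identityʳ (vℚ j ℚ.+ ℚL.sum (λ i → qℚ (T i) j)))
      (sym (trans (ι-+ (v j) (ℤL.sum (λ i → q (T i) j))) (cong (λ t → vℚ j ℚ.+ t) (sum-ι (λ i → q (T i) j)))))
  blocks⇒hull f (b ∷ bs) (ob ∷ obs) ((f≥0 , s≤1) ∷ fs) {m} T nr (tb ∷ tbs) = hull-trans {Y = Y} Y∈ (l , l≥0 , l≡1 , eq)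
    where
    open ≡-Reasoning
    k = List.length b
    choose : Fin k → Fin (ℕ.suc m) → Fin d
    choose i zero    = List.lookup b i
    choose i (suc t) = T t
    Y : Fin (ℕ.suc k) → Funℚ d
    Y zero    = offset T f bs
    Y (suc i) = offset (choose i) f bs
    fb : Fin k → ℚ
    fb i = f (List.lookup b i)
    -- The first weight belongs to taking no direction of `b`, the others to taking one of its
    -- members.
    l : Fin (ℕ.suc k) → ℚ
    l zero    = 1ℚ ℚ.- ℚL.sum fb
    l (suc i) = fb i
    l≥0 : ∀ i → 0ℚ ℚ.≤ l i
    l≥0 zero    = ≤⇒0≤ s≤1
    l≥0 (suc i) = f≥0 i
    lem₀ : ∀ o s → (o ℚ.- s) ℚ.+ s ≡ o
    lem₀ = solve-∀ ringℚ
    l≡1 : ℚL.sum l ≡ 1ℚ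
    l≡1 = lem₀ 1ℚ (ℚL.sum fb)
    choose-nr : ∀ i s t → s ≢ t → ¬ R (choose i s) (choose i t)
    choose-nr i zero    zero    ne = ⊥-elim (ne refl)
    choose-nr i zero    (suc t) ne = λ r → tb (∈-lookup {xs = b} i) t (R-sym r)
    choose-nr i (suc s) zero    ne = tb (∈-lookup {xs = b} i) s
    choose-nr i (suc s) (suc t) ne = nr s t (λ { refl → ne refl })
    choose-tbs : ∀ i {bs} → All (OtherClass b) bs → All (λ b → ∀ {a} → a ∈ b → ∀ i → ¬ R (T i) a) bs →
      All (λ b′ → ∀ {a} → a ∈ b′ → ∀ s → ¬ R (choose i s) a) bs
    choose-tbs i []       []       = []
    choose-tbs i (o ∷ os) (p ∷ ps) = (λ { a∈ zero → o (∈-lookup {xs = b} i) a∈ ; a∈ (suc s) → p a∈ s }) ∷ choose-tbs i os ps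
    Y∈ : ∀ i → Hull X (Y i)
    Y∈ zero    = blocks⇒hull f bs obs fs T nr tbs
    Y∈ (suc i) = blocks⇒hull f bs obs fs (choose i) (choose-nr i) (choose-tbs i ob tbs)
    lem₁ : ∀ f v q t r → f ℚ.* ((v ℚ.+ (q ℚ.+ t)) ℚ.+ r) ≡ f ℚ.* q ℚ.+ f ℚ.* ((v ℚ.+ t) ℚ.+ r)
    lem₁ = solve-∀ ringℚ
    lem₂ : ∀ B G r s → B ℚ.+ (G ℚ.+ r) ≡ (1ℚ ℚ.- s) ℚ.* (B ℚ.+ r) ℚ.+ (G ℚ.+ s ℚ.* (B ℚ.+ r))
    lem₂ = solve-∀ ringℚ
    eq : ∀ j → offset T f (b ∷ bs) j ≡ ℚL.sum (λ i → l i ℚ.* Y i j)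
    eq j = begin
      base ℚ.+ ℚS.sumList g (b List.++ List.concat bs)
        ≡⟨ cong (λ t → base ℚ.+ t) (trans (ℚS.sumList-++ g b (List.concat bs)) (cong (ℚ._+ rest) (ℚS.sumList-lookup g b))) ⟩
      base ℚ.+ (G ℚ.+ rest)
        ≡⟨ lem₂ base G rest (ℚL.sum fb) ⟩
      (1ℚ ℚ.- ℚL.sum fb) ℚ.* (base ℚ.+ rest) ℚ.+ (G ℚ.+ ℚL.sum fb ℚ.* (base ℚ.+ rest))
        ≡⟨ cong (λ t → (1ℚ ℚ.- ℚL.sum fb) ℚ.* (base ℚ.+ rest) ℚ.+ (G ℚ.+ t)) (ℚL.*-distribʳ-sum (base ℚ.+ rest) fb) ⟩
      (1ℚ ℚ.- ℚL.sum fb) ℚ.* (base ℚ.+ rest) ℚ.+ (G ℚ.+ ℚL.sum (λ i → fb i ℚ.* (base ℚ.+ rest)))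
        ≡⟨ cong (λ t → (1ℚ ℚ.- ℚL.sum fb) ℚ.* (base ℚ.+ rest) ℚ.+ t)
             (trans (sym (ℚL.∑-distrib-+ (λ i → g (List.lookup b i)) (λ i → fb i ℚ.* (base ℚ.+ rest))))
               (ℚL.sum-cong-≋ (λ i → sym (lem₁ (fb i) (vℚ j) (qℚ (List.lookup b i) j) (ℚL.sum (λ i → qℚ (T i) j)) rest)))) ⟩
      ℚL.sum (λ i → l i ℚ.* Y i j) ∎
      where
      g : Fin d → ℚ
      g a = f a ℚ.* qℚ a j
      base rest G : ℚ
      base = vℚ j ℚ.+ ℚL.sum (λ i → qℚ (T i) j)
      rest = ℚS.sumList g (List.concat bs)
      G = ℚL.sum (λ i → g (List.lookup b i))

  decomposition : List (List (Fin d))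
  decomposition = blocks (List.allFin d)

  decomposition-↭ : List.concat decomposition ↭ List.allFin d
  decomposition-↭ = classes-↭ (List.allFin d)

  -- With no direction chosen and all blocks untreated, `offset` is `v` plus the expansion of
  -- `x - v` in the basis, that is, `x` itself.
  blocks⇒hull-height : ∀ {x} → All (InBlock (height x)) decomposition → Hull X x
  blocks⇒hull-height {x} fs = hull-resp eq (blocks⇒hull (height x) decomposition (blocks-other (List.allFin d)) fs none (λ ())
      (All.universal none-clash decomposition))
    where
    open ≡-Reasoning
    open BasisChange lattice-basis
    none : Fin 0 → Fin d
    none ()
    none-clash : ∀ b {a} → a ∈ b → ∀ i → ¬ R (none i) a
    none-clash b _ ()
    lem : ∀ x v → x ≡ (v ℚ.+ 0ℚ) ℚ.+ (x ℚ.- v)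
    lem = solve-∀ ringℚ
    eq : ∀ j → x j ≡ offset none (height x) decomposition j
    eq j = begin
      x j
        ≡⟨ lem (x j) (vℚ j) ⟩
      (vℚ j ℚ.+ 0ℚ) ℚ.+ (x j ℚ.- vℚ j)
        ≡⟨ cong (λ t → (vℚ j ℚ.+ 0ℚ) ℚ.+ t) (expandℚ (λ j → x j ℚ.- vℚ j) j) ⟩
      (vℚ j ℚ.+ 0ℚ) ℚ.+ ℚL.sum (λ k → ⟪ φℚ k , (λ j → x j ℚ.- vℚ j) ⟫ ℚ.* qℚ k j)
        ≡⟨ cong (λ t → (vℚ j ℚ.+ 0ℚ) ℚ.+ t) (ℚL.sum-cong-≋ (λ k → cong (ℚ._* qℚ k j) (ℚL.dot-- (φℚ k) x vℚ))) ⟩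
      (vℚ j ℚ.+ 0ℚ) ℚ.+ ℚL.sum (λ k → height x k ℚ.* qℚ k j)
        ≡⟨ cong (λ t → (vℚ j ℚ.+ 0ℚ) ℚ.+ t) (trans (sym (ℚS.sumList-tabulate g (λ i → i))) (sym (ℚS.sumList-↭ g decomposition-↭))) ⟩
      (vℚ j ℚ.+ 0ℚ) ℚ.+ ℚS.sumList g (List.concat decomposition) ∎
      where
      g : Fin d → ℚ
      g a = height x a ℚ.* qℚ a j

-- Translation of the hypotheses of the theorem.

toPoint : ∀ {d} → Funℚ d → Point d
toPoint = Vec.tabulate

dot-toPoint : ∀ {d} (a f : Funℚ d) → dot (toPoint a) (toPoint f) ≡ ⟪ a , f ⟫
dot-toPoint a f = trans (dot-lookup (toPoint a) (toPoint f))
  (ℚL.sum-cong-≋ (λ j → cong₂ ℚ._*_ (Vec.lookup∘tabulate a j) (Vec.lookup∘tabulate f j)))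

dot-toPointʳ : ∀ {d} (c : Point d) (f : Funℚ d) → dot c (toPoint f) ≡ ⟪ Vec.lookup c , f ⟫
dot-toPointʳ c f = trans (dot-lookup c (toPoint f)) (ℚL.dot-cong (Vec.lookup c) (Vec.lookup∘tabulate f))

dot-toPointˡ : ∀ {d} (a : Funℚ d) (x : Point d) → dot (toPoint a) x ≡ ⟪ a , Vec.lookup x ⟫
dot-toPointˡ a x = trans (dot-lookup (toPoint a) x) (ℚL.sum-cong-≋ (λ j → cong (ℚ._* Vec.lookup x j) (Vec.lookup∘tabulate a j)))

toPoint-lattice : ∀ {d} (z : Funℤ d) → IsLatticePoint (toPoint (λ j → ι (z j)))
toPoint-lattice z = Vec.tabulate z , Vec.tabulate-∘ ι z

-- The weights of an empty family sum to 0 and not to 1. The index obtained selects the base vertex.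
fullDim-nonempty : ∀ {d} (P : LatticePolytope d) → FullDim P → Fin (proj₁ P)
fullDim-nonempty (ℕ.zero , [])  full with full zeroP
... | [] , () , _
fullDim-nonempty (ℕ.suc n , _) full = zero

module Polytope-of {d n} (Svec : Vec (Vec ℤ d) n) (smooth : Smooth (n , Svec))
  (lattice⇔vertex : (x : Point d) → (x ∈P (n , Svec) × IsLatticePoint x) ⇔ Vertex (n , Svec) x) where

  P : LatticePolytope d
  P = n , Svec

  S : Fin n → Funℤ d
  S i j = Vec.lookup (Vec.lookup Svec i) j

  open LatticePoints S
  open Polytope X

  gens-lookup : ∀ i j → Vec.lookup (Vec.lookup (gens P) i) j ≡ X i j
  gens-lookup i j = trans (cong (λ y → Vec.lookup y j) (Vec.lookup-map i embed Svec)) (lookup-embed (Vec.lookup Svec i) j)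

  ∈P⇒hull : ∀ {x} → x ∈P P → Hull X (Vec.lookup x)
  ∈P⇒hull = InConv⇒Hull gens-lookup

  hull⇒∈P : ∀ {x} → Hull X (Vec.lookup x) → x ∈P P
  hull⇒∈P = Hull⇒InConv {X = gens P} gens-lookup

  toPoint-∈P : ∀ {f} → Hull X f → toPoint f ∈P P
  toPoint-∈P {f} h = hull⇒∈P (hull-resp (Vec.lookup∘tabulate f) h)

  vertex : ∀ {z} → V z → Vertex P (toPoint (λ j → ι (z j)))
  vertex {z} vz = Equivalence.to (lattice⇔vertex _) (toPoint-∈P (hull vz) , toPoint-lattice z)

  -- The hypothesis that lattice points are vertices enters here; both `lonely` and the search for
  -- edges rest on it.
  exposed : ∀ z → V z → Exposed (λ j → ι (z j))
  exposed z vz with vertex {z} vz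
  ... | _ , c , h = Vec.lookup c , λ f hf ne → subst₂ ℚ._<_ (dot-toPointʳ c f) (dot-toPointʳ c zℚ)
      (h (toPoint f) (toPoint-∈P hf) (λ e → ne (λ j → trans (sym (Vec.lookup∘tabulate f j))
        (trans (cong (λ y → Vec.lookup y j) e) (Vec.lookup∘tabulate zℚ j)))))
    where
    zℚ : Funℚ d
    zℚ j = ι (z j)

  edge : ∀ {z} a m → V z → IsEdge (λ j → ι (z j)) m a → Edge P (toPoint (λ j → ι (z j))) (toPoint (X m))
  edge {z} a m vz (z≢ , a≡ , a≤ , face) =
    (λ e → z≢ (λ j → trans (sym (Vec.lookup∘tabulate zℚ j)) (trans (cong (λ y → Vec.lookup y j) e) (Vec.lookup∘tabulate (X m) j))))
    , toPoint-∈P (hull vz) , toPoint-∈P (hull-point X m) , toPoint a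
    , trans (dot-toPoint a (X m)) (trans a≡ (sym (dot-toPoint a zℚ)))
    , (λ x x∈ → subst₂ ℚ._≤_ (sym (dot-toPointˡ a x)) (sym (dot-toPoint a zℚ)) (a≤ (Vec.lookup x) (∈P⇒hull x∈)))
    , λ x x∈ e → segment x (face (Vec.lookup x) (∈P⇒hull x∈) (trans (sym (dot-toPointˡ a x)) (trans e (dot-toPoint a zℚ))))
    where
    zℚ : Funℚ d
    zℚ j = ι (z j)
    segment : ∀ x → (∃ λ t → 0ℚ ℚ.≤ t × t ℚ.≤ 1ℚ × (∀ j → Vec.lookup x j ℚ.- zℚ j ≡ t ℚ.* (X m j ℚ.- zℚ j))) →
              InConv (toPoint zℚ ∷ toPoint (X m) ∷ []) x
    segment x (t , t≥0 , t≤1 , e) = InConv-pair t t≥0 t≤1 λ j → begin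
      Vec.lookup x j ℚ.- Vec.lookup (toPoint zℚ) j                            ≡⟨ cong (λ y → Vec.lookup x j ℚ.- y) (Vec.lookup∘tabulate zℚ j) ⟩
      Vec.lookup x j ℚ.- zℚ j                                               ≡⟨ e j ⟩
      t ℚ.* (X m j ℚ.- zℚ j)                                              ≡⟨ cong₂ (λ y w → t ℚ.* (y ℚ.- w)) (Vec.lookup∘tabulate (X m) j) (Vec.lookup∘tabulate zℚ j) ⟨
      t ℚ.* (Vec.lookup (toPoint (X m)) j ℚ.- Vec.lookup (toPoint zℚ) j)      ∎
      where open ≡-Reasoning

  abstract
    -- Smoothness at the vertex `z` supplies the basis `p`. Each listed end is `z` plus a positive
    -- rational multiple of a basis vector, and each edge found by `edge-exists` ends at one of
    -- them, as `frame-of` requires.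
    frame : ∀ v → V v → Frame V v
    frame z vz = frame-at (proj₂ smooth (toPoint zℚ) (vertex {z} vz))
      where
      open ≡-Reasoning
      zℚ : Funℚ d
      zℚ j = ι (z j)
      frame-at : (Σ (Vec (Point d) d) λ w →
        ((i j : Fin d) → Vec.lookup w i ≡ Vec.lookup w j → i ≡ j) ×
        ((u : Point d) → Edge P (toPoint zℚ) u ⇔ Σ (Fin d) λ i → u ≡ Vec.lookup w i) ×
        Σ (Vec (Vec ℤ d) d) λ p →
          ((i : Fin d) → PrimDir (Vec.lookup w i ⊖ toPoint zℚ) (Vec.lookup p i)) × IsBasis p) → Frame V z
      frame-at (w , _ , edges , p , dirs , basis-p) = frame-of exposed {z} vz B nbrs edges′
        where
        B : Basis d
        B = proj₁ (basis p basis-p)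
        direction : ∀ k → ∃ λ l → 0ℚ ℚ.< l × (∀ j → Vec.lookup (Vec.lookup w k) j ℚ.- zℚ j ≡ l ℚ.* ι (Basis.q B k j))
        direction k with dirs k
        ... | _ , l , l>0 , e = l , l>0 , λ j → begin
          Vec.lookup (Vec.lookup w k) j ℚ.- zℚ j                   ≡⟨ cong (λ y → Vec.lookup (Vec.lookup w k) j ℚ.- y) (Vec.lookup∘tabulate zℚ j) ⟨
          Vec.lookup (Vec.lookup w k) j ℚ.- Vec.lookup (toPoint zℚ) j ≡⟨ lookup-⊖ (Vec.lookup w k) (toPoint zℚ) j ⟨
          Vec.lookup (Vec.lookup w k ⊖ toPoint zℚ) j               ≡⟨ cong (λ y → Vec.lookup y j) e ⟩
          Vec.lookup (l • embed (Vec.lookup p k)) j                ≡⟨ Vec.lookup-map j (l ℚ.*_) (embed (Vec.lookup p k)) ⟩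
          l ℚ.* Vec.lookup (embed (Vec.lookup p k)) j              ≡⟨ cong (l ℚ.*_) (lookup-embed (Vec.lookup p k) j) ⟩
          l ℚ.* ι (Vec.lookup (Vec.lookup p k) j)                  ∎
        lem : ∀ x y → y ℚ.+ (x ℚ.- y) ≡ x
        lem = solve-∀ ringℚ
        nbrs : ∀ k → ∃ λ l → 0ℚ ℚ.< l × Hull X (λ j → ι (z j) ℚ.+ l ℚ.* ι (Basis.q B k j))
        nbrs k = proj₁ (direction k) , proj₁ (proj₂ (direction k)) , hull-resp
          (λ j → trans (cong (λ t → zℚ j ℚ.+ t) (sym (proj₂ (proj₂ (direction k)) j))) (lem (Vec.lookup (Vec.lookup w k) j) (zℚ j)))
          (∈P⇒hull (proj₁ (proj₂ (proj₂ (Equivalence.from (edges (Vec.lookup w k)) (k , refl))))))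
        edges′ : ∀ a m → IsEdge zℚ m a → ∃ λ k → ∃ λ l → 0ℚ ℚ.< l × (∀ j → X m j ℚ.- zℚ j ≡ l ℚ.* ι (Basis.q B k j))
        edges′ a m e = along (Equivalence.to (edges (toPoint (X m))) (edge {z} a m vz e))
          where
          along : (Σ (Fin d) λ k → toPoint (X m) ≡ Vec.lookup w k) →
                  ∃ λ k → ∃ λ l → 0ℚ ℚ.< l × (∀ j → X m j ℚ.- zℚ j ≡ l ℚ.* ι (Basis.q B k j))
          along (k , Xm≡) = k , proj₁ (direction k) , proj₁ (proj₂ (direction k)) , λ j →
            trans (cong (ℚ._- zℚ j) (trans (sym (Vec.lookup∘tabulate (X m) j)) (cong (λ y → Vec.lookup y j) Xm≡)))
                  (proj₂ (proj₂ (direction k)) j)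

  base : Fin n
  base = fullDim-nonempty P (proj₁ smooth)

  module D = Decomposition S (lonely exposed) frame (S base) (V-gen base)

-- The lattice equivalence.

subst-toPoint : ∀ {m n} (eq : m ≡ n) (h : Funℚ n) → subst Point (sym eq) (toPoint h) ≡ toPoint (λ k → h (Fin.cast eq k))
subst-toPoint refl h = Vec.tabulate-cong (λ k → cong h (sym (Fin.cast-is-id refl k)))

sum-cast : ∀ {m n} (eq : m ≡ n) (h : Funℤ m) → ℤL.sum {n} (λ k → h (Fin.cast (sym eq) k)) ≡ ℤL.sum h
sum-cast refl h = ℤL.sum-cong-≋ (λ k → cong h (Fin.cast-is-id refl k))

matMul-lookup : ∀ {d} (A B : Mat d) i j → Vec.lookup (Vec.lookup (matMul A B) i) j ≡
  ℤL.sum (λ k → Vec.lookup (Vec.lookup A i) k ℤ.* Vec.lookup (Vec.lookup B k) j)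
matMul-lookup A B i j = trans (cong (λ r → Vec.lookup r j) (Vec.lookup-map i (λ row → zlincomb row B) A)) (zlincomb-lookup (Vec.lookup A i) B j)

module Matrices {d} (B : Basis d) (τ : Fin d → Fin d) (τ-injective : ∀ i j → τ i ≡ τ j → i ≡ j)
  (τ-sum : ∀ (g : Funℤ d) → ℤL.sum (λ k → g (τ k)) ≡ ℤL.sum g) where
  open Basis B
  open BasisChange B

  -- The rows of `A` are the dual basis in the order `τ`, and the columns of the inverse are the
  -- basis in the same order.
  A A⁻¹ : Mat d
  A   = Vec.tabulate (λ k → Vec.tabulate (φ (τ k)))
  A⁻¹ = Vec.tabulate (λ i → Vec.tabulate (λ k → q (τ k) i))

  A-lookup : ∀ k j → Vec.lookup (Vec.lookup A k) j ≡ φ (τ k) j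
  A-lookup k j = trans (cong (λ r → Vec.lookup r j) (Vec.lookup∘tabulate (λ k → Vec.tabulate (φ (τ k))) k)) (Vec.lookup∘tabulate (φ (τ k)) j)

  A⁻¹-lookup : ∀ i k → Vec.lookup (Vec.lookup A⁻¹ i) k ≡ q (τ k) i
  A⁻¹-lookup i k = trans (cong (λ r → Vec.lookup r k) (Vec.lookup∘tabulate (λ i → Vec.tabulate (λ k → q (τ k) i)) i)) (Vec.lookup∘tabulate (λ k → q (τ k) i) k)

  δ-τ : ∀ i j → ℤL.δ (τ i) (τ j) ≡ ℤL.δ i j
  δ-τ i j with i Fin.≟ j
  ... | yes refl = trans (ℤL.δ-refl (τ i)) (sym (ℤL.δ-refl i))
  ... | no i≢j = trans (ℤL.δ-≢ (τ i) (τ j) (λ e → i≢j (τ-injective i j e))) (sym (ℤL.δ-≢ i j i≢j))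

  -- One product is duality, with `τ` injective; the other is the expansion of unit vectors, with
  -- the sum reindexed along `τ`.
  unimodular : Unimodular A
  unimodular = A⁻¹ , vec-ext (λ i → vec-ext (λ j → AA⁻¹ i j)) , vec-ext (λ i → vec-ext (λ j → A⁻¹A i j))
    where
    open ≡-Reasoning
    AA⁻¹ : ∀ i j → Vec.lookup (Vec.lookup (matMul A A⁻¹) i) j ≡ Vec.lookup (Vec.lookup idMat i) j
    AA⁻¹ i j = begin
      Vec.lookup (Vec.lookup (matMul A A⁻¹) i) j   ≡⟨ matMul-lookup A A⁻¹ i j ⟩
      ℤL.sum (λ k → Vec.lookup (Vec.lookup A i) k ℤ.* Vec.lookup (Vec.lookup A⁻¹ k) j) ≡⟨ ℤL.sum-cong-≋ (λ k → cong₂ ℤ._*_ (A-lookup i k) (A⁻¹-lookup k j)) ⟩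
      ⟨ φ (τ i) , q (τ j) ⟩                     ≡⟨ dual (τ i) (τ j) ⟩
      ℤL.δ (τ i) (τ j)                          ≡⟨ δ-τ i j ⟩
      ℤL.δ i j                                  ≡⟨ idMat-lookup i j ⟨
      Vec.lookup (Vec.lookup idMat i) j             ∎
    A⁻¹A : ∀ i j → Vec.lookup (Vec.lookup (matMul A⁻¹ A) i) j ≡ Vec.lookup (Vec.lookup idMat i) j
    A⁻¹A i j = begin
      Vec.lookup (Vec.lookup (matMul A⁻¹ A) i) j   ≡⟨ matMul-lookup A⁻¹ A i j ⟩
      ℤL.sum (λ k → Vec.lookup (Vec.lookup A⁻¹ i) k ℤ.* Vec.lookup (Vec.lookup A k) j) ≡⟨ ℤL.sum-cong-≋ (λ k → cong₂ ℤ._*_ (A⁻¹-lookup i k) (A-lookup k j)) ⟩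
      ℤL.sum (λ k → q (τ k) i ℤ.* φ (τ k) j)    ≡⟨ τ-sum (λ a → q a i ℤ.* φ a j) ⟩
      ℤL.sum (λ a → q a i ℤ.* φ a j)            ≡⟨ δ-expand i j ⟩
      ℤL.δ i j                                  ≡⟨ idMat-lookup i j ⟨
      Vec.lookup (Vec.lookup idMat i) j             ∎

  module _ (v : Funℤ d) where
    -- Minus the image of `v` under `A`, so that `v` goes to the origin.
    t : Vec ℤ d
    t = Vec.tabulate (λ k → ℤ.- ⟨ φ (τ k) , v ⟩)

    applyAff-lookup : ∀ x k → Vec.lookup (applyAff A t x) k ≡
      ⟪ (λ j → ι (φ (τ k) j)) , Vec.lookup x ⟫ ℚ.- ⟪ (λ j → ι (φ (τ k) j)) , (λ j → ι (v j)) ⟫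
    applyAff-lookup x k = trans (Vec.lookup-zipWith ℚ._+_ k (Vec.map (λ row → dot (embed row) x) A) (embed t)) (cong₂ ℚ._+_ linear shift)
      where
      linear : Vec.lookup (Vec.map (λ row → dot (embed row) x) A) k ≡ ⟪ (λ j → ι (φ (τ k) j)) , Vec.lookup x ⟫
      linear = trans (Vec.lookup-map k (λ row → dot (embed row) x) A) (trans (dot-lookup (embed (Vec.lookup A k)) x)
        (ℚL.sum-cong-≋ (λ j → cong (ℚ._* Vec.lookup x j) (trans (lookup-embed (Vec.lookup A k) j) (cong ι (A-lookup k j))))))
      shift : Vec.lookup (embed t) k ≡ ℚ.- ⟪ (λ j → ι (φ (τ k) j)) , (λ j → ι (v j)) ⟫
      shift = trans (lookup-embed t k) (trans (cong ι (Vec.lookup∘tabulate (λ k → ℤ.- ⟨ φ (τ k) , v ⟩) k))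
        (trans (ι-neg ⟨ φ (τ k) , v ⟩) (cong ℚ.-_ (dot-ι (φ (τ k)) v))))

theorem3p30 : (d : ℕ) (P : LatticePolytope d) →
    Smooth P →
    ((x : Point d) → (x ∈P P × IsLatticePoint x) ⇔ Vertex P x) →
    Σ (Mat d) λ A → Unimodular A × Σ (Vec ℤ d) λ t →
    Σ (List ℕ) λ ks → Σ (sum ks ≡ d) λ eq →
    (x : Point d) →
    x ∈P P ⇔ InProdSimplex ks (subst Point (sym eq) (applyAff A t x))
theorem3p30 d (n , Svec) smooth lattice⇔vertex =
  M.A , M.unimodular , M.t (S base) , ks , eq , λ x → mk⇔ (⇒ x) (⇐ x)
  where
  open Polytope-of Svec smooth lattice⇔vertex
  open LatticePoints S using (X; V-gen)
  bs : List (List (Fin d))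
  bs = D.decomposition
  ks : List ℕ
  ks = List.map List.length bs
  ρ : Vec (Fin d) (sum ks)
  ρ = index bs
  ρ-↭ : Vec.toList ρ ↭ List.allFin d
  ρ-↭ = subst (_↭ List.allFin d) (sym (toList-index bs)) D.decomposition-↭
  unique-concat : Unique (List.concat bs)
  unique-concat = unique-resp-↭ (↭-sym D.decomposition-↭) (allFin⁺ d)
  ρ-unique : Unique (Vec.toList ρ)
  ρ-unique = unique-resp-↭ (↭-sym ρ-↭) (allFin⁺ d)
  eq : sum ks ≡ d
  eq = trans (sym (Vec.length-toList ρ)) (trans (Perm.↭-length ρ-↭) (List.length-tabulate (λ i → i)))
  -- The cast is forced by `eq`: `ρ` has length `sum ks`, which equals `d` only propositionally.
  τ : Fin d → Fin d
  τ k = Vec.lookup ρ (Fin.cast (sym eq) k)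
  τ-injective : ∀ i j → τ i ≡ τ j → i ≡ j
  τ-injective i j e = trans (sym (Fin.cast-involutive eq (sym eq) i))
    (trans (cong (Fin.cast eq) (lookup-unique ρ ρ-unique _ _ e)) (Fin.cast-involutive eq (sym eq) j))
  module M = Matrices (Frame.lattice-basis (frame (S base) (V-gen base))) τ τ-injective
    (λ g → trans (sum-cast eq (λ k → g (Vec.lookup ρ k))) (ℤS.sum-reindex ρ ρ-↭ g))
  -- The transport along `eq` undoes the cast in `τ`. What remains are the heights in the order of
  -- `ρ`, the form in which blocks and product are compared.
  image : ∀ x → subst Point (sym eq) (applyAff M.A (M.t (S base)) x) ≡ Vec.map (D.height (Vec.lookup x)) ρ
  image x = begin
    subst Point (sym eq) (applyAff M.A (M.t (S base)) x)      ≡⟨ cong (subst Point (sym eq)) (sym (Vec.tabulate∘lookup _)) ⟩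
    subst Point (sym eq) (toPoint (Vec.lookup (applyAff M.A (M.t (S base)) x)))
      ≡⟨ cong (subst Point (sym eq)) (Vec.tabulate-cong (M.applyAff-lookup (S base) x)) ⟩
    subst Point (sym eq) (toPoint (λ k → D.height (Vec.lookup x) (τ k)))   ≡⟨ subst-toPoint eq (λ k → D.height (Vec.lookup x) (τ k)) ⟩
    toPoint (λ k → D.height (Vec.lookup x) (τ (Fin.cast eq k)))
      ≡⟨ Vec.tabulate-cong (λ k → cong (λ i → D.height (Vec.lookup x) (Vec.lookup ρ i)) (Fin.cast-involutive (sym eq) eq k)) ⟩
    toPoint (λ k → D.height (Vec.lookup x) (Vec.lookup ρ k))      ≡⟨ Vec.tabulate-∘ (D.height (Vec.lookup x)) (Vec.lookup ρ) ⟩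
    Vec.map (D.height (Vec.lookup x)) (Vec.tabulate (Vec.lookup ρ))   ≡⟨ cong (Vec.map (D.height (Vec.lookup x))) (Vec.tabulate∘lookup ρ) ⟩
    Vec.map (D.height (Vec.lookup x)) ρ                           ∎
    where open ≡-Reasoning
  ⇒ : ∀ x → x ∈P (n , Svec) → InProdSimplex ks (subst Point (sym eq) (applyAff M.A (M.t (S base)) x))
  ⇒ x x∈ = subst (InProdSimplex ks) (sym (image x)) (blocks⇒product (D.height (Vec.lookup x)) bs
    (All.zipWith {P = Unique} {Q = D.SameClass} (λ (u , same) → D.hull⇒block u same (∈P⇒hull x∈)) (unique-concat⁻ bs unique-concat , D.blocks-same (List.allFin d))))
  ⇐ : ∀ x → InProdSimplex ks (subst Point (sym eq) (applyAff M.A (M.t (S base)) x)) → x ∈P (n , Svec)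
  ⇐ x p = hull⇒∈P (D.blocks⇒hull-height (product⇒blocks (D.height (Vec.lookup x)) bs (subst (InProdSimplex ks) (image x) p)))
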